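{- Let $r$ be a positive integer. For any $r$-core $\gamma$ and any $m,n\in\mathbb{N}$, there is a bijection between the $m\times n$ matrices $A=(A_{i,j})_{0\le i<m,\,0\le j<n}$ with entries in $\{0,1\}^r$, and the pairs $(P,Q)$ consisting of a semistandard $r$-ribbon tableau $P$ (with $n$ steps) and a transpose semistandard $r$-ribbon tableau $Q$ (with $m$ steps) of equal shape $\lambda/\gamma$ for some partition $\lambda$, such that whenever $A$ corresponds to $(P,Q)$ one has $$\mathrm{wt}(P)=\Bigl(\sum_{i=0}^{m-1}|A_{i,j}|\Bigr)_{0\le j<n},\qquad \mathrm{wt}(Q)=\Bigl(\sum_{j=0}^{n-1}|A_{i,j}|\Bigr)_{0\le i<m},$$ and in addition $$\mathrm{spin}(P)+\mathrm{spin}^{\mathrm t}(Q)=\sum_{i=0}^{m-1}\sum_{j=0}^{n-1}\mathrm{n}(A_{i,j}).$$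
   Context: For $a=(a_0,\dots,a_{r-1})\in\{0,1\}^r$ put $|a|=\sum_{i=0}^{r-1}a_i$ and $\mathrm{n}(a)=\sum_{i=0}^{r-1}i\,a_i$. Partitions are identified with their Young diagrams (square $(i,j)$ in row $i$, column $j$, both numbered from $0$; rows numbered downwards). Diagonal $d_k$ is $\{(i,j):j-i=k\}$. For $\lambda\subset\mu$, $\mu/\lambda$ is an $r$-ribbon (written $\lambda\prec_r\mu$) if the skew diagram consists of exactly one square on each of $r$ consecutive diagonals; its head is its top-rightmost square, and its height is one less than the number of rows it meets. An $r$-core is a partition from which no $r$-ribbon can be removed. $\mu/\lambda$ is a horizontal (respectively vertical) $r$-ribbon strip, written $\lambda\leftharpoondown_r\mu$ (respectively $\lambda\leftharpoonup_r\mu$), if there is a (possibly trivial) chain $\lambda=\lambda^{(0)}\prec_r\cdots\prec_r\lambda^{(p)}=\mu$ such that, with $d_{k_t}$ the diagonal containing the head of $\lambda^{(t)}/\lambda^{(t-1)}$, one has $k_1<k_2<\cdots<k_p$ (respectively $k_1>k_2>\cdots>k_p$). Such a chain is unique and called the standardisation of $\mu/\lambda$ as a horizontal (respectively vertical) $r$-ribbon strip. In either case $|\mu/\lambda|_r=p$, and $\mathrm{spin}(\mu/\lambda)$ (respectively $\mathrm{spin}^{\mathrm t}(\mu/\lambda)$) is half the sum of the heights of the ribbons in that standardisation. A semistandard (respectively transpose semistandard) $r$-ribbon tableau of shape $\lambda/\gamma$ with $n$ steps is a sequence $\gamma=\lambda^0,\lambda^1,\dots,\lambda^n=\lambda$ with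 $\lambda^j\leftharpoondown_r\lambda^{j+1}$ (respectively $\lambda^j\leftharpoonup_r\lambda^{j+1}$) for $0\le j<n$ (repetitions allowed). Its weight $\mathrm{wt}$ is $(|\lambda^{j+1}/\lambda^j|_r)_{0\le j<n}$, and its $\mathrm{spin}$ (respectively $\mathrm{spin}^{\mathrm t}$) is the sum over $0\le j<n$ of $\mathrm{spin}(\lambda^{j+1}/\lambda^j)$ (respectively $\mathrm{spin}^{\mathrm t}(\lambda^{j+1}/\lambda^j)$). -}

module Defs where

open import Data.Fin.Base using (Fin; toℕ)
open import Data.Integer.Base as ℤ using (ℤ; _⊖_)
open import Data.List.Base as List using (List; []; _∷_; filter; length; upTo)
open import Data.List.Relation.Unary.All using (All)
open import Data.List.Relation.Unary.Linked using (Linked)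
open import Data.Nat.Base using (ℕ; zero; suc; pred; _*_; _<_; _≤_; _≥_)
open import Data.Nat.ListAction renaming (sum to sumᴸ)
open import Data.Nat.Properties using (_<?_; +-0-commutativeMonoid)
open import Data.Product using (Σ-syntax; _×_; _,_; proj₁; proj₂; ∃!)
open import Data.Rational.Base as ℚ using (ℚ; 0ℚ)
open import Data.Vec.Base as Vec using (Vec; []; _∷_; lookup)
open import Level using (0ℓ)
open import Relation.Binary.Bundles using (Setoid)
open import Relation.Binary.Core using (Rel)
import Relation.Binary.Construct.On as On
open import Relation.Binary.Construct.Closure.ReflexiveTransitive using (Star; ε; _◅_)
open import Relation.Binary.PropositionalEquality using (_≡_; setoid)
open import Relation.Nullary.Negation using (¬_)

open import Algebra.Properties.CommutativeMonoid.Sum +-0-commutativeMonoid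
  using (sum-syntax) public

BitVec : ℕ → Set
BitVec r = Vec (Fin 2) r

∣_∣ : ∀ {r} → BitVec r → ℕ
∣_∣ {r} a = ∑[ i < r ] toℕ (lookup a i)

𝐧 : ∀ {r} → BitVec r → ℕ
𝐧 {r} a = ∑[ i < r ] (toℕ i * toℕ (lookup a i))

Matrix : ℕ → ℕ → ℕ → Set
Matrix r m n = Vec (Vec (BitVec r) n) m

infix 25 _[_,_]

_[_,_] : ∀ {r m n} → Matrix r m n → Fin m → Fin n → BitVec r
A [ i , j ] = lookup (lookup A i) j

record Partition : Set where
  constructor mkPartition
  field
    parts    : List ℕ
    sorted   : Linked _≥_ parts
    positive : All (0 <_) parts

open Partition public

part : List ℕ → ℕ → ℕ
part []       _       = 0
part (x ∷ xs) zero    = x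
part (x ∷ xs) (suc i) = part xs i

row : Partition → ℕ → ℕ
row μ i = part (parts μ) i

-- (row , column)
Square : Set
Square = ℕ × ℕ

diagonal : Square → ℤ
diagonal (i , j) = j ⊖ i

infix 4 _∈_ _∈_∖_ _⊆_ _≺[_]_

_∈_ : Square → Partition → Set
(i , j) ∈ μ = j < row μ i

_⊆_ : Rel Partition 0ℓ
ν ⊆ μ = ∀ {s} → s ∈ ν → s ∈ μ

_∈_∖_ : Square → Partition → Partition → Set
s ∈ μ ∖ ν = s ∈ μ × ¬ (s ∈ ν)

record _≺[_]_ (ν : Partition) (r : ℕ) (μ : Partition) : Set where
  field
    contained : ν ⊆ μ
    -- the r diagonals met are start, start + 1, …, start + (r - 1)
    start     : ℤ
    one       : ∀ (t : Fin r) →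
                ∃! _≡_ λ s → s ∈ μ ∖ ν × diagonal s ≡ start ℤ.+ ℤ.+ toℕ t
    noOther   : ∀ s → s ∈ μ ∖ ν →
                Σ[ t ∈ Fin r ] diagonal s ≡ start ℤ.+ ℤ.+ toℕ t

IsCore : ℕ → Partition → Set
IsCore r μ = ∀ ν → ¬ (ν ≺[ r ] μ)

record IsHead (ν μ : Partition) (h : Square) : Set where
  field
    inside    : h ∈ μ ∖ ν
    topmost   : ∀ s → s ∈ μ ∖ ν → proj₁ h ≤ proj₁ s
    rightmost : ∀ s → s ∈ μ ∖ ν → proj₂ s ≤ proj₂ h

-- For ν ⊆ μ, the skew diagram μ / ν meets row i exactly when row ν i < row μ i.
height : Partition → Partition → ℕ
height ν μ =
  pred (length (filter (λ i → row ν i <? row μ i) (upTo (length (parts μ)))))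

record RibbonStep (r : ℕ) (ν μ : Partition) : Set where
  field
    ribbon : ν ≺[ r ] μ
    head   : Square
    isHead : IsHead ν μ head

Chain : ℕ → Rel Partition 0ℓ
Chain r = Star (RibbonStep r)

headDiagonals : ∀ {r ν μ} → Chain r ν μ → List ℤ
headDiagonals ε       = []
headDiagonals (x ◅ c) = diagonal (RibbonStep.head x) ∷ headDiagonals c

heights : ∀ {r ν μ} → Chain r ν μ → List ℕ
heights ε                         = []
heights (_◅_ {i = ν} {j = κ} _ c) = height ν κ ∷ heights c

-- Ribbon strips carry their standardisation, along which the diagonals of the
-- heads are to be monotone for _⊏_: increasing for horizontal strips,
-- decreasing for vertical ones.

record Strip (_⊏_ : Rel ℤ 0ℓ) (r : ℕ) (ν μ : Partition) : Set where
  field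
    standardisation : Chain r ν μ
    monotone        : Linked _⊏_ (headDiagonals standardisation)

open Strip public

HorizontalStrip VerticalStrip : ℕ → Rel Partition 0ℓ
HorizontalStrip = Strip ℤ._<_
VerticalStrip   = Strip ℤ._>_

stripSize : ∀ {_⊏_ r ν μ} → Strip _⊏_ r ν μ → ℕ
stripSize s = length (headDiagonals (standardisation s))

stripSpin : ∀ {_⊏_ r ν μ} → Strip _⊏_ r ν μ → ℚ
stripSpin s = ℤ.+ sumᴸ (heights (standardisation s)) ℚ./ 2

infixr 5 _∷_

data Tableau (_⊏_ : Rel ℤ 0ℓ) (r : ℕ) : ℕ → Partition → Partition → Set where
  []  : ∀ {γ} → Tableau _⊏_ r 0 γ γ
  _∷_ : ∀ {n γ κ μ} → Strip _⊏_ r γ κ → Tableau _⊏_ r n κ μ →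
        Tableau _⊏_ r (suc n) γ μ

SemistandardTableau TransposeSemistandardTableau :
  (r n : ℕ) (γ μ : Partition) → Set
SemistandardTableau          = Tableau ℤ._<_
TransposeSemistandardTableau = Tableau ℤ._>_

shapes : ∀ {_⊏_ r n γ μ} → Tableau _⊏_ r n γ μ → Vec Partition (suc n)
shapes {γ = γ} []      = γ ∷ []
shapes {γ = γ} (_ ∷ T) = γ ∷ shapes T

wt : ∀ {_⊏_ r n γ μ} → Tableau _⊏_ r n γ μ → Vec ℕ n
wt []      = []
wt (s ∷ T) = stripSize s ∷ wt T

spin : ∀ {_⊏_ r n γ μ} → Tableau _⊏_ r n γ μ → ℚ
spin []      = 0ℚ
spin (s ∷ T) = stripSpin s ℚ.+ spin T

TableauPair : (r m n : ℕ) → Partition → Set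
TableauPair r m n γ =
  Σ[ μ ∈ Partition ]
    SemistandardTableau r n γ μ × TransposeSemistandardTableau r m γ μ

-- A tableau is a sequence of partitions, so pairs of tableaux are compared
-- through these sequences only, disregarding the recorded standardisations.
TableauPairs : (r m n : ℕ) → Partition → Setoid 0ℓ 0ℓ
TableauPairs r m n γ =
  On.setoid {B = TableauPair r m n γ}
    (setoid (Vec Partition (suc n) × Vec Partition (suc m)))
    (λ (_ , P , Q) → shapes P , shapes Q)

{-# OPTIONS --safe #-}
-- Read a partition ν as beads on ℤ, row i contributing a bead at row ν i − i − 1.
-- Adding an r-ribbon makes a bead jump from p to p + r; the head of the ribbon
-- lies on diagonal p + r and its height is the number of beads jumped over.  A
-- horizontal strip is thus a pass over the beads from left to right with a queue
-- of r bits, and so is, on the complementary bits, the undoing of a vertical strip.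
--
-- For the local rule fix β and γ.  If α → β is a horizontal and α → γ a vertical
-- strip, or γ → δ a horizontal and β → δ a vertical one, then the moves made by
-- just one of the two strips, and a bit sequence w recording the queues, depend
-- on β and γ only.  The number of beads of w in [q , q + r) goes from r to 0 by
-- unit steps; the possible α correspond to the sets of ascents of this walk, at
-- which both strips α → β and α → γ move, and the possible δ to the sets of
-- descents.  On each level h < r descents and ascents alternate, starting and
-- ending with a descent, so that shifting the chosen ascents to the next descent
-- leaves on each level one bit free: this is the entry of the matrix.  The jumps
-- made at level h have height h, up to corrections that cancel between the two
-- strips, which gives the spin statistic.  The bijection then is a growth diagram,
-- run backwards as well as forwards because nothing lies below a core.
module Submission where

-- The obstacle is that the ribbons of a strip interact: one may become available only after another
-- has been added. Recording at each position the bit that the pass finds there turns a strip into a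
-- condition tying `q` to `q + r` alone, with no order of moves left in it. In these terms `w q` is
-- the bead of α at `q` after the horizontal arrivals at `q` and the vertical departures from `q`,
-- and it is equally the bead of δ at `q` before the horizontal departures and the vertical
-- arrivals. The moves made by one strip only are the differences both of β from `w` at `q` and of γ
-- from `w` at `q + r`; hence β and γ determine `w` by a recursion of width `r` that starts on the
-- far left. All identities of the local rule then concern a few bits and are checked by evaluation.
-- Matching ascents with descents is a bracketing and is done by a stack, as high as the window has
-- beads. It holds `r` bits on the far left, where the window is full; bit `i` of the entry has `i`
-- others beneath it, which is where its coefficient in `𝐧` comes from.

module RibbonCorrespondence where

  open import Defs
  open import Data.Bool.Base using (Bool; true; false; not; _∧_; _∨_; _xor_; if_then_else_)
  import Data.Bool.Properties as Boolₚ
  open import Data.Fin.Base using (Fin; zero; suc; toℕ; fromℕ<)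
  import Data.Fin.Properties as Finₚ
  open import Data.Integer.Base as ℤ using (ℤ; +_; -[1+_]; _⊖_)
  import Algebra.Properties.AbelianGroup as AbelianGroupₚ
  import Data.Integer.Properties as ℤₚ
  open import Data.List.Base as List using (List; []; _∷_; filter; length; applyUpTo)
  import Data.List.Properties as Listₚ
  open import Data.Nat.ListAction renaming (sum to sumᴸ)
  open import Data.List.Relation.Unary.All as All using (All; []; _∷_)
  open import Data.List.Relation.Unary.Linked as Linked using (Linked; []; [-]; _∷_)
  open import Data.Nat.Base as ℕ using (ℕ; zero; suc; pred; _+_; _*_; _∸_; _≤_; _<_; _≥_; z≤n; s≤s)
  import Data.Nat.Properties as ℕₚ
  open import Algebra.Properties.CommutativeMonoid.Sum ℕₚ.+-0-commutativeMonoid using (sum-cong-≗)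
  import Data.Nat.Solver as ℕSolver
  open import Data.Product using (Σ-syntax; ∃-syntax; _×_; _,_; proj₁; proj₂)
  open import Data.Rational.Base as ℚ using (ℚ)
  import Data.Integer.Solver as ℤSolver
  import Data.Rational.Properties as ℚₚ
  import Data.Rational.Unnormalised.Base as ℚᵘ
  import Data.Rational.Unnormalised.Properties as ℚᵘₚ
  open import Data.Sum.Base using (inj₁; inj₂)
  open import Data.Unit.Base using (⊤; tt)
  open import Data.Vec.Base as Vec using (Vec; []; _∷_; lookup; tabulate)
  import Data.Vec.Properties as Vecₚ
  open import Function.Base using (_∘_; case_of_; id)
  open import Function.Bundles using (Bijection)
  open import Relation.Binary.Bundles using (Setoid)
  open import Relation.Binary.Construct.Closure.ReflexiveTransitive using (ε; _◅_)
  open import Relation.Binary.Definitions using (tri<; tri≈; tri>)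
  open import Relation.Binary.PropositionalEquality hiding ([_])
  open import Relation.Nullary using (¬_; Dec; yes; no; does; contradiction)
  open import Relation.Nullary.Decidable using (dec-true; dec-false)

  -- Integers

  infixl 6 _⊹_

  _⊹_ : ℤ → ℕ → ℤ
  k ⊹ n = k ℤ.+ + n

  ⊹-assoc : ∀ k m n → k ⊹ m ⊹ n ≡ k ⊹ (m + n)
  ⊹-assoc k m n = ℤₚ.+-assoc k (+ m) (+ n)

  ⊹-identityʳ : ∀ k → k ⊹ 0 ≡ k
  ⊹-identityʳ = ℤₚ.+-identityʳ

  ⊹-suc : ∀ k n → k ⊹ 1 ⊹ n ≡ k ⊹ suc n
  ⊹-suc k = ⊹-assoc k 1

  ⊹-suc′ : ∀ k n → k ⊹ n ⊹ 1 ≡ k ⊹ suc n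
  ⊹-suc′ k n = trans (⊹-assoc k n 1) (cong (k ⊹_) (ℕₚ.+-comm n 1))

  ⊹-comm : ∀ k m n → k ⊹ m ⊹ n ≡ k ⊹ n ⊹ m
  ⊹-comm k m n =
    trans (⊹-assoc k m n) (trans (cong (k ⊹_) (ℕₚ.+-comm m n)) (sym (⊹-assoc k n m)))

  ⊹-cancelʳ : ∀ n {k l} → k ⊹ n ≡ l ⊹ n → k ≡ l
  ⊹-cancelʳ n {k} {l} e = AbelianGroupₚ.∙-cancelʳ ℤₚ.+-0-abelianGroup (+ n) k l e

  ⊹-cancelˡ : ∀ k {m n} → k ⊹ m ≡ k ⊹ n → m ≡ n
  ⊹-cancelˡ k {m} {n} e = ℤₚ.+-injective (AbelianGroupₚ.∙-cancelˡ ℤₚ.+-0-abelianGroup k (+ m) (+ n) e)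

  k≢k⊹suc : ∀ k n → k ≢ k ⊹ suc n
  k≢k⊹suc k n e = ℕₚ.0≢1+n (⊹-cancelˡ k (trans (⊹-identityʳ k) e))

  minus-⊹ : ∀ k n → (k ℤ.- + n) ⊹ n ≡ k
  minus-⊹ k n = trans (ℤₚ.+-assoc k (ℤ.- + n) (+ n))
    (trans (cong (λ d → k ℤ.+ d) (ℤₚ.+-inverseˡ (+ n))) (ℤₚ.+-identityʳ k))

  ⊖-⊹ : ∀ j i → (j ⊖ i) ⊹ i ≡ + j
  ⊖-⊹ j i = trans (cong (_⊹ i) (sym (ℤₚ.m-n≡m⊖n j i))) (minus-⊹ (+ j) i)

  data Side (p : ℤ) : ℤ → Set where
    after  : ∀ j → Side p (p ⊹ j)
    before : ∀ {k} j → p ≡ k ⊹ suc j → Side p k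

  side : ∀ p k → Side p k
  side p k with k ℤ.- p in e
  ... | + j = subst (Side p) eq (after j)
    where
    eq : p ⊹ j ≡ k
    eq = trans (cong (λ d → p ℤ.+ d) (sym e))
           (trans (ℤₚ.+-comm p _) (trans (ℤₚ.+-assoc k (ℤ.- p) p)
             (trans (cong (λ d → k ℤ.+ d) (ℤₚ.+-inverseˡ p)) (ℤₚ.+-identityʳ k))))
  ... | -[1+ j ] = before j eq
    where
    eq : p ≡ k ⊹ suc j
    eq = trans (sym (minus-⊹ p (suc j))) (cong (_⊹ suc j)
           (trans (cong (λ d → p ℤ.+ d) (sym e))
           (trans (ℤₚ.+-comm p _) (trans (ℤₚ.+-assoc k (ℤ.- p) p)
             (trans (cong (λ d → k ℤ.+ d) (ℤₚ.+-inverseˡ p)) (ℤₚ.+-identityʳ k))))))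

  ⊹-monoʳ-< : ∀ k {m n} → m < n → k ⊹ m ℤ.< k ⊹ n
  ⊹-monoʳ-< k m<n = ℤₚ.+-monoʳ-< k (ℤ.+<+ m<n)

  ⊹-monoʳ-≤ : ∀ k {m n} → m ≤ n → k ⊹ m ℤ.≤ k ⊹ n
  ⊹-monoʳ-≤ k m≤n = ℤₚ.+-monoʳ-≤ k (ℤ.+≤+ m≤n)

  k≤k⊹n : ∀ k n → k ℤ.≤ k ⊹ n
  k≤k⊹n k n = subst (ℤ._≤ k ⊹ n) (⊹-identityʳ k) (⊹-monoʳ-≤ k z≤n)

  k<k⊹suc : ∀ k n → k ℤ.< k ⊹ suc n
  k<k⊹suc k n = subst (ℤ._< k ⊹ suc n) (⊹-identityʳ k) (⊹-monoʳ-< k (s≤s z≤n))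

  <⇒⊹ : ∀ {k l} → k ℤ.< l → ∃[ j ] l ≡ k ⊹ suc j
  <⇒⊹ {k} {l} k<l with side l k
  ... | after j    = contradiction k<l (ℤₚ.≤⇒≯ (k≤k⊹n l j))
  ... | before j e = j , e

  ≤⇒⊹ : ∀ {k l} → k ℤ.≤ l → ∃[ j ] l ≡ k ⊹ j
  ≤⇒⊹ {k} {l} k≤l with side k l
  ... | after j    = j , refl
  ... | before j e = contradiction k≤l (ℤₚ.<⇒≱ (subst (l ℤ.<_) (sym e) (k<k⊹suc l j)))

  isNeg : ℤ → Bool
  isNeg (+ _)    = false
  isNeg -[1+ _ ] = true

  ⊖-negative : ∀ {m a} → m ≤ a → m ⊖ suc a ≡ -[1+ a ∸ m ]
  ⊖-negative {m} {a} m≤a =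
    trans (ℤₚ.⊖-≤ (ℕₚ.m≤n⇒m≤1+n m≤a)) (cong (λ d → ℤ.- + d) (ℕₚ.+-∸-assoc 1 m≤a))

  far-⊹ : ∀ n m q → n + m < ℤ.∣ q ∣ → n < ℤ.∣ q ⊹ m ∣ × isNeg (q ⊹ m) ≡ isNeg q
  far-⊹ n m (+ a) lt = ℕₚ.≤-trans (s≤s (ℕₚ.m≤m+n n m)) (ℕₚ.≤-trans lt (ℕₚ.m≤m+n a m)) , refl
  far-⊹ n m -[1+ a ] (s≤s lt)
    rewrite ⊖-negative (ℕₚ.≤-trans (ℕₚ.m≤n+m m n) lt) =
    s≤s (ℕₚ.m+n≤o⇒m≤o∸n n lt) , refl

  far-⊹⁻ : ∀ n m q → n + m < ℤ.∣ q ⊹ m ∣ → n < ℤ.∣ q ∣ × isNeg (q ⊹ m) ≡ isNeg q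
  far-⊹⁻ n m (+ a) lt = ℕₚ.+-cancelʳ-< m n a lt , refl
  far-⊹⁻ n m -[1+ a ] lt with ℕₚ.≤-<-connex m a
  ... | inj₁ m≤a rewrite ⊖-negative m≤a =
    ℕₚ.≤-trans (s≤s (ℕₚ.m≤m+n n m)) (ℕₚ.≤-trans lt (s≤s (ℕₚ.m∸n≤m a m))) , refl
  ... | inj₂ a<m rewrite ℤₚ.⊖-≥ {m} {suc a} a<m =
    contradiction (ℕₚ.≤-trans lt (ℕₚ.m∸n≤m m (suc a))) (ℕₚ.<⇒≱ (s≤s (ℕₚ.m≤n+m m n)))

  -- The surplus `e` makes room for a step width: `suc (∣ q ∣ + n)` steps to the left, of any
  -- positive width, lead beyond `n` on the negative side.
  minus-negative : ∀ q n e → ∃[ j ] n ≤ j × q ℤ.- + (suc (ℤ.∣ q ∣ + n) + e) ≡ -[1+ j ]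
  minus-negative (+ a) n e = n + e , ℕₚ.m≤m+n n e ,
    trans (⊖-negative {a} {a + n + e} (ℕₚ.≤-trans (ℕₚ.m≤m+n a n) (ℕₚ.m≤m+n (a + n) e)))
      (cong -[1+_] (trans (cong (_∸ a) (ℕₚ.+-assoc a n e)) (ℕₚ.m+n∸m≡n a (n + e))))
  minus-negative -[1+ a ] n e = suc (a + (suc a + n + e)) ,
    ℕₚ.≤-trans (ℕₚ.m≤n+m n (suc a)) (ℕₚ.≤-trans (ℕₚ.m≤m+n (suc a + n) e)
      (ℕₚ.m≤n⇒m≤1+n (ℕₚ.m≤n+m _ a))) , refl

  module _ (P : ℤ → Set) (n : ℕ) where

    -- ℤ has no least element, so the induction starts wherever the claim is known far to the left.
    -- The width `suc s` is `r` for flows, which tie `q` only to `q + r`, and 1 for stacks.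
    ascending : ∀ s → (∀ q → n < ℤ.∣ q ∣ → isNeg q ≡ true → P q) →
                (∀ q → P q → P (q ⊹ suc s)) → ∀ q → P q
    ascending s base step q with minus-negative q n (suc (ℤ.∣ q ∣ + n) * s)
    ... | j , n≤j , eq = descend (suc (ℤ.∣ q ∣ + n)) q
        (subst P (sym (trans (cong (λ d → q ℤ.- + d) (ℕₚ.*-suc (suc (ℤ.∣ q ∣ + n)) s)) eq))
          (base -[1+ j ] (s≤s n≤j) refl))
      where
      descend : ∀ m q → P (q ℤ.- + (m * suc s)) → P q
      descend zero q Pq = subst P (ℤₚ.+-identityʳ q) Pq
      descend (suc m) q Pq = subst P (minus-⊹ q (suc s))
        (step _ (descend m (q ℤ.- + suc s) (subst P eq′ Pq)))
        where
        eq′ : q ℤ.- + (suc s + m * suc s) ≡ q ℤ.- + suc s ℤ.- + (m * suc s)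
        eq′ = trans (cong (λ d → q ℤ.+ d) (ℤₚ.neg-distrib-+ (+ suc s) (+ (m * suc s))))
                    (sym (ℤₚ.+-assoc q _ _))

    descending : (∀ q → n < ℤ.∣ q ∣ → isNeg q ≡ false → P q) →
                 (∀ q → P (q ⊹ 1) → P q) → ∀ q → P q
    descending base step q = climb (suc (ℤ.∣ q ∣ + n)) q (far q)
      where
      climb : ∀ m q → P (q ⊹ m) → P q
      climb zero q Pq = subst P (⊹-identityʳ q) Pq
      climb (suc m) q Pq = step q (climb m (q ⊹ 1) (subst P (sym (⊹-suc q m)) Pq))
      far : ∀ q → P (q ⊹ suc (ℤ.∣ q ∣ + n))
      far (+ a) = base _ (ℕₚ.≤-trans (s≤s (ℕₚ.m≤n+m n a)) (ℕₚ.m≤n+m _ a)) refl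
      far -[1+ a ] = base _
        (subst (n <_) (sym (cong ℤ.∣_∣ eq)) (ℕₚ.n<1+n n)) (cong isNeg eq)
        where
        eq : suc (suc a + n) ⊖ suc a ≡ + suc n
        eq = trans (ℤₚ.⊖-≥ (s≤s (ℕₚ.≤-trans (ℕₚ.m≤m+n a n) (ℕₚ.n≤1+n _))))
          (cong +_ (trans (cong (_∸ a) (sym (ℕₚ.+-suc a n))) (ℕₚ.m+n∸m≡n a (suc n))))

  -- Partitions as configurations of beads

  # : Bool → ℕ
  # true  = 1
  # false = 0

  part-≤-head : ∀ {x xs} → Linked _≥_ (x ∷ xs) → ∀ i → part xs i ≤ x
  part-≤-head {xs = []}    _         i       = z≤n
  part-≤-head {xs = _ ∷ _} (y≤x ∷ _) zero    = y≤x
  part-≤-head {xs = _ ∷ _} (y≤x ∷ l) (suc i) = ℕₚ.≤-trans (part-≤-head l i) y≤x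

  -- depth λ k is the number of rows i with k + i < row λ i, that is, the row in
  -- which diagonal k leaves the diagram.
  depthᴸ : List ℕ → ℤ → ℕ
  depthᴸ []       (+ n)    = 0
  depthᴸ []       -[1+ n ] = suc n
  depthᴸ (x ∷ xs) k        = # (does (k ℤₚ.<? + x)) + depthᴸ xs (k ⊹ 1)

  depth : Partition → ℤ → ℕ
  depth ν = depthᴸ (parts ν)

  -- Rows decrease weakly, so `k + i` minus row `i` increases strictly with `i`: the rows counted by
  -- the depth are the first ones. Rows past the last part count with length 0, whence the value of
  -- `depthᴸ` on the empty list.
  depthᴸ-sound : ∀ {xs} → Linked _≥_ xs → ∀ k i → i < depthᴸ xs k → k ⊹ i ℤ.< + part xs i
  depthᴸ-sound {[]} _ -[1+ n ] i (s≤s i≤n) rewrite ⊖-negative i≤n = ℤ.-<+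
  depthᴸ-sound {x ∷ xs} l k i i<d with k ℤₚ.<? + x
  depthᴸ-sound {x ∷ xs} l k zero i<d | yes k<x = subst (ℤ._< + x) (sym (⊹-identityʳ k)) k<x
  depthᴸ-sound {x ∷ xs} l k (suc i) (s≤s i<d) | yes k<x =
    subst (ℤ._< + part xs i) (⊹-suc k i) (depthᴸ-sound (Linked.tail l) (k ⊹ 1) i i<d)
  depthᴸ-sound {x ∷ xs} l k i i<d | no k≮x = contradiction
    (ℤₚ.≤-<-trans (ℤₚ.≤-trans (k≤k⊹n k 1) (k≤k⊹n _ i))
      (ℤₚ.<-≤-trans (depthᴸ-sound (Linked.tail l) (k ⊹ 1) i i<d) (ℤ.+≤+ (part-≤-head l i))))
    k≮x

  depthᴸ-complete : ∀ {xs} → Linked _≥_ xs → ∀ k i → k ⊹ i ℤ.< + part xs i → i < depthᴸ xs k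
  depthᴸ-complete {[]} _ -[1+ n ] i lt with ℕₚ.<-≤-connex i (suc n)
  ... | inj₁ i<1+n = i<1+n
  ... | inj₂ n<i rewrite ℤₚ.⊖-≥ {i} {suc n} n<i = contradiction lt λ { (ℤ.+<+ ()) }
  depthᴸ-complete {[]} _ (+ n) i (ℤ.+<+ ())
  depthᴸ-complete {x ∷ xs} l k i lt with k ℤₚ.<? + x
  depthᴸ-complete {x ∷ xs} l k zero lt | yes k<x = s≤s z≤n
  depthᴸ-complete {x ∷ xs} l k (suc i) lt | yes k<x = s≤s (depthᴸ-complete (Linked.tail l) (k ⊹ 1) i
    (subst (ℤ._< + part xs i) (sym (⊹-suc k i)) lt))
  depthᴸ-complete {x ∷ xs} l k zero lt | no k≮x =
    contradiction (subst (ℤ._< + x) (⊹-identityʳ k) lt) k≮x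
  depthᴸ-complete {x ∷ xs} l k (suc i) lt | no k≮x = contradiction
    (ℤₚ.≤-<-trans (k≤k⊹n k (suc i)) (ℤₚ.<-≤-trans lt (ℤ.+≤+ (part-≤-head l i)))) k≮x

  depth-sound : ∀ ν k i → i < depth ν k → k ⊹ i ℤ.< + row ν i
  depth-sound ν = depthᴸ-sound (sorted ν)

  depth-complete : ∀ ν k i → k ⊹ i ℤ.< + row ν i → i < depth ν k
  depth-complete ν = depthᴸ-complete (sorted ν)

  ≤-by-< : ∀ {a b} → (∀ i → i < a → i < b) → a ≤ b
  ≤-by-< {zero}  f = z≤n
  ≤-by-< {suc a} f = f a ℕₚ.≤-refl

  ∈⇒<depth : ∀ ν {i j} → (i , j) ∈ ν → i < depth ν (j ⊖ i)
  ∈⇒<depth ν {i} {j} j<row =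
    depth-complete ν (j ⊖ i) i (subst (ℤ._< + row ν i) (sym (⊖-⊹ j i)) (ℤ.+<+ j<row))

  <depth⇒∈ : ∀ ν {i j} → i < depth ν (j ⊖ i) → (i , j) ∈ ν
  <depth⇒∈ ν {i} {j} i<d =
    ℤₚ.drop‿+<+ (subst (ℤ._< + row ν i) (⊖-⊹ j i) (depth-sound ν (j ⊖ i) i i<d))

  diagonal⇒⊹ : ∀ {i j k} → j ⊖ i ≡ k → k ⊹ i ≡ + j
  diagonal⇒⊹ {i} {j} refl = ⊖-⊹ j i

  ⊹⇒diagonal : ∀ {i j k} → k ⊹ i ≡ + j → j ⊖ i ≡ k
  ⊹⇒diagonal {i} {j} e = ⊹-cancelʳ i (trans (⊖-⊹ j i) (sym e))

  depth-anti : ∀ ν k → depth ν (k ⊹ 1) ≤ depth ν k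
  depth-anti ν k = ≤-by-< λ i i<d → depth-complete ν k i
    (ℤₚ.<-trans (subst (k ⊹ i ℤ.<_) (sym (⊹-suc k i)) (⊹-monoʳ-< k (ℕₚ.n<1+n i)))
      (depth-sound ν (k ⊹ 1) i i<d))

  row-suc : ∀ ν i → row ν (suc i) ≤ row ν i
  row-suc ν = go (sorted ν)
    where
    go : ∀ {xs} → Linked _≥_ xs → ∀ i → part xs (suc i) ≤ part xs i
    go {[]}     l i       = z≤n
    go {x ∷ xs} l zero    = part-≤-head l 0
    go {x ∷ xs} l (suc i) = go (Linked.tail l) i

  depth-step : ∀ ν k → depth ν k ≤ suc (depth ν (k ⊹ 1))
  depth-step ν k = ≤-by-< λ where
    zero    _   → s≤s z≤n
    (suc i) i<d → s≤s (depth-complete ν (k ⊹ 1) i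
      (subst (ℤ._< + row ν i) (sym (⊹-suc k i))
        (ℤₚ.<-≤-trans (depth-sound ν k (suc i) i<d) (ℤ.+≤+ (row-suc ν i)))))

  abstract

    -- Row `i` is counted by the depth up to the diagonal `row ν i − i − 1` and not beyond, so its
    -- bead shows as a drop of the depth. Everything later goes through `depth-bead`; the decision
    -- procedure stays sealed.
    bead : Partition → ℤ → Bool
    bead ν k = does (depth ν (k ⊹ 1) ℕₚ.<? depth ν k)

    depth-bead : ∀ ν k → depth ν k ≡ # (bead ν k) + depth ν (k ⊹ 1)
    depth-bead ν k with depth ν (k ⊹ 1) ℕₚ.<? depth ν k
    ... | yes lt rewrite dec-true (depth ν (k ⊹ 1) ℕₚ.<? depth ν k) lt =
      ℕₚ.≤-antisym (depth-step ν k) lt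
    ... | no ≮ rewrite dec-false (depth ν (k ⊹ 1) ℕₚ.<? depth ν k) ≮ =
      ℕₚ.≤-antisym (ℕₚ.≮⇒≥ ≮) (depth-anti ν k)

  #-injective : ∀ {a b} → # a ≡ # b → a ≡ b
  #-injective {false} {false} _ = refl
  #-injective {true}  {true}  _ = refl

  bead-unique : ∀ ν k b → depth ν k ≡ # b + depth ν (k ⊹ 1) → bead ν k ≡ b
  bead-unique ν k b e = #-injective (ℕₚ.+-cancelʳ-≡ (depth ν (k ⊹ 1)) _ _ (trans (sym (depth-bead ν k)) e))

  size : Partition → ℕ
  size ν = length (parts ν) + row ν 0

  part-past : ∀ xs {i} → length xs ≤ i → part xs i ≡ 0
  part-past []       _         = refl
  part-past (x ∷ xs) (s≤s len) = part-past xs len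

  row-≤-first : ∀ ν i → row ν i ≤ row ν 0
  row-≤-first ν zero    = ℕₚ.≤-refl
  row-≤-first ν (suc i) = ℕₚ.≤-trans (row-suc ν i) (row-≤-first ν i)

  depth-right : ∀ ν n → row ν 0 ≤ n → depth ν (+ n) ≡ 0
  depth-right ν n le = ℕₚ.n≤0⇒n≡0 (≤-by-< λ i i<d → contradiction
    (ℤₚ.drop‿+<+ (depth-sound ν (+ n) i i<d))
    (ℕₚ.≤⇒≯ (ℕₚ.≤-trans (row-≤-first ν i) (ℕₚ.≤-trans le (ℕₚ.m≤m+n n i)))))

  depth-left : ∀ ν n → length (parts ν) ≤ n → depth ν (ℤ.- + n) ≡ n
  depth-left ν n le = ℕₚ.≤-antisym
    (≤-by-< λ i i<d → ℕₚ.≰⇒> λ n≤i → contradiction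
      (subst₂ ℤ._<_ (trans (ℤₚ.-m+n≡n⊖m n i) (ℤₚ.⊖-≥ n≤i))
        (cong +_ (part-past (parts ν) (ℕₚ.≤-trans le n≤i))) (depth-sound ν _ i i<d))
      λ { (ℤ.+<+ ()) })
    (≤-by-< λ i i<n → depth-complete ν _ i
      (subst (ℤ._< + row ν i) (sym (trans (ℤₚ.-m+n≡n⊖m n i) (neg i<n))) ℤ.-<+))
    where
    neg : ∀ {i n} → i < n → i ⊖ n ≡ -[1+ n ∸ suc i ]
    neg (s≤s i≤n) = ⊖-negative i≤n

  -- Far out, the beads are those of the empty partition: all negative positions are occupied, all
  -- others free.
  Far : ℕ → (ℤ → Bool) → Set
  Far n b = ∀ q → n < ℤ.∣ q ∣ → b q ≡ isNeg q

  bead-far : ∀ ν → Far (size ν) (bead ν)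
  bead-far ν (+ n) lt = bead-unique ν (+ n) false
    (trans (depth-right ν n le) (sym (depth-right ν (n + 1) (ℕₚ.≤-trans le (ℕₚ.m≤m+n n 1)))))
    where
    le : row ν 0 ≤ n
    le = ℕₚ.≤-trans (ℕₚ.m≤n+m _ (length (parts ν))) (ℕₚ.<⇒≤ lt)
  bead-far ν -[1+ n ] (s≤s lt) = bead-unique ν -[1+ n ] true
    (trans (depth-left ν (suc n) (ℕₚ.m≤n⇒m≤1+n le))
      (cong suc (sym (trans (cong (depth ν) (ℤₚ.⊖-≤ {1} {suc n} (s≤s z≤n))) (depth-left ν n le)))))
    where
    le : length (parts ν) ≤ n
    le = ℕₚ.≤-trans (ℕₚ.m≤m+n _ _) lt

  -- Both depths vanish far to the right.
  beads⇒depth : ∀ ν μ → (∀ k → bead ν k ≡ bead μ k) → ∀ k → depth ν k ≡ depth μ k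
  beads⇒depth ν μ e = descending _ (row ν 0 + row μ 0) base step
    where
    base : ∀ q → row ν 0 + row μ 0 < ℤ.∣ q ∣ → isNeg q ≡ false → depth ν q ≡ depth μ q
    base (+ n) lt _ = trans
      (depth-right ν n (ℕₚ.≤-trans (ℕₚ.m≤m+n _ _) (ℕₚ.<⇒≤ lt)))
      (sym (depth-right μ n (ℕₚ.≤-trans (ℕₚ.m≤n+m _ _) (ℕₚ.<⇒≤ lt))))
    step : ∀ q → depth ν (q ⊹ 1) ≡ depth μ (q ⊹ 1) → depth ν q ≡ depth μ q
    step q eq = trans (depth-bead ν q) (trans (cong₂ _+_ (cong # (e q)) eq) (sym (depth-bead μ q)))

  rows⇒≡ : ∀ ν μ → (∀ i → row ν i ≡ row μ i) → ν ≡ μ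
  rows⇒≡ ν μ e = eq ν μ (go (positive ν) (positive μ) e)
    where
    go : ∀ {xs ys} → All (0 <_) xs → All (0 <_) ys → (∀ i → part xs i ≡ part ys i) → xs ≡ ys
    go {[]} {[]} _ _ e = refl
    go {[]} {y ∷ ys} _ (py ∷ _) e = contradiction (e 0) (ℕₚ.<⇒≢ py)
    go {x ∷ xs} {[]} (px ∷ _) _ e = contradiction (sym (e 0)) (ℕₚ.<⇒≢ px)
    go {x ∷ xs} {y ∷ ys} (_ ∷ p) (_ ∷ q) e = cong₂ _∷_ (e 0) (go p q (e ∘ suc))
    eq : ∀ ν μ → parts ν ≡ parts μ → ν ≡ μ
    eq (mkPartition xs s p) (mkPartition .xs s′ p′) refl =
      cong₂ (mkPartition xs) (Linked.irrelevant ℕₚ.≤-irrelevant s s′)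
        (All.irrelevant ℕₚ.≤-irrelevant p p′)

  beads⇒≡ : ∀ ν μ → (∀ k → bead ν k ≡ bead μ k) → ν ≡ μ
  beads⇒≡ ν μ e = rows⇒≡ ν μ λ i → ℕₚ.≤-antisym
    (≤-by-< λ j j<r → <depth⇒∈ μ (subst (i <_) (beads⇒depth ν μ e _) (∈⇒<depth ν j<r)))
    (≤-by-< λ j j<r → <depth⇒∈ ν (subst (i <_) (sym (beads⇒depth ν μ e _)) (∈⇒<depth μ j<r)))

  -- Turns a row given by a membership test into a row length.
  initial-segment : ∀ {P : ℕ → Set} → (∀ j → Dec (P j)) → (∀ j → P (suc j) → P j) →
                    ∀ N → ¬ P N → ∃[ n ] ∀ j → (j < n → P j) × (P j → j < n)
  initial-segment {P} P? down zero ¬P0 = 0 , λ j → (λ ()) , λ Pj → contradiction (bottom j Pj) ¬P0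
    where
    bottom : ∀ j → P j → P 0
    bottom zero    P0 = P0
    bottom (suc j) Pj = bottom j (down j Pj)
  initial-segment {P} P? down (suc N) ¬PN with P? N
  ... | no ¬P = initial-segment P? down N ¬P
  ... | yes PN = suc N , λ j → (λ { (s≤s j≤N) → below (ℕₚ.≤⇒≤′ j≤N) PN }) ,
                   λ Pj → ℕₚ.≰⇒> λ N<j → ¬PN (below (ℕₚ.≤⇒≤′ N<j) Pj)
    where
    below : ∀ {i j} → i ℕ.≤′ j → P j → P i
    below ℕ.≤′-refl       Pj = Pj
    below (ℕ.≤′-step i≤j) Pj = below i≤j (down _ Pj)

  fromRows : ∀ (f : ℕ → ℕ) → (∀ i → f (suc i) ≤ f i) → ∀ N → f N ≡ 0 →
             Σ[ ν ∈ Partition ] (∀ i → row ν i ≡ f i)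
  fromRows f anti N fN≡0 = let xs , l , p , e = go f anti N fN≡0 in mkPartition xs l p , e
    where
    vanish : ∀ (f : ℕ → ℕ) → (∀ i → f (suc i) ≤ f i) → f 0 ≡ 0 → ∀ i → 0 ≡ f i
    vanish f anti e zero    = sym e
    vanish f anti e (suc i) =
      sym (ℕₚ.n≤0⇒n≡0 (subst (f (suc i) ≤_) (sym (vanish f anti e i)) (anti i)))
    link : ∀ {x xs} → part xs 0 ≤ x → Linked _≥_ xs → Linked _≥_ (x ∷ xs)
    link {xs = []}    _ _ = [-]
    link {xs = _ ∷ _} y l = y ∷ l
    go : ∀ (f : ℕ → ℕ) → (∀ i → f (suc i) ≤ f i) → ∀ N → f N ≡ 0 →
         Σ[ xs ∈ List ℕ ] Linked _≥_ xs × All (0 <_) xs × (∀ i → part xs i ≡ f i)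
    go f anti zero e = [] , [] , [] , vanish f anti e
    go f anti (suc N) e with f 0 ℕₚ.≟ 0
    ... | yes f0≡0 = [] , [] , [] , vanish f anti f0≡0
    ... | no f0≢0 =
      let xs , l , p , eq = go (f ∘ suc) (anti ∘ suc) N e
      in f 0 ∷ xs , link (subst (_≤ f 0) (sym (eq 0)) (anti 0)) l ,
         ℕₚ.n≢0⇒n>0 f0≢0 ∷ p , λ { zero → refl ; (suc i) → eq i }

  neg⊹1 : ∀ n → (ℤ.- + suc n) ⊹ 1 ≡ ℤ.- + n
  neg⊹1 n = ℤₚ.⊖-≤ {1} {suc n} (s≤s z≤n)

  -- A partition is built from a prospective depth function by admitting the square `(i , j)` when
  -- `i < C (j ⊖ i)`. As `C` drops by 0 or 1 at each step these squares form a diagram, and the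
  -- boundary values make it finite.
  realise : (C : ℤ → ℕ) (b : ℤ → Bool) → (∀ k → C k ≡ # (b k) + C (k ⊹ 1)) →
            ∀ N → (∀ n → N ≤ n → C (+ n) ≡ 0) → (∀ n → N ≤ n → C (ℤ.- + n) ≡ n) →
            Σ[ ν ∈ Partition ] (∀ k → depth ν k ≡ C k)
  realise C b C-step N right left = ν , λ k → ℕₚ.≤-antisym (≤-by-< (to k)) (≤-by-< (from k))
    where
    anti : ∀ k → C (k ⊹ 1) ≤ C k
    anti k = subst (C (k ⊹ 1) ≤_) (sym (C-step k)) (ℕₚ.m≤n+m _ _)

    #≤1 : ∀ b → # b ≤ 1
    #≤1 false = z≤n
    #≤1 true  = ℕₚ.≤-refl

    slow : ∀ k → C k ≤ suc (C (k ⊹ 1))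
    slow k = subst (_≤ suc (C (k ⊹ 1))) (sym (C-step k)) (ℕₚ.+-monoˡ-≤ _ (#≤1 (b k)))

    -- Far to the left the value at `− n` is `n`, and each step to the right loses at most one.
    floor : ∀ n → n ≤ C (ℤ.- + n)
    floor n = go N n (ℕₚ.≤-reflexive (sym (left (N + n) (ℕₚ.m≤m+n N n))))
      where
      go : ∀ m n → m + n ≤ C (ℤ.- + (m + n)) → n ≤ C (ℤ.- + n)
      go zero    n le = le
      go (suc m) n le = go m n (ℕₚ.≤-pred (ℕₚ.≤-trans le
        (subst (λ k → C (ℤ.- + suc (m + n)) ≤ suc (C k)) (neg⊹1 (m + n)) (slow _))))

    next : ∀ j i → (j ⊖ i) ⊹ 1 ≡ suc j ⊖ i
    next j i = trans (ℤₚ.distribˡ-⊖-+-pos 1 j i) (cong (_⊖ i) (ℕₚ.+-comm j 1))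

    search : ∀ i → ∃[ n ] ∀ j → (j < n → i < C (j ⊖ i)) × (i < C (j ⊖ i) → j < n)
    search i = initial-segment (λ j → i ℕₚ.<? C (j ⊖ i))
      (λ j lt → ℕₚ.<-≤-trans (subst (λ k → i < C k) (sym (next j i)) lt) (anti _))
      (N + i) (λ lt → ℕₚ.n≮0 (subst (i <_) (trans (cong C (trans (ℤₚ.⊖-≥ (ℕₚ.m≤n+m i N))
        (cong +_ (ℕₚ.m+n∸n≡m N i)))) (right N ℕₚ.≤-refl)) lt))

    f : ℕ → ℕ
    f i = proj₁ (search i)

    f-anti : ∀ i → f (suc i) ≤ f i
    f-anti i = ≤-by-< λ j j<f → proj₂ (proj₂ (search i) j)
      (ℕₚ.≤-pred (ℕₚ.≤-trans (proj₁ (proj₂ (search (suc i)) j) j<f)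
        (subst (λ k → C (j ⊖ suc i) ≤ suc (C k))
          (trans (next j (suc i)) (ℤₚ.[1+m]⊖[1+n]≡m⊖n j i)) (slow _))))

    fN≡0 : f N ≡ 0
    fN≡0 = ℕₚ.n≤0⇒n≡0 (≤-by-< λ j j<f → contradiction
      (ℕₚ.<-≤-trans (proj₁ (proj₂ (search N) 0) (ℕₚ.≤-<-trans z≤n j<f))
        (ℕₚ.≤-reflexive (trans (cong C (ℤₚ.⊖-≤ {0} {N} z≤n)) (left N ℕₚ.≤-refl))))
      (ℕₚ.<-irrefl refl))

    built : Σ[ ν ∈ Partition ] (∀ i → row ν i ≡ f i)
    built = fromRows f f-anti N fN≡0

    ν : Partition
    ν = proj₁ built

    to : ∀ k i → i < depth ν k → i < C k
    to k i i<d with k ⊹ i in e | depth-sound ν k i i<d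
    ... | + j | ℤ.+<+ j<row = subst (λ k → i < C k) (⊹⇒diagonal e)
            (proj₁ (proj₂ (search i) j) (subst (j <_) (proj₂ built i) j<row))
    to (+ n) i i<d | -[1+ j ] | _ = contradiction e λ ()
    to -[1+ n ] i i<d | -[1+ j ] | _ with ℕₚ.<-≤-connex i (suc n)
    ... | inj₁ i<n = ℕₚ.<-≤-trans i<n (floor (suc n))
    ... | inj₂ n≤i = contradiction (trans (sym e) (ℤₚ.⊖-≥ n≤i)) λ ()

    from : ∀ k i → i < C k → i < depth ν k
    from k i i<C with k ⊹ i in e
    ... | + j = depth-complete ν k i (subst (ℤ._< + row ν i) (sym e)
            (ℤ.+<+ (subst (j <_) (sym (proj₂ built i))
              (proj₂ (proj₂ (search i) j) (subst (λ k → i < C k) (sym (⊹⇒diagonal e)) i<C)))))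
    ... | -[1+ j ] = depth-complete ν k i (subst (ℤ._< + row ν i) (sym e) ℤ.-<+)

  +≤⇒≤∣∣ : ∀ {n x} → + n ℤ.≤ x → n ≤ ℤ.∣ x ∣
  +≤⇒≤∣∣ (ℤ.+≤+ le) = le

  <-⇒<∣∣ : ∀ n {p} → p ℤ.< ℤ.- + n → n < ℤ.∣ p ∣
  <-⇒<∣∣ zero    ℤ.-<+      = s≤s z≤n
  <-⇒<∣∣ (suc n) (ℤ.-<- lt) = s≤s lt

  -- Ribbons, of length r = suc R

  module Ribbon (R : ℕ) where

    r : ℕ
    r = suc R

    abstract

      -- The diagonals of a ribbon: when a bead jumps from `p` to `p + r`, the depth rises by one
      -- exactly on these.
      span : ℤ → ℤ → Bool
      span p k = does (p ℤₚ.<? k) ∧ does (k ℤₚ.≤? p ⊹ r)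

      span-left : ∀ {p k} j → p ≡ k ⊹ j → span p k ≡ false
      span-left {p} {k} j e
        rewrite dec-false (p ℤₚ.<? k) (ℤₚ.≤⇒≯ (subst (k ℤ.≤_) (sym e) (k≤k⊹n k j))) = refl

      span-inside : ∀ p {j} → j < r → span p (p ⊹ suc j) ≡ true
      span-inside p {j} j<r
        rewrite dec-true (p ℤₚ.<? p ⊹ suc j) (k<k⊹suc p j)
              | dec-true (p ⊹ suc j ℤₚ.≤? p ⊹ r) (⊹-monoʳ-≤ p j<r) = refl

      span-right : ∀ p {j} → r ≤ j → span p (p ⊹ suc j) ≡ false
      span-right p {j} r≤j
        rewrite dec-false (p ⊹ suc j ℤₚ.≤? p ⊹ r) (ℤₚ.<⇒≱ (⊹-monoʳ-< p (s≤s r≤j))) =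
        Boolₚ.∧-zeroʳ _

      span-bounded : ∀ p {n} → ℤ.∣ p ∣ + r < n → span p (+ n) ≡ false
      span-bounded p {n} lt rewrite dec-false (+ n ℤₚ.≤? p ⊹ r) (λ le → ℕₚ.<⇒≱ lt
        (ℕₚ.≤-trans (+≤⇒≤∣∣ le) (ℤₚ.∣i+j∣≤∣i∣+∣j∣ p (+ r)))) = Boolₚ.∧-zeroʳ _

      span-bounded⁻ : ∀ p {n} → ℤ.∣ p ∣ ≤ n → span p (ℤ.- + n) ≡ false
      span-bounded⁻ p {n} le rewrite dec-false (p ℤₚ.<? ℤ.- + n) (λ lt → ℕₚ.<⇒≱ (<-⇒<∣∣ n lt) le) = refl

    -- A bead is a difference of depths, so only the two places where `span p` changes its value can
    -- have their beads altered.
    data Edge (p k : ℤ) : Set where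
      start : k ≡ p → span p k ≡ false → span p (k ⊹ 1) ≡ true → Edge p k
      end   : k ≡ p ⊹ r → span p k ≡ true → span p (k ⊹ 1) ≡ false → Edge p k
      none  : k ≢ p → k ≢ p ⊹ r → span p k ≡ span p (k ⊹ 1) → Edge p k

    edge : ∀ p k → Edge p k
    edge p k with side p k
    edge p k | before j e = none
      (λ k≡p → k≢k⊹suc k j (trans k≡p e))
      (λ k≡p⊹r → k≢k⊹suc k (j + r) (trans k≡p⊹r (trans (cong (_⊹ r) e) (⊹-assoc k (suc j) r))))
      (trans (span-left (suc j) e) (sym (span-left j (trans e (sym (⊹-suc k j))))))
    edge p _ | after zero = start (⊹-identityʳ p) (span-left 0 (trans (sym (⊹-identityʳ p)) (sym (⊹-identityʳ _))))
      (trans (cong (λ k → span p (k ⊹ 1)) (⊹-identityʳ p)) (span-inside p (s≤s z≤n)))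
    edge p _ | after (suc j) with ℕₚ.<-cmp j R
    ... | tri< j<R _ _ = none (k≢k⊹suc p j ∘ sym)
            (λ e → ℕₚ.<⇒≢ j<R (ℕₚ.suc-injective (⊹-cancelˡ p e)))
            (trans (span-inside p (ℕₚ.m≤n⇒m≤1+n j<R))
              (sym (trans (cong (span p) (⊹-suc′ p (suc j))) (span-inside p (s≤s j<R)))))
    ... | tri≈ _ refl _ = end refl (span-inside p ℕₚ.≤-refl)
            (trans (cong (span p) (⊹-suc′ p r)) (span-right p ℕₚ.≤-refl))
    ... | tri> _ _ R<j = none (k≢k⊹suc p j ∘ sym)
            (λ e → ℕₚ.<⇒≢ R<j (sym (ℕₚ.suc-injective (⊹-cancelˡ p e))))
            (trans (span-right p R<j)
              (sym (trans (cong (span p) (⊹-suc′ p (suc j))) (span-right p (ℕₚ.m≤n⇒m≤1+n R<j)))))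

    -- A bead jumps from p to p + r.
    record Move (p : ℤ) (ν μ : Partition) : Set where
      constructor move
      field
        depth-move : ∀ k → depth μ k ≡ # (span p k) + depth ν k

    open Move public

    module _ {p ν μ} (m : Move p ν μ) where

      private
        -- The difference of the depth equations at `k` and `k + 1`, arranged without subtraction.
        compare-beads : ∀ k → # (bead μ k) + # (span p (k ⊹ 1)) ≡ # (span p k) + # (bead ν k)
        compare-beads k = ℕₚ.+-cancelʳ-≡ (depth ν (k ⊹ 1)) _ _ (begin
          # (bead μ k) + # (span p (k ⊹ 1)) + depth ν (k ⊹ 1)   ≡⟨ ℕₚ.+-assoc (# (bead μ k)) _ _ ⟩
          # (bead μ k) + (# (span p (k ⊹ 1)) + depth ν (k ⊹ 1)) ≡⟨ cong (# (bead μ k) ℕ.+_) (depth-move m (k ⊹ 1)) ⟨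
          # (bead μ k) + depth μ (k ⊹ 1)                        ≡⟨ depth-bead μ k ⟨
          depth μ k                                             ≡⟨ depth-move m k ⟩
          # (span p k) + depth ν k                              ≡⟨ cong (# (span p k) ℕ.+_) (depth-bead ν k) ⟩
          # (span p k) + (# (bead ν k) + depth ν (k ⊹ 1))       ≡⟨ ℕₚ.+-assoc (# (span p k)) _ _ ⟨
          # (span p k) + # (bead ν k) + depth ν (k ⊹ 1)         ∎)
          where open ≡-Reasoning

        at-start : ∀ {a b} → # a + 1 ≡ 0 + # b → a ≡ false × b ≡ true
        at-start {false} {true}  _  = refl , refl
        at-start {false} {false} ()
        at-start {true}  {true}  ()
        at-start {true}  {false} ()

        at-end : ∀ {a b} → # a + 0 ≡ 1 + # b → a ≡ true × b ≡ false
        at-end {true}  {false} _  = refl , refl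
        at-end {true}  {true}  ()
        at-end {false} {true}  ()
        at-end {false} {false} ()

        at-p : bead μ p ≡ false × bead ν p ≡ true
        at-p = at-start (subst₂ (λ s t → # (bead μ p) + # t ≡ # s + # (bead ν p))
          (span-left 0 (sym (⊹-identityʳ p))) (span-inside p (s≤s z≤n)) (compare-beads p))

        at-p⊹r : bead μ (p ⊹ r) ≡ true × bead ν (p ⊹ r) ≡ false
        at-p⊹r = at-end (subst₂ (λ s t → # (bead μ (p ⊹ r)) + # t ≡ # s + # (bead ν (p ⊹ r)))
          (span-inside p ℕₚ.≤-refl) (trans (cong (span p) (⊹-suc′ p r)) (span-right p ℕₚ.≤-refl))
          (compare-beads (p ⊹ r)))

      move-source : bead ν p ≡ true
      move-source = proj₂ at-p
      move-source′ : bead μ p ≡ false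
      move-source′ = proj₁ at-p
      move-target : bead ν (p ⊹ r) ≡ false
      move-target = proj₂ at-p⊹r
      move-target′ : bead μ (p ⊹ r) ≡ true
      move-target′ = proj₁ at-p⊹r

      move-other : ∀ q → q ≢ p → q ≢ p ⊹ r → bead μ q ≡ bead ν q
      move-other q q≢p q≢p⊹r with edge p q
      ... | start e _ _ = contradiction e q≢p
      ... | end e _ _   = contradiction e q≢p⊹r
      ... | none _ _ e  = #-injective (ℕₚ.+-cancelʳ-≡ (# (span p (q ⊹ 1))) _ _
              (trans (compare-beads q) (trans (cong (λ s → # s + # (bead ν q)) e) (ℕₚ.+-comm _ (# (bead ν q))))))

    private
      far-bounds : ∀ ν p {n} → suc (size ν + (ℤ.∣ p ∣ + r)) ≤ n →
                   length (parts ν) ≤ n × row ν 0 ≤ n × ℤ.∣ p ∣ + r < n × ℤ.∣ p ∣ ≤ n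
      far-bounds ν p {n} le =
        ℕₚ.≤-trans (ℕₚ.m≤m+n _ (row ν 0)) size≤n ,
        ℕₚ.≤-trans (ℕₚ.m≤n+m _ (length (parts ν))) size≤n ,
        ℕₚ.≤-trans (s≤s (ℕₚ.m≤n+m _ (size ν))) le ,
        ℕₚ.≤-trans (ℕₚ.m≤m+n _ r) (ℕₚ.≤-trans (ℕₚ.m≤n+m _ (size ν)) (ℕₚ.<⇒≤ le))
        where
        size≤n : size ν ≤ n
        size≤n = ℕₚ.≤-trans (ℕₚ.m≤m+n _ (ℤ.∣ p ∣ + r)) (ℕₚ.<⇒≤ le)

      toggle : ℤ → Partition → ℤ → Bool
      toggle p ν k = bead ν k xor (span p k xor span p (k ⊹ 1))

    addRibbon : ∀ ν p → bead ν p ≡ true → bead ν (p ⊹ r) ≡ false → Σ[ μ ∈ Partition ] Move p ν μ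
    addRibbon ν p bp bpr = let μ , e = raised in μ , move e
      where
      balance : ∀ k → Edge p k → # (span p k) + (# (bead ν k) + depth ν (k ⊹ 1)) ≡
                                 # (toggle p ν k) + (# (span p (k ⊹ 1)) + depth ν (k ⊹ 1))
      balance k (start refl s t) rewrite s | t | bp  = refl
      balance k (end refl s t)   rewrite s | t | bpr = refl
      balance k (none _ _ e)     rewrite e with span p (k ⊹ 1) | bead ν k
      ... | false | false = refl
      ... | false | true  = refl
      ... | true  | false = refl
      ... | true  | true  = refl

      raised = realise (λ k → # (span p k) + depth ν k) (toggle p ν)
        (λ k → trans (cong (# (span p k) ℕ.+_) (depth-bead ν k)) (balance k (edge p k)))
        (suc (size ν + (ℤ.∣ p ∣ + r)))
        (λ n le → let _ , r≤n , p<n , _ = far-bounds ν p le in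
           cong₂ _+_ (cong # (span-bounded p p<n)) (depth-right ν n r≤n))
        (λ n le → let l≤n , _ , _ , p≤n = far-bounds ν p le in
           cong₂ _+_ (cong # (span-bounded⁻ p p≤n)) (depth-left ν n l≤n))

    -- Lowering the depth requires it to be positive on the whole span. The bead at `p + r` makes it
    -- positive at the right end, and the depth only grows towards the left.
    removeRibbon : ∀ μ p → bead μ p ≡ false → bead μ (p ⊹ r) ≡ true → Σ[ ν ∈ Partition ] Move p ν μ
    removeRibbon μ p bp bpr =
      let ν , e = realise C (toggle p μ) (λ k → balance k (edge p k))
                    (suc (size μ + (ℤ.∣ p ∣ + r)))
                    (λ n le → let _ , r≤n , p<n , _ = far-bounds μ p le in
                       trans (cong (λ s → depth μ (+ n) ∸ # s) (span-bounded p p<n)) (depth-right μ n r≤n))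
                    (λ n le → let l≤n , _ , _ , p≤n = far-bounds μ p le in
                       trans (cong (λ s → depth μ (ℤ.- + n) ∸ # s) (span-bounded⁻ p p≤n)) (depth-left μ n l≤n))
      in ν , move λ k → sym (trans (cong (# (span p k) ℕ.+_) (e k)) (ℕₚ.m+[n∸m]≡n (enough k)))
      where
      C : ℤ → ℕ
      C k = depth μ k ∸ # (span p k)

      depth-mono : ∀ k n → depth μ (k ⊹ n) ≤ depth μ k
      depth-mono k zero    = ℕₚ.≤-reflexive (cong (depth μ) (⊹-identityʳ k))
      depth-mono k (suc n) = ℕₚ.≤-trans
        (subst (λ l → depth μ l ≤ depth μ (k ⊹ 1)) (⊹-suc k n) (depth-mono (k ⊹ 1) n)) (depth-anti μ k)

      positive-end : 0 < depth μ (p ⊹ r)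
      positive-end = subst (0 <_) (sym (trans (depth-bead μ (p ⊹ r))
        (cong (λ b → # b + depth μ (p ⊹ r ⊹ 1)) bpr))) (s≤s z≤n)

      enough : ∀ k → # (span p k) ≤ depth μ k
      enough k with side p k
      ... | before j e rewrite span-left {p} {k} (suc j) e = z≤n
      ... | after zero rewrite span-left {p} {p ⊹ 0} 0 (sym (trans (⊹-identityʳ _) (⊹-identityʳ p))) = z≤n
      ... | after (suc j) with ℕₚ.<-≤-connex j r
      ...   | inj₂ r≤j rewrite span-right p r≤j = z≤n
      ...   | inj₁ j<r rewrite span-inside p j<r = ℕₚ.<-≤-trans positive-end
              (subst (λ k → depth μ k ≤ depth μ (p ⊹ suc j))
                (trans (⊹-assoc p (suc j) (r ∸ suc j)) (cong (p ⊹_) (ℕₚ.m+[n∸m]≡n j<r)))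
                (depth-mono (p ⊹ suc j) (r ∸ suc j)))

      balance : ∀ k → Edge p k → C k ≡ # (toggle p μ k) + C (k ⊹ 1)
      balance k (start refl s t) with depth-bead μ p | enough (p ⊹ 1)
      ... | e | le rewrite s | t | bp = trans e (sym (ℕₚ.m+[n∸m]≡n le))
      balance k (end refl s t) with depth-bead μ (p ⊹ r)
      ... | e rewrite s | t | bpr | e = refl
      balance k (none _ _ s) with depth-bead μ k | enough (k ⊹ 1)
      ... | e | le rewrite s | e with span p (k ⊹ 1) | bead μ k
      ... | false | false = refl
      ... | false | true  = refl
      ... | true  | false = refl
      ... | true  | true  = sym (ℕₚ.m+[n∸m]≡n le)

  -- Ribbons as skew diagrams and as jumps of beads

  sumℤ : (ℤ → ℕ) → ℤ → ℕ → ℕ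
  sumℤ f k zero    = 0
  sumℤ f k (suc n) = f k + sumℤ f (k ⊹ 1) n

  depth-sum : ∀ ν k n → depth ν k ≡ sumℤ (# ∘ bead ν) k n + depth ν (k ⊹ n)
  depth-sum ν k zero    = cong (depth ν) (sym (⊹-identityʳ k))
  depth-sum ν k (suc n) = begin
    depth ν k                                                                    ≡⟨ depth-bead ν k ⟩
    # (bead ν k) + depth ν (k ⊹ 1)                                               ≡⟨ cong (# (bead ν k) ℕ.+_) (depth-sum ν (k ⊹ 1) n) ⟩
    # (bead ν k) + (sumℤ (# ∘ bead ν) (k ⊹ 1) n + depth ν (k ⊹ 1 ⊹ n))            ≡⟨ ℕₚ.+-assoc (# (bead ν k)) _ _ ⟨
    # (bead ν k) + sumℤ (# ∘ bead ν) (k ⊹ 1) n + depth ν (k ⊹ 1 ⊹ n)              ≡⟨ cong (λ l → # (bead ν k) + sumℤ (# ∘ bead ν) (k ⊹ 1) n + depth ν l) (⊹-suc k n) ⟩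
    # (bead ν k) + sumℤ (# ∘ bead ν) (k ⊹ 1) n + depth ν (k ⊹ suc n)              ∎
    where open ≡-Reasoning

  depth-antitone : ∀ ν k n → depth ν (k ⊹ n) ≤ depth ν k
  depth-antitone ν k n = subst (depth ν (k ⊹ n) ≤_) (sym (depth-sum ν k n)) (ℕₚ.m≤n+m _ _)

  depth-lipschitz : ∀ ν k n → depth ν k ≤ n + depth ν (k ⊹ n)
  depth-lipschitz ν k zero    = ℕₚ.≤-reflexive (cong (depth ν) (sym (⊹-identityʳ k)))
  depth-lipschitz ν k (suc n) = ℕₚ.≤-trans (depth-step ν k)
    (s≤s (subst (λ l → depth ν (k ⊹ 1) ≤ n + depth ν l) (⊹-suc k n) (depth-lipschitz ν (k ⊹ 1) n)))

  -- Discrete intermediate values: the depth never falls by more than one per step.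
  depth-attains : ∀ ν k n {i} → depth ν (k ⊹ n) ≤ i → i ≤ depth ν k →
                  ∃[ m ] m ≤ n × depth ν (k ⊹ m) ≡ i
  depth-attains ν k n lo hi with ℕₚ.m≤n⇒m<n∨m≡n hi
  ... | inj₂ refl = 0 , z≤n , cong (depth ν) (⊹-identityʳ k)
  depth-attains ν k zero {i} lo hi | inj₁ lt =
    contradiction lo (ℕₚ.<⇒≱ (subst (i <_) (cong (depth ν) (sym (⊹-identityʳ k))) lt))
  depth-attains ν k (suc n) {i} lo hi | inj₁ lt =
    let m , m≤n , e = depth-attains ν (k ⊹ 1) n (subst (λ l → depth ν l ≤ i) (sym (⊹-suc k n)) lo)
                        (ℕₚ.≤-pred (ℕₚ.≤-trans lt (depth-step ν k)))
    in suc m , s≤s m≤n , trans (cong (depth ν) (sym (⊹-suc k m))) e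

  square-at : ∀ ν k {i} → depth ν k ≤ i → ∃[ j ] j ⊖ i ≡ k
  square-at ν k {i} le with k ⊹ i in e
  ... | + j      = j , ⊹⇒diagonal e
  ... | -[1+ j ] = contradiction
          (depth-complete ν k i (subst (ℤ._< + row ν i) (sym e) ℤ.-<+)) (ℕₚ.≤⇒≯ le)

  -- On each diagonal a diagram occupies the rows above its depth, so the skew squares there lie in
  -- the rows from one depth up to the other.
  skew-square : ∀ ν μ {k i} → depth ν k ≤ i → i < depth μ k →
                ∃[ j ] j ⊖ i ≡ k × (i , j) ∈ μ ∖ ν
  skew-square ν μ {k} {i} lo hi with square-at ν k lo
  ... | j , refl = j , refl , <depth⇒∈ μ hi , λ s∈ν → ℕₚ.≤⇒≯ lo (∈⇒<depth ν s∈ν)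

  skew-bounds : ∀ ν μ {i j k} → j ⊖ i ≡ k → (i , j) ∈ μ ∖ ν → depth ν k ≤ i × i < depth μ k
  skew-bounds ν μ refl (s∈μ , s∉ν) =
    ℕₚ.≮⇒≥ (λ lt → s∉ν (<depth⇒∈ ν lt)) , ∈⇒<depth μ s∈μ

  ⊆⇒depth≤ : ∀ ν μ → ν ⊆ μ → ∀ k → depth ν k ≤ depth μ k
  ⊆⇒depth≤ ν μ ν⊆μ k = ≤-by-< λ i i<d → bound i i<d
    where
    bound : ∀ i → i < depth ν k → i < depth μ k
    bound i i<d with k ⊹ i in e
    ... | -[1+ j ] = depth-complete μ k i (subst (ℤ._< + row μ i) (sym e) ℤ.-<+)
    ... | + j = subst (λ l → i < depth μ l) (⊹⇒diagonal e) (∈⇒<depth μ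
            (ν⊆μ {i , j} (<depth⇒∈ ν (subst (λ l → i < depth ν l) (sym (⊹⇒diagonal e)) i<d))))

  part-positive : ∀ xs {i} → 0 < part xs i → i < length xs
  part-positive xs {i} pos with ℕₚ.<-≤-connex i (length xs)
  ... | inj₁ lt = lt
  ... | inj₂ le = contradiction (sym (part-past xs le)) (ℕₚ.<⇒≢ pos)

  -- `height` filters a list of rows, and the rows met by a ribbon form an interval. The function
  -- `f` is there for the induction, which passes to `f ∘ suc`.
  length-filter-interval : ∀ {P : ℕ → Set} (P? : ∀ i → Dec (P i)) n lo w (f : ℕ → ℕ) →
    (∀ i → P (f i) → lo ≤ i × i < lo + w) → (∀ i → lo ≤ i → i < lo + w → P (f i)) →
    lo + w ≤ n → length (filter P? (applyUpTo f n)) ≡ w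
  length-filter-interval P? zero lo w f to from le = sym (ℕₚ.m+n≡0⇒n≡0 lo (ℕₚ.n≤0⇒n≡0 le))
  length-filter-interval P? (suc n) lo w f to from le with P? (f 0)
  length-filter-interval P? (suc n) (suc lo) w f to from le | yes p =
    contradiction (proj₁ (to 0 p)) λ ()
  length-filter-interval P? (suc n) zero zero f to from le | yes p =
    contradiction (proj₂ (to 0 p)) λ ()
  length-filter-interval P? (suc n) zero (suc w) f to from le | yes p =
    cong suc (length-filter-interval P? n zero w (f ∘ suc)
      (λ i q → z≤n , ℕₚ.≤-pred (proj₂ (to (suc i) q))) (λ i _ lt → from (suc i) z≤n (s≤s lt)) (ℕₚ.≤-pred le))
  length-filter-interval P? (suc n) zero zero f to from le | no ¬p =
    length-filter-interval P? n zero zero (f ∘ suc)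
      (λ i q → contradiction (proj₂ (to (suc i) q)) λ ()) (λ i _ ()) z≤n
  length-filter-interval P? (suc n) zero (suc w) f to from le | no ¬p =
    contradiction (from 0 z≤n (s≤s z≤n)) ¬p
  length-filter-interval P? (suc n) (suc lo) w f to from le | no ¬p =
    length-filter-interval P? n lo w (f ∘ suc)
      (λ i q → let a , b = to (suc i) q in ℕₚ.≤-pred a , ℕₚ.≤-pred b)
      (λ i a b → from (suc i) (s≤s a) (s≤s b)) (ℕₚ.≤-pred le)

  module RibbonMoves (R : ℕ) where
    open Ribbon R

    data Position (p : ℤ) : ℤ → Set where
      inside  : ∀ j → j < r → Position p (p ⊹ suc j)
      outside : ∀ {k} → span p k ≡ false → (∀ j → j < r → k ≢ p ⊹ suc j) → Position p k

    position : ∀ p k → Position p k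
    position p k with side p k
    ... | before j e = outside (span-left (suc j) e) λ j′ _ k≡ →
            k≢k⊹suc k (j + suc j′) (trans k≡ (trans (cong (_⊹ suc j′) e) (⊹-assoc k (suc j) (suc j′))))
    ... | after zero = outside (span-left 0 (sym (trans (⊹-identityʳ _) (⊹-identityʳ p))))
            λ j′ _ k≡ → ℕₚ.0≢1+n (⊹-cancelˡ p k≡)
    ... | after (suc j) with ℕₚ.<-≤-connex j r
    ...   | inj₁ j<r = inside j j<r
    ...   | inj₂ r≤j = outside (span-right p r≤j)
              λ j′ j′<r k≡ → ℕₚ.≤⇒≯ r≤j (subst (_< r) (sym (ℕₚ.suc-injective (⊹-cancelˡ p k≡))) j′<r)

    module _ {ν μ} (rib : ν ≺[ r ] μ) where
      open _≺[_]_ rib renaming (start to first)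

      -- The bead leaves the position just before the first diagonal of the ribbon.
      origin : ℤ
      origin = first ℤ.- + 1

      private
        first-⊹ : ∀ t → first ℤ.+ + t ≡ origin ⊹ suc t
        first-⊹ t = trans (cong (_⊹ t) (sym (minus-⊹ first 1))) (⊹-suc origin t)

      ribbon⇒move : Move origin ν μ
      ribbon⇒move = move shifted
        where
        shifted : ∀ k → depth μ k ≡ # (span origin k) + depth ν k
        shifted k with position origin k
        shifted k | outside s away rewrite s = ℕₚ.≤-antisym
          (ℕₚ.≮⇒≥ λ lt → let j , e , sk = skew-square ν μ ℕₚ.≤-refl lt
                             t , e′ = noOther (depth ν k , j) sk
                         in away (toℕ t) (Finₚ.toℕ<n t) (trans (sym e) (trans e′ (first-⊹ (toℕ t)))))
          (⊆⇒depth≤ ν μ contained k)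
        shifted _ | inside j j<r rewrite span-inside origin j<r
          with one (fromℕ< j<r)
        ... | (i , _) , (sk , e) , unique =
          ℕₚ.≤-antisym (ℕₚ.≮⇒≥ λ lt →
              let j₀ , e₀ , sk₀ = skew-square ν μ ℕₚ.≤-refl (ℕₚ.<-trans (ℕₚ.n<1+n _) lt)
                  j₁ , e₁ , sk₁ = skew-square ν μ (ℕₚ.n≤1+n _) lt
                  same₀ = unique (sk₀ , trans e₀ (sym eq))
                  same₁ = unique (sk₁ , trans e₁ (sym eq))
              in ℕₚ.m≢1+n+m _ {0} (cong proj₁ (trans (sym same₀) same₁)))
            (ℕₚ.≤-<-trans (proj₁ bounds) (proj₂ bounds))
          where
          eq : first ℤ.+ + toℕ (fromℕ< j<r) ≡ origin ⊹ suc j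
          eq = trans (cong (λ t → first ℤ.+ + t) (Finₚ.toℕ-fromℕ< j<r)) (first-⊹ j)
          bounds : depth ν (origin ⊹ suc j) ≤ i × i < depth μ (origin ⊹ suc j)
          bounds = skew-bounds ν μ (trans e eq) sk

    module _ {p ν μ} (m : Move p ν μ) where

      private
        depth-inside : ∀ {j} → j < r → depth μ (p ⊹ suc j) ≡ suc (depth ν (p ⊹ suc j))
        depth-inside {j} j<r =
          trans (depth-move m (p ⊹ suc j)) (cong (λ s → # s + depth ν (p ⊹ suc j)) (span-inside p j<r))

        square : ∀ {j} → j < r → ∃[ c ] let i = depth ν (p ⊹ suc j) in
                 c ⊖ i ≡ p ⊹ suc j × (i , c) ∈ μ ∖ ν
        square j<r = skew-square ν μ ℕₚ.≤-refl (ℕₚ.≤-reflexive (sym (depth-inside j<r)))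

        data OnRibbon : Square → Set where
          on : ∀ {i c} j → j < r → c ⊖ i ≡ p ⊹ suc j → i ≡ depth ν (p ⊹ suc j) → OnRibbon (i , c)

        locate : ∀ s → s ∈ μ ∖ ν → OnRibbon s
        locate (i , c) sk with c ⊖ i in e
        ... | k with position p k | skew-bounds ν μ e sk
        ...   | inside j j<r  | lo , hi = on j j<r e
                  (ℕₚ.≤-antisym (ℕₚ.≤-pred (subst (i <_) (depth-inside j<r) hi)) lo)
        ...   | outside s _   | lo , hi = contradiction
                  (subst (i <_) (trans (depth-move m k) (cong (λ b → # b + depth ν k) s)) hi) (ℕₚ.≤⇒≯ lo)

      move⇒ribbon : ν ≺[ r ] μ
      move⇒ribbon = record
        { contained = λ {s} s∈ν → <depth⇒∈ μ (ℕₚ.<-≤-trans (∈⇒<depth ν s∈ν)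
            (subst (depth ν (diagonal s) ≤_) (sym (depth-move m _)) (ℕₚ.m≤n+m _ _)))
        ; start   = p ⊹ 1
        ; one     = λ t → let c , e , sk = square (Finₚ.toℕ<n t) in
            _ , (sk , trans e (sym (⊹-suc p (toℕ t)))) ,
            λ {s} (sk′ , e′) → same sk′ (trans e′ (⊹-suc p (toℕ t))) e (Finₚ.toℕ<n t)
        ; noOther = λ s sk → other (locate s sk)
        }
        where
        same : ∀ {c i′ c′ j} → (i′ , c′) ∈ μ ∖ ν → c′ ⊖ i′ ≡ p ⊹ suc j →
               c ⊖ depth ν (p ⊹ suc j) ≡ p ⊹ suc j → j < r → (depth ν (p ⊹ suc j) , c) ≡ (i′ , c′)
        same {j = j} sk′ e′ e j<r with skew-bounds ν μ e′ sk′
        ... | lo , hi with ℕₚ.≤-antisym (ℕₚ.≤-pred (subst (_ <_) (depth-inside j<r) hi)) lo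
        ...   | refl = cong (depth ν (p ⊹ suc j) ,_)
                  (ℤₚ.+-injective (trans (sym (diagonal⇒⊹ {depth ν (p ⊹ suc j)} e)) (diagonal⇒⊹ {depth ν (p ⊹ suc j)} e′)))
        other : ∀ {s} → OnRibbon s → Σ[ t ∈ Fin r ] diagonal s ≡ p ⊹ 1 ℤ.+ + toℕ t
        other (on j j<r e _) = fromℕ< j<r ,
          trans e (trans (sym (⊹-suc p j)) (cong (λ t → p ⊹ 1 ℤ.+ + t) (sym (Finₚ.toℕ-fromℕ< j<r))))

      private
        headSquare : Square
        headSquare = depth ν (p ⊹ r) , proj₁ (square (ℕₚ.n<1+n R))

        head-diagonal : diagonal headSquare ≡ p ⊹ r
        head-diagonal = proj₁ (proj₂ (square (ℕₚ.n<1+n R)))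

        head-isHead : IsHead ν μ headSquare
        head-isHead = record
          { inside    = proj₂ (proj₂ (square (ℕₚ.n<1+n R)))
          ; topmost   = λ s sk → top (locate s sk)
          ; rightmost = λ s sk → right (locate s sk)
          }
          where
          reach : ∀ {j} → j < r → p ⊹ suc j ⊹ (r ∸ suc j) ≡ p ⊹ r
          reach {j} j<r = trans (⊹-assoc p (suc j) _) (cong (p ⊹_) (ℕₚ.m+[n∸m]≡n j<r))
          top : ∀ {s} → OnRibbon s → proj₁ headSquare ≤ proj₁ s
          top (on j j<r e refl) = subst (λ k → depth ν k ≤ depth ν (p ⊹ suc j)) (reach j<r)
            (depth-antitone ν (p ⊹ suc j) (r ∸ suc j))
          right : ∀ {s} → OnRibbon s → proj₂ s ≤ proj₂ headSquare
          right (on j j<r e refl) = ℤₚ.drop‿+≤+ (subst₂ ℤ._≤_ (diagonal⇒⊹ {depth ν (p ⊹ suc j)} e)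
            (trans (sym (⊹-assoc (p ⊹ suc j) (r ∸ suc j) (depth ν (p ⊹ r))))
              (trans (cong (_⊹ depth ν (p ⊹ r)) (reach j<r)) (diagonal⇒⊹ {depth ν (p ⊹ r)} head-diagonal)))
            (⊹-monoʳ-≤ (p ⊹ suc j) (subst (λ k → depth ν (p ⊹ suc j) ≤ r ∸ suc j + depth ν k) (reach j<r)
              (depth-lipschitz ν (p ⊹ suc j) (r ∸ suc j)))))

      move⇒step : RibbonStep r ν μ
      move⇒step = record { ribbon = move⇒ribbon ; head = headSquare ; isHead = head-isHead }

      move⇒step-head : diagonal (RibbonStep.head move⇒step) ≡ p ⊹ r
      move⇒step-head = head-diagonal

      -- The head stored in a step is known only as a topmost and rightmost square. Its diagonal is
      -- at most `p + r` because it lies on the ribbon, and at least `p + r` by comparison with the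
      -- square on the last diagonal.
      diagonal-of-head : ∀ {h} → IsHead ν μ h → diagonal h ≡ p ⊹ r
      diagonal-of-head {i , c} h with locate (i , c) (IsHead.inside h)
      ... | on j j<r e _ = ℤₚ.≤-antisym (subst (ℤ._≤ p ⊹ r) (sym e) (⊹-monoʳ-≤ p j<r))
        (subst (ℤ._≤ c ⊖ i) head-diagonal
          (ℤₚ.≤-trans (ℤₚ.⊖-monoˡ-≤ (depth ν (p ⊹ r)) (IsHead.rightmost h _ (IsHead.inside head-isHead)))
                      (ℤₚ.⊖-monoʳ-≥-≤ c (IsHead.topmost h _ (IsHead.inside head-isHead)))))

      -- The rows met are those from `depth ν (p + r)` to `depth ν (p + 1)`, both included. That is
      -- one more than the difference of these depths, which counts the beads strictly between the
      -- ends of the jump.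
      height-move : height ν μ ≡ sumℤ (# ∘ bead ν) (p ⊹ 1) R
      height-move = cong pred (length-filter-interval _ _ lo (suc w) id to from
        (subst (_≤ length (parts μ)) (sym (ℕₚ.+-suc lo w)) (part-positive (parts μ) (ℕₚ.≤-<-trans z≤n
          (from′ (lo + w) (ℕₚ.m≤m+n lo w) (ℕₚ.≤-reflexive lo+w))))))
        where
        lo w : ℕ
        lo = depth ν (p ⊹ r)
        w  = sumℤ (# ∘ bead ν) (p ⊹ 1) R

        lo+w : lo + w ≡ depth ν (p ⊹ 1)
        lo+w = trans (ℕₚ.+-comm lo w)
          (sym (trans (depth-sum ν (p ⊹ 1) R) (cong (λ k → w + depth ν k) (⊹-suc p R))))

        to : ∀ i → row ν i < row μ i → lo ≤ i × i < lo + suc w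
        to i lt with locate (i , row ν i) (lt , ℕₚ.<-irrefl refl)
        ... | on j j<r e refl =
          subst (λ k → depth ν k ≤ depth ν (p ⊹ suc j))
            (trans (⊹-assoc p (suc j) _) (cong (p ⊹_) (ℕₚ.m+[n∸m]≡n j<r)))
            (depth-antitone ν (p ⊹ suc j) (r ∸ suc j)) ,
          subst (depth ν (p ⊹ suc j) <_) (trans (cong suc (sym lo+w)) (sym (ℕₚ.+-suc lo w)))
            (s≤s (subst (λ k → depth ν k ≤ depth ν (p ⊹ 1)) (⊹-suc p j) (depth-antitone ν (p ⊹ 1) j)))

        from′ : ∀ i → lo ≤ i → i ≤ depth ν (p ⊹ 1) → row ν i < row μ i
        from′ i lo≤i i≤hi with depth-attains ν (p ⊹ 1) R
                                 (subst (λ k → depth ν k ≤ i) (sym (⊹-suc p R)) lo≤i) i≤hi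
        ... | j , j≤R , refl rewrite ⊹-suc p j =
          let c , e , c<μ , c≮ν = square (s≤s j≤R) in ℕₚ.≤-<-trans (ℕₚ.≮⇒≥ c≮ν) c<μ

        from : ∀ i → lo ≤ i → i < lo + suc w → row ν i < row μ i
        from i lo≤i i<hi = from′ i lo≤i (ℕₚ.≤-pred (subst (i <_)
          (trans (ℕₚ.+-suc lo w) (cong suc lo+w)) i<hi))

  -- Sums over intervals of ℤ and finite supports

  sumℤ-cong : ∀ {f g : ℤ → ℕ} k n → (∀ i → i < n → f (k ⊹ i) ≡ g (k ⊹ i)) → sumℤ f k n ≡ sumℤ g k n
  sumℤ-cong k zero    e = refl
  sumℤ-cong {f} {g} k (suc n) e = cong₂ _+_
    (subst (λ l → f l ≡ g l) (⊹-identityʳ k) (e 0 (s≤s z≤n)))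
    (sumℤ-cong (k ⊹ 1) n λ i i<n → subst (λ l → f l ≡ g l) (sym (⊹-suc k i)) (e (suc i) (s≤s i<n)))

  sumℤ-bump : ∀ {f g : ℤ → ℕ} {a} k n i → i < n → f (k ⊹ i) ≡ a + g (k ⊹ i) →
              (∀ q → q ≢ k ⊹ i → f q ≡ g q) → sumℤ f k n ≡ a + sumℤ g k n
  sumℤ-bump {f} {g} {a} k (suc n) zero _ hit miss = trans
    (cong₂ _+_ (subst (λ l → f l ≡ a + g l) (⊹-identityʳ k) hit)
      (sumℤ-cong (k ⊹ 1) n λ j _ → miss _ λ e → ℕₚ.0≢1+n (sym (⊹-cancelˡ k (trans (sym (⊹-suc k j)) e)))))
    (ℕₚ.+-assoc a (g k) _)
  sumℤ-bump {f} {g} {a} k (suc n) (suc i) (s≤s i<n) hit miss = trans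
    (cong₂ _+_ (miss k (k≢k⊹suc k i))
      (sumℤ-bump (k ⊹ 1) n i i<n (subst (λ l → f l ≡ a + g l) (sym (⊹-suc k i)) hit)
        (λ q q≢ → miss q λ e → q≢ (trans e (sym (⊹-suc k i))))))
    (trans (sym (ℕₚ.+-assoc (g k) a _)) (trans (cong (_+ sumℤ g (k ⊹ 1) n) (ℕₚ.+-comm (g k) a))
      (ℕₚ.+-assoc a (g k) _)))

  sumℤ-zero : ∀ {f : ℤ → ℕ} k n → (∀ q → f q ≡ 0) → sumℤ f k n ≡ 0
  sumℤ-zero k zero    z = refl
  sumℤ-zero k (suc n) z = cong₂ _+_ (z k) (sumℤ-zero (k ⊹ 1) n z)

  total : ℕ → (ℤ → ℕ) → ℕ
  total n f = sumℤ f (ℤ.- + n) (suc (n + n))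

  within : ∀ n q → ℤ.∣ q ∣ ≤ n → ∃[ i ] i < suc (n + n) × q ≡ (ℤ.- + n) ⊹ i
  within n (+ a) a≤n = n + a , s≤s (ℕₚ.+-monoʳ-≤ n a≤n) ,
    sym (trans (sym (⊹-assoc (ℤ.- + n) n a)) (cong (_⊹ a) (ℤₚ.+-inverseˡ (+ n))))
  within n -[1+ a ] a<n = n ∸ suc a , s≤s (ℕₚ.≤-trans (ℕₚ.m∸n≤m n (suc a)) (ℕₚ.m≤m+n n n)) ,
    ⊹-cancelʳ (suc a) (trans (ℤₚ.+-inverseˡ (+ suc a)) (sym (trans (⊹-assoc (ℤ.- + n) (n ∸ suc a) (suc a))
      (trans (cong ((ℤ.- + n) ⊹_) (ℕₚ.m∸n+n≡m a<n)) (ℤₚ.+-inverseˡ (+ n))))))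

  Supp : ℕ → (ℤ → Bool) → Set
  Supp n x = ∀ q → n < ℤ.∣ q ∣ → x q ≡ false

  Supp-mono : ∀ {m n x} → m ≤ n → Supp m x → Supp n x
  Supp-mono m≤n s q lt = s q (ℕₚ.≤-<-trans m≤n lt)

  abstract

    update : ℤ → Bool → (ℤ → Bool) → ℤ → Bool
    update p v f q = if does (q ℤₚ.≟ p) then v else f q

    update-hit : ∀ p v f → update p v f p ≡ v
    update-hit p v f rewrite dec-true (p ℤₚ.≟ p) refl = refl

    update-miss : ∀ {p q} v f → q ≢ p → update p v f q ≡ f q
    update-miss {p} {q} v f q≢p rewrite dec-false (q ℤₚ.≟ p) q≢p = refl

  -- A queue of r bits passes over a configuration from left to right; at each
  -- position the bit leaving the queue is either swapped with the incoming one or not.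
  data Hop : (front incoming : Bool) (jumps : Bool) (outgoing back : Bool) → Set where
    stay : ∀ {h k} → Hop h k false h k
    jump : Hop true false true false true

  Hop-subst : ∀ {h k x l h′ i m y n i′} → h ≡ i → k ≡ m → x ≡ y → l ≡ n → h′ ≡ i′ →
              Hop h k x l h′ → Hop i m y n i′
  Hop-subst refl refl refl refl refl s = s

  stay-out : ∀ {h k l h′} → Hop h k false l h′ → l ≡ h
  stay-out stay = refl

  stay-back : ∀ {h k l h′} → Hop h k false l h′ → h′ ≡ k
  stay-back stay = refl

  Hop-jumps : ∀ {h k k′ x y l h₁ h₂} → Hop h k x l h₁ → Hop h k′ y l h₂ → x ≡ y
  Hop-jumps stay stay = refl
  Hop-jumps jump jump = refl

  Hop-back : ∀ {h h′ k x l l′ h₁ h₂} → Hop h k x l h₁ → Hop h′ k x l′ h₂ → h₁ ≡ h₂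
  Hop-back stay stay = refl
  Hop-back jump jump = refl

  -- Runs of moves and the flows that record them

  true≢false : true ≢ false
  true≢false ()

  -- What a pass needs to know of a move, so that horizontal strips on beads and undone vertical
  -- strips on gaps can share one analysis. `weight` translates a bit back into a number of beads,
  -- in which both heights are measured.
  record Dynamics (R : ℕ) : Set₁ where
    r : ℕ
    r = suc R
    field
      bit     : Partition → ℤ → Bool
      Step    : ℤ → Partition → Partition → Set
      source  : ∀ {p ρ ρ′} → Step p ρ ρ′ → bit ρ p ≡ true
      source′ : ∀ {p ρ ρ′} → Step p ρ ρ′ → bit ρ′ p ≡ false
      target  : ∀ {p ρ ρ′} → Step p ρ ρ′ → bit ρ (p ⊹ r) ≡ false
      target′ : ∀ {p ρ ρ′} → Step p ρ ρ′ → bit ρ′ (p ⊹ r) ≡ true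
      other   : ∀ {p ρ ρ′} → Step p ρ ρ′ → ∀ q → q ≢ p → q ≢ p ⊹ r → bit ρ′ q ≡ bit ρ q
      step    : ∀ ρ p → bit ρ p ≡ true → bit ρ (p ⊹ r) ≡ false → Σ[ ρ′ ∈ Partition ] Step p ρ ρ′
      weight  : Bool → ℕ

  module Flows {R : ℕ} (D : Dynamics R) where
    open Dynamics D

    data Run : ℤ → Partition → Partition → Set where
      done : ∀ {t ρ} → Run t ρ ρ
      hop  : ∀ {t p ρ ρ′ ρ″} → t ℤ.≤ p → Step p ρ ρ′ → Run (p ⊹ 1) ρ′ ρ″ → Run t ρ ρ″

    hops : ∀ {t ρ ρ′} → Run t ρ ρ′ → ℕ
    hops done        = 0
    hops (hop _ _ c) = suc (hops c)

    weights : ∀ {t ρ ρ′} → Run t ρ ρ′ → ℕ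
    weights done                        = 0
    weights (hop {p = p} {ρ} _ _ c) = sumℤ (weight ∘ bit ρ) (p ⊹ 1) R + weights c

    -- `x` marks the jumps, `h q` is the bit found at `q` when the pass arrives there, and `o q` the
    -- bit left behind.
    Flow : Partition → (x h o : ℤ → Bool) → Set
    Flow ρ x h o = ∀ q → Hop (h q) (bit ρ (q ⊹ r)) (x q) (o q) (h (q ⊹ r))

    -- When the pass stands at `q`, the rest of the queue consists of the values of `h` at the `R`
    -- positions after `q`: the bits that a jump passes over.
    crossing : (ℤ → Bool) → ℤ → ℕ
    crossing h q = sumℤ (weight ∘ h) (q ⊹ 1) R

    record Recorded {t ρ ρ′} (c : Run t ρ ρ′) : Set where
      field
        x h     : ℤ → Bool
        flow    : Flow ρ x h (bit ρ′)
        quiet   : ∀ q j → t ≡ q ⊹ suc j → x q ≡ false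
        bound   : ℕ
        support : Supp bound x
        -- For every admissible `n`, so that the sums belonging to several strips can be taken over
        -- one range.
        hops≡   : ∀ n → Supp n x → hops c ≡ total n (# ∘ x)
        weight≡ : ∀ n → Supp n x → weights c ≡ total n (λ q → # (x q) * crossing h q)

    back-at : ∀ {ρ x h o} → Flow ρ x h o → ∀ q → x (q ℤ.- + r) ≡ false → h q ≡ bit ρ q
    back-at {ρ} {x} {h} f q xf = subst (λ k → h k ≡ bit ρ k) (minus-⊹ q r)
      (stay-back (Hop-subst refl refl xf refl refl (f (q ℤ.- + r))))

    -- Induction on the run, prepending its first move, at `p`. That move also fills `p + r`, but
    -- the back of the queue receives the same bit whether it arrives by the jump or is found there;
    -- so `x` and `h` change at `p` only.
    recording : ∀ {t ρ ρ′} (c : Run t ρ ρ′) → Recorded c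
    recording {t} {ρ} done = record
      { x = λ _ → false ; h = bit ρ
      ; flow = λ _ → stay
      ; quiet = λ _ _ _ → refl
      ; bound = 0 ; support = λ _ _ → refl
      ; hops≡ = λ n _ → sym (sumℤ-zero (ℤ.- + n) (suc (n + n)) λ _ → refl)
      ; weight≡ = λ n _ → sym (sumℤ-zero (ℤ.- + n) (suc (n + n)) λ _ → refl)
      }
    recording {t} {ρ} {ρ″} (hop {p = p} {ρ′ = ρ′} t≤p m c) = record
      { x = x ; h = h ; flow = flow ; quiet = quiet
      ; bound = N.bound ℕ.⊔ ℤ.∣ p ∣
      ; support = λ q lt → trans
          (x-miss λ q≡p → ℕₚ.<⇒≢ (ℕₚ.≤-<-trans (ℕₚ.m≤n⊔m N.bound _) lt) (cong ℤ.∣_∣ (sym q≡p)))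
          (N.support q (ℕₚ.≤-<-trans (ℕₚ.m≤m⊔n _ ℤ.∣ p ∣) lt))
      ; hops≡ = λ n s → trans (cong suc (N.hops≡ n (old s))) (sym (gain n s
          (trans (cong # x-hit) (cong (λ b → 1 + # b) (sym x′p))) (λ q q≢ → cong # (x-miss q≢))))
      ; weight≡ = λ n s → trans (cong (jumped ℕ.+_) (N.weight≡ n (old s)))
          (sym (gain {a = jumped} n s
            (trans (cong₂ _*_ (cong # x-hit) crossing-p) (trans (ℕₚ.*-identityˡ _)
              (trans (sym (ℕₚ.+-identityʳ _)) (cong (λ b → jumped + # b * crossing N.h p) (sym x′p)))))
            (λ q q≢ → trans (cong (λ b → # b * crossing h q) (x-miss q≢)) (crossing-other q))))
      }
      where
      module N = Recorded (recording c)
      jumped : ℕ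
      jumped = sumℤ (weight ∘ bit ρ) (p ⊹ 1) R
      x h : ℤ → Bool
      x = update p true N.x
      h = update p true N.h
      x-hit : x p ≡ true
      x-hit = update-hit p true N.x
      x-miss : ∀ {q} → q ≢ p → x q ≡ N.x q
      x-miss = update-miss true N.x

      quiet′ : ∀ q e → q ⊹ e ≡ p → N.x q ≡ false
      quiet′ q e eq = N.quiet q e (trans (cong (_⊹ 1) (sym eq)) (⊹-suc′ q e))

      x′p : N.x p ≡ false
      x′p = quiet′ p 0 (⊹-identityʳ p)

      h′p : N.h p ≡ false
      h′p = trans (back-at N.flow p (quiet′ _ r (minus-⊹ p r))) (source′ m)

      flow : Flow ρ x h (bit ρ″)
      flow q with q ℤₚ.≟ p | q ⊹ r ℤₚ.≟ p
      ... | yes refl | _ = Hop-subst (sym (update-hit p true N.h)) (sym (target m)) (sym x-hit)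
            (sym (trans (stay-out at-p) h′p))
            (sym (trans (update-miss true N.h (k≢k⊹suc p R ∘ sym)) (trans (stay-back at-p) (target′ m)))) jump
        where
        at-p = Hop-subst refl refl x′p refl refl (N.flow p)
      ... | no q≢p | yes e = Hop-subst
            (sym (update-miss true N.h q≢p)) (trans (sym (source m)) (cong (bit ρ) (sym e)))
            (sym (trans (x-miss q≢p) xq)) (sym (stay-out (Hop-subst refl refl xq refl refl (N.flow q))))
            (trans (sym (update-hit p true N.h)) (cong h (sym e))) stay
        where
        xq : N.x q ≡ false
        xq = quiet′ q r e
      ... | no q≢p | no q⊹r≢p = Hop-subst (sym (update-miss true N.h q≢p))
            (other m (q ⊹ r) q⊹r≢p (q≢p ∘ ⊹-cancelʳ r)) (sym (x-miss q≢p)) refl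
            (sym (update-miss true N.h q⊹r≢p)) (N.flow q)

      quiet : ∀ q j → t ≡ q ⊹ suc j → x q ≡ false
      quiet q j e with ≤⇒⊹ t≤p
      ... | n , p≡ = trans (x-miss λ q≡p → k≢k⊹suc q (j + n) (trans q≡p (sym eq))) (quiet′ q (suc j + n) eq)
        where
        eq : q ⊹ suc (j + n) ≡ p
        eq = trans (sym (⊹-assoc q (suc j) n)) (trans (cong (_⊹ n) (sym e)) (sym p≡))

      old : ∀ {n} → Supp n x → Supp n N.x
      old s q lt with q ℤₚ.≟ p
      ... | yes refl = x′p
      ... | no q≢p   = trans (sym (x-miss q≢p)) (s q lt)

      gain : ∀ {f g : ℤ → ℕ} {a} n → Supp n x → f p ≡ a + g p → (∀ q → q ≢ p → f q ≡ g q) →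
             total n f ≡ a + total n g
      gain {f} {g} {a} n s hit miss =
        let i , i<N , e = within n p (ℕₚ.≮⇒≥ λ lt → true≢false (trans (sym x-hit) (s p lt)))
        in sumℤ-bump (ℤ.- + n) _ i i<N (subst (λ k → f k ≡ a + g k) e hit)
             (λ q q≢ → miss q λ q≡p → q≢ (trans q≡p e))

      -- No jump before `p` has landed on the `R` positions after `p`, so the queue there still
      -- shows `ρ`.
      crossing-p : crossing h p ≡ jumped
      crossing-p = sumℤ-cong (p ⊹ 1) R λ i i<R → cong weight
        (trans (update-miss true N.h (λ e → k≢k⊹suc p i (sym (trans (sym (⊹-suc p i)) e))))
        (trans (back-at N.flow _ (quiet′ _ (r ∸ suc i) (⊹-cancelʳ (suc i) (eq i i<R))))
          (other m _ (λ e → k≢k⊹suc p i (sym (trans (sym (⊹-suc p i)) e)))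
            λ e → ℕₚ.<⇒≢ i<R (ℕₚ.suc-injective (⊹-cancelˡ p (trans (sym (⊹-suc p i)) e))))))
        where
        eq : ∀ i → i < R → (p ⊹ 1 ⊹ i ℤ.- + r) ⊹ (r ∸ suc i) ⊹ suc i ≡ p ⊹ suc i
        eq i i<R = trans (⊹-assoc (p ⊹ 1 ⊹ i ℤ.- + r) (r ∸ suc i) (suc i)) (trans
          (cong ((p ⊹ 1 ⊹ i ℤ.- + r) ⊹_) (ℕₚ.m∸n+n≡m (ℕₚ.≤-trans i<R (ℕₚ.n≤1+n R))))
          (trans (minus-⊹ _ r) (⊹-suc p i)))

      crossing-other : ∀ q → # (N.x q) * crossing h q ≡ # (N.x q) * crossing N.h q
      crossing-other q with N.x q in xq
      ... | false = refl
      ... | true with side p q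
      ...   | before j e = contradiction (trans (sym xq) (quiet′ q (suc j) (sym e))) true≢false
      ...   | after j    = cong (1 ℕ.*_) (sumℤ-cong (p ⊹ j ⊹ 1) R λ i _ → cong weight
              (update-miss true N.h λ e → k≢k⊹suc p (j + i) (sym (trans (sym (eq i)) e))))
        where
        eq : ∀ i → p ⊹ j ⊹ 1 ⊹ i ≡ p ⊹ suc (j + i)
        eq i = trans (cong (_⊹ i) (⊹-suc′ p j)) (⊹-assoc p (suc j) i)

    -- A jump occurs exactly when the outgoing bit differs from the front, so `o` and `h q` give
    -- `x q`, and these with `ρ` give `h (q + r)`. On the far left the queue agrees with `ρ`.
    flow-unique : ∀ {ρ x h y g o n m} → Flow ρ x h o → Flow ρ y g o → Supp n x → Supp m y →
                  ∀ q → x q ≡ y q × h q ≡ g q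
    flow-unique {ρ} {x} {h} {y} {g} {o} {n} {m} f f′ s s′ = ascending
      (λ q → x q ≡ y q × h q ≡ g q) (n + m + r) R base next
      where
      base : ∀ q → n + m + r < ℤ.∣ q ∣ → isNeg q ≡ true → x q ≡ y q × h q ≡ g q
      base q lt _ = trans (Supp-mono (ℕₚ.m≤m+n n m) s q (ℕₚ.≤-<-trans (ℕₚ.m≤m+n _ r) lt))
                      (sym (Supp-mono (ℕₚ.m≤n+m m n) s′ q (ℕₚ.≤-<-trans (ℕₚ.m≤m+n _ r) lt))) ,
        trans (back-at f q (Supp-mono (ℕₚ.m≤m+n n m) s _ far))
          (sym (back-at f′ q (Supp-mono (ℕₚ.m≤n+m m n) s′ _ far)))
        where
        far : n + m < ℤ.∣ q ℤ.- + r ∣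
        far = proj₁ (far-⊹⁻ (n + m) r (q ℤ.- + r) (subst (λ k → n + m + r < ℤ.∣ k ∣) (sym (minus-⊹ q r)) lt))
      next : ∀ q → x q ≡ y q × h q ≡ g q → x (q ⊹ r) ≡ y (q ⊹ r) × h (q ⊹ r) ≡ g (q ⊹ r)
      next q (ex , eh) = Hop-jumps (f (q ⊹ r)) (Hop-subst (sym eh′) refl refl refl refl (f′ (q ⊹ r))) , eh′
        where
        eh′ : h (q ⊹ r) ≡ g (q ⊹ r)
        eh′ = Hop-back (f q) (Hop-subst refl refl (sym ex) refl refl (f′ q))

    In : ℤ → ℕ → (ℤ → Bool) → Set
    In t n x = ∀ q → x q ≡ true → ∃[ i ] i < n × q ≡ t ⊹ i

    Supp⇒In : ∀ {n x} → Supp n x → In (ℤ.- + n) (suc (n + n)) x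
    Supp⇒In {n} s q xq = within n q (ℕₚ.≮⇒≥ λ lt → true≢false (trans (sym xq) (s q lt)))

    weaken : ∀ {t u ρ ρ′} → t ℤ.≤ u → Run u ρ ρ′ → Run t ρ ρ′
    weaken t≤u done          = done
    weaken t≤u (hop u≤p m c) = hop (ℤₚ.≤-trans t≤u u≤p) m c

    hops-weaken : ∀ {t u ρ ρ′} (t≤u : t ℤ.≤ u) (c : Run u ρ ρ′) → hops (weaken t≤u c) ≡ hops c
    hops-weaken _ done        = refl
    hops-weaken _ (hop _ _ _) = refl

    weights-weaken : ∀ {t u ρ ρ′} (t≤u : t ℤ.≤ u) (c : Run u ρ ρ′) → weights (weaken t≤u c) ≡ weights c
    weights-weaken _ done        = refl
    weights-weaken _ (hop _ _ _) = refl

    -- The converse of `recording`, where `n` is the width of the range still to be searched for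
    -- jumps. A jump at `t` is carried out as a move and struck from `x` and `h`, which leaves a
    -- flow out of the new partition.
    replay : ∀ n t ρ {x h o} → Flow ρ x h o → In t n x →
             Σ[ ρ′ ∈ Partition ] Run t ρ ρ′ × (∀ q → bit ρ′ q ≡ o q)
    replay zero t ρ {x} {h} {o} f inside = ρ , done , λ q → trans
      (sym (back-at f q (silent _))) (sym (stay-out (Hop-subst refl refl (silent q) refl refl (f q))))
      where
      silent : ∀ q → x q ≡ false
      silent q = Boolₚ.¬-not λ xq → case proj₁ (proj₂ (inside q xq)) of λ ()
    replay (suc n) t ρ {x} {h} {o} f inside with x t in xt
    ... | false = let ρ′ , c , e = replay n (t ⊹ 1) ρ f inside′ in ρ′ , weaken (k≤k⊹n t 1) c , e
      where
      inside′ : In (t ⊹ 1) n x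
      inside′ q xq with inside q xq
      ... | zero  , _       , refl = contradiction
              (trans (sym xq) (trans (cong x (⊹-identityʳ t)) xt)) true≢false
      ... | suc i , s≤s i<n , refl = i , i<n , sym (⊹-suc t i)
    ... | true =
      let ρ′ , c , e = replay n (t ⊹ 1) ρ₁ flow′ inside′
      in ρ′ , hop ℤₚ.≤-refl m c , e
      where
      early : ∀ q j → q ⊹ suc j ≡ t → x q ≡ false
      early q j e = Boolₚ.¬-not λ xq → let i , _ , e′ = inside q xq in
        k≢k⊹suc q (j + i) (trans e′ (trans (cong (_⊹ i) (sym e)) (⊹-assoc q (suc j) i)))
      at-t : Hop (h t) (bit ρ (t ⊹ r)) true (o t) (h (t ⊹ r))
      at-t = Hop-subst refl refl xt refl refl (f t)
      front : ∀ {h k l h′} → Hop h k true l h′ → h ≡ true × k ≡ false × l ≡ false × h′ ≡ true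
      front jump = refl , refl , refl , refl
      made : Σ[ ρ₁ ∈ Partition ] Step t ρ ρ₁
      made = step ρ t (trans (sym (back-at f t (early _ R (minus-⊹ t r)))) (proj₁ (front at-t)))
        (proj₁ (proj₂ (front at-t)))
      ρ₁ = proj₁ made
      m = proj₂ made
      x₁ h₁ : ℤ → Bool
      x₁ = update t false x
      h₁ = update t false h
      flow′ : Flow ρ₁ x₁ h₁ o
      flow′ q with q ℤₚ.≟ t | q ⊹ r ℤₚ.≟ t
      ... | yes refl | _ = Hop-subst (sym (update-hit t false h)) (sym (target′ m)) (sym (update-hit t false x))
            (sym (proj₁ (proj₂ (proj₂ (front at-t)))))
            (sym (trans (update-miss false h (k≢k⊹suc t R ∘ sym)) (proj₂ (proj₂ (proj₂ (front at-t)))))) stay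
      ... | no q≢t | yes e = Hop-subst (sym (update-miss false h q≢t))
            (trans (sym (source′ m)) (cong (bit ρ₁) (sym e))) (sym (trans (update-miss false x q≢t) xq))
            (sym (stay-out (Hop-subst refl refl xq refl refl (f q))))
            (trans (sym (update-hit t false h)) (cong h₁ (sym e))) stay
        where
        xq : x q ≡ false
        xq = early q R e
      ... | no q≢t | no q⊹r≢t = Hop-subst (sym (update-miss false h q≢t))
            (sym (other m (q ⊹ r) q⊹r≢t (q≢t ∘ ⊹-cancelʳ r))) (sym (update-miss false x q≢t)) refl
            (sym (update-miss false h q⊹r≢t)) (f q)
      inside′ : In (t ⊹ 1) n x₁
      inside′ q xq with q ℤₚ.≟ t
      ... | yes refl = contradiction (trans (sym xq) (update-hit t false x)) true≢false
      ... | no q≢t with inside q (trans (sym (update-miss false x q≢t)) xq)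
      ...   | zero  , _       , refl = contradiction (⊹-identityʳ t) q≢t
      ...   | suc i , s≤s i<n , refl = i , i<n , sym (⊹-suc t i)

  -- Ribbon strips as runs

  module Strips (R : ℕ) where
    open Ribbon R
    open RibbonMoves R

    horizontal vertical : Dynamics R
    horizontal = record
      { bit = bead ; Step = Move
      ; source = move-source ; source′ = move-source′ ; target = move-target ; target′ = move-target′
      ; other = move-other ; step = addRibbon ; weight = #
      }
    -- Undoing the moves of a vertical strip, read on the complementary bits, one
    -- meets them in increasing order as well.
    vertical = record
      { bit = λ ν k → not (bead ν k) ; Step = λ p μ ν → Move p ν μ
      ; source = cong not ∘ move-source′ ; source′ = cong not ∘ move-source
      ; target = cong not ∘ move-target′ ; target′ = cong not ∘ move-target
      ; other = λ m q q≢p q≢p⊹r → cong not (sym (move-other m q q≢p q≢p⊹r))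
      ; step = λ μ p b b′ → removeRibbon μ p (Boolₚ.not-injective b) (Boolₚ.not-injective b′)
      ; weight = λ b → # (not b)
      }

    module H = Flows horizontal
    module V = Flows vertical

    private
      FirstHead : (ℤ → Set) → ∀ {ν μ} → Chain r ν μ → Set
      FirstHead P ε       = ⊤
      FirstHead P (x ◅ c) = P (diagonal (RibbonStep.head x))

      link : ∀ {_⊏_ : ℤ → ℤ → Set} {ν κ μ} (x : RibbonStep r ν κ) (c : Chain r κ μ) →
             FirstHead (diagonal (RibbonStep.head x) ⊏_) c → Linked _⊏_ (headDiagonals c) →
             Linked _⊏_ (headDiagonals (x ◅ c))
      link x ε       _ _ = [-]
      link x (y ◅ c) f l = f ∷ l

      unlink : ∀ {_⊏_ : ℤ → ℤ → Set} {ν κ μ} (x : RibbonStep r ν κ) (c : Chain r κ μ) →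
               Linked _⊏_ (headDiagonals (x ◅ c)) →
               FirstHead (diagonal (RibbonStep.head x) ⊏_) c × Linked _⊏_ (headDiagonals c)
      unlink x ε       l       = tt , []
      unlink x (y ◅ c) (f ∷ l) = f , l

      map-first : ∀ {P Q : ℤ → Set} {ν μ} (c : Chain r ν μ) → (∀ {k} → P k → Q k) →
                  FirstHead P c → FirstHead Q c
      map-first ε       f p = tt
      map-first (x ◅ c) f p = f p

      position-of : ∀ {ν μ} → RibbonStep r ν μ → ℤ
      position-of x = origin (RibbonStep.ribbon x)

      head-of : ∀ {ν μ} (x : RibbonStep r ν μ) → diagonal (RibbonStep.head x) ≡ position-of x ⊹ r
      head-of x = diagonal-of-head (ribbon⇒move (RibbonStep.ribbon x)) (RibbonStep.isHead x)

      ⊹r-cancel-≤ : ∀ {k l} → k ⊹ r ℤ.≤ l ⊹ r → k ℤ.≤ l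
      ⊹r-cancel-≤ {k} {l} le with side l k
      ... | before j e   = subst (k ℤ.≤_) (sym e) (k≤k⊹n k (suc j))
      ... | after zero   = ℤₚ.≤-reflexive (⊹-identityʳ l)
      ... | after (suc j) = contradiction le (ℤₚ.<⇒≱ (subst (l ⊹ r ℤ.<_)
              (⊹-comm l r (suc j)) (k<k⊹suc (l ⊹ r) j)))

      <⇒⊹1≤ : ∀ {k l} → k ℤ.< l → k ⊹ 1 ℤ.≤ l
      <⇒⊹1≤ {k} k<l = let j , e = <⇒⊹ k<l in
        subst (k ⊹ 1 ℤ.≤_) (trans (⊹-suc k j) (sym e)) (k≤k⊹n (k ⊹ 1) j)

      ⊹1≤⇒< : ∀ {k l} → k ⊹ 1 ℤ.≤ l → k ℤ.< l
      ⊹1≤⇒< {k} le = ℤₚ.<-≤-trans (k<k⊹suc k 0) le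

    record Horizontal (ν μ : Partition) (n w : ℕ) : Set where
      constructor horizontalRun
      field
        {t}      : ℤ
        run      : H.Run t ν μ
        hops≡    : H.hops run ≡ n
        weights≡ : H.weights run ≡ w

    record Vertical (ν μ : Partition) (n w : ℕ) : Set where
      constructor verticalRun
      field
        {t}      : ℤ
        run      : V.Run t μ ν
        hops≡    : V.hops run ≡ n
        weights≡ : V.weights run ≡ w

    stripHeight : ∀ {_⊏_ ν μ} → Strip _⊏_ r ν μ → ℕ
    stripHeight s = sumᴸ (heights (standardisation s))

    horizontal-run : ∀ {ν μ} (s : HorizontalStrip r ν μ) → Horizontal ν μ (stripSize s) (stripHeight s)
    horizontal-run s = whole (standardisation s) (monotone s)
      where
      Result : ∀ {ν μ} → Chain r ν μ → ℤ → Set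
      Result {ν} {μ} c t = Σ[ run ∈ H.Run t ν μ ]
        H.hops run ≡ length (headDiagonals c) × H.weights run ≡ sumᴸ (heights c)
      go : ∀ {ν μ} t (c : Chain r ν μ) → FirstHead (t ⊹ r ℤ.≤_) c → Linked ℤ._<_ (headDiagonals c) → Result c t
      go t ε       _ _ = H.done , refl , refl
      go t (x ◅ c) f l =
        let p       = position-of x
            m       = ribbon⇒move (RibbonStep.ribbon x)
            f′ , l′ = unlink x c l
            run , e , e′ = go (p ⊹ 1) c
              (map-first c (λ {k} lt → subst (ℤ._≤ k) (trans (cong (_⊹ 1) (head-of x)) (⊹-comm p r 1)) (<⇒⊹1≤ lt)) f′) l′
        in H.hop (⊹r-cancel-≤ (subst (t ⊹ r ℤ.≤_) (head-of x) f)) m run ,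
           cong suc e , cong₂ _+_ (sym (height-move m)) e′
      whole : ∀ {ν μ} (c : Chain r ν μ) → Linked ℤ._<_ (headDiagonals c) →
              Horizontal ν μ (length (headDiagonals c)) (sumᴸ (heights c))
      whole ε       l = horizontalRun {t = + 0} H.done refl refl
      whole (x ◅ c) l = let run , e , e′ = go (position-of x) (x ◅ c) (ℤₚ.≤-reflexive (sym (head-of x))) l
                        in horizontalRun run e e′

    horizontal-strip : ∀ {t ν μ} → H.Run t ν μ → HorizontalStrip r ν μ
    horizontal-strip c = let c′ , _ , l = go c in record { standardisation = c′ ; monotone = l }
      where
      go : ∀ {t ν μ} → H.Run t ν μ →
           Σ[ c ∈ Chain r ν μ ] FirstHead (t ⊹ r ℤ.≤_) c × Linked ℤ._<_ (headDiagonals c)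
      go H.done = ε , tt , []
      go {t} (H.hop {p = p} t≤p m run) =
        let c , f , l = go run in
        move⇒step m ◅ c ,
        subst (t ⊹ r ℤ.≤_) (sym (move⇒step-head m)) (ℤₚ.+-monoˡ-≤ (+ r) t≤p) ,
        link (move⇒step m) c (map-first c (λ {k} le → subst (ℤ._< k) (sym (move⇒step-head m))
          (⊹1≤⇒< (subst (ℤ._≤ k) (⊹-comm p 1 r) le))) f) l

    private
      -- Undoing a move sees the beads of the larger partition, while the height was expressed by
      -- those of the smaller one; strictly between the ends of the jump the two agree.
      vertical-weight : ∀ {p ν μ} → Move p ν μ →
        sumℤ (λ q → # (not (not (bead μ q)))) (p ⊹ 1) R ≡ height ν μ
      vertical-weight {p} {ν} {μ} m = trans (sumℤ-cong (p ⊹ 1) R λ i i<R →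
          cong # (trans (Boolₚ.not-involutive _) (move-other m _
            (λ e → k≢k⊹suc p i (sym (trans (sym (⊹-suc p i)) e)))
            λ e → ℕₚ.<⇒≢ i<R (ℕₚ.suc-injective (⊹-cancelˡ p (trans (sym (⊹-suc p i)) e))))))
        (sym (height-move m))

    -- The last ribbon of the chain has the leftmost head and is the first to be undone, so the run
    -- is accumulated in reverse while the chain is read.
    vertical-run : ∀ {ν μ} (s : VerticalStrip r ν μ) → Vertical ν μ (stripSize s) (stripHeight s)
    vertical-run s = whole (standardisation s) (monotone s)
      where
      go : ∀ {ν ρ μ t} (run : V.Run t ρ ν) (c : Chain r ρ μ) → FirstHead (ℤ._< t ⊹ r) c →
           Linked ℤ._>_ (headDiagonals c) →
           Vertical ν μ (length (headDiagonals c) + V.hops run) (sumᴸ (heights c) + V.weights run)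
      go run ε _ _ = verticalRun run refl refl
      go {ν} {ρ} {t = t} run (_◅_ {j = ρ′} x c) f l =
        let p       = position-of x
            m       = ribbon⇒move (RibbonStep.ribbon x)
            f′ , l′ = unlink x c l
            p⊹1≤t = ⊹r-cancel-≤ (subst (ℤ._≤ t ⊹ r) (trans (cong (_⊹ 1) (head-of x)) (⊹-comm p r 1)) (<⇒⊹1≤ f))
            verticalRun run′ e e′ = go (V.hop ℤₚ.≤-refl m (V.weaken p⊹1≤t run)) c
              (map-first c (λ {k} lt → subst (k ℤ.<_) (head-of x) lt) f′) l′
        in verticalRun run′
             (trans e (trans (ℕₚ.+-suc _ _) (cong (λ n → suc (length (headDiagonals c) + n)) (V.hops-weaken p⊹1≤t run))))
             (trans e′ (trans (cong (sumᴸ (heights c) ℕ.+_)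
                 (cong₂ _+_ (vertical-weight m) (V.weights-weaken p⊹1≤t run)))
               (trans (sym (ℕₚ.+-assoc (sumᴸ (heights c)) _ _))
                 (cong (_+ V.weights run) (ℕₚ.+-comm (sumᴸ (heights c)) (height ρ ρ′))))))
      whole : ∀ {ν μ} (c : Chain r ν μ) → Linked ℤ._>_ (headDiagonals c) →
              Vertical ν μ (length (headDiagonals c)) (sumᴸ (heights c))
      whole ε       l = verticalRun {t = + 0} V.done refl refl
      whole (x ◅ c) l =
        let verticalRun run e e′ = go {t = position-of x ⊹ 1} V.done (x ◅ c)
              (subst₂ ℤ._<_ (sym (head-of x)) (⊹-comm (position-of x) r 1) (k<k⊹suc _ 0)) l
        in verticalRun run (trans e (ℕₚ.+-identityʳ _)) (trans e′ (ℕₚ.+-identityʳ _))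

    vertical-strip : ∀ {t ν μ} → V.Run t μ ν → VerticalStrip r ν μ
    vertical-strip run = go run ε tt []
      where
      go : ∀ {t ν ρ μ} → V.Run t ρ ν → (c : Chain r ρ μ) → FirstHead (ℤ._< t ⊹ r) c →
           Linked ℤ._>_ (headDiagonals c) → VerticalStrip r ν μ
      go V.done c f l = record { standardisation = c ; monotone = l }
      go {t} (V.hop {p = p} t≤p m run) c f l = go run (move⇒step m ◅ c)
        (subst₂ ℤ._<_ (sym (move⇒step-head m)) (⊹-comm p r 1) (k<k⊹suc _ 0))
        (link (move⇒step m) c (map-first c (λ {k} lt → subst (k ℤ.<_) (sym (move⇒step-head m))
          (ℤₚ.<-≤-trans lt (ℤₚ.+-monoˡ-≤ (+ r) t≤p))) f) l)

  -- Tautologies in finitely many bits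

  Bool^ : ℕ → Set
  Bool^ zero    = Bool
  Bool^ (suc n) = Bool → Bool^ n

  Holds : ∀ n → Bool^ n → Set
  Holds zero    b = b ≡ true
  Holds (suc n) f = ∀ b → Holds n (f b)

  everywhere : ∀ n → Bool^ n → Bool
  everywhere zero    b = b
  everywhere (suc n) f = everywhere n (f true) ∧ everywhere n (f false)

  ∧-true : ∀ {a b} → a ∧ b ≡ true → a ≡ true × b ≡ true
  ∧-true {true} e = refl , e

  -- For a concrete formula the premise is `refl`: all assignments are evaluated by the type
  -- checker.
  tautology : ∀ n f → everywhere n f ≡ true → Holds n f
  tautology zero    b e = e
  tautology (suc n) f e true  = tautology n (f true) (proj₁ (∧-true e))
  tautology (suc n) f e false = tautology n (f false) (proj₂ (∧-true e))

  infixr 3 _⇒_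
  infix 4 _≐_

  _⇒_ _≐_ : Bool → Bool → Bool
  a ⇒ b = not a ∨ b
  a ≐ b = not (a xor b)

  ⇒-elim : ∀ {a b} → (a ⇒ b) ≡ true → a ≡ true → b ≡ true
  ⇒-elim e refl = e

  ⇒-intro : ∀ {a b} → (a ≡ true → b ≡ true) → (a ⇒ b) ≡ true
  ⇒-intro {false} f = refl
  ⇒-intro {true}  f = f refl

  ≐-sound : ∀ {a b} → (a ≐ b) ≡ true → a ≡ b
  ≐-sound {true}  {true}  _ = refl
  ≐-sound {false} {false} _ = refl

  hop? : (h k x l h′ : Bool) → Bool
  hop? h k x l h′ = if x then h ∧ not k ∧ not l ∧ h′ else (l ≐ h) ∧ (h′ ≐ k)

  ≐-refl : ∀ b → (b ≐ b) ≡ true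
  ≐-refl true  = refl
  ≐-refl false = refl

  Hop⇒hop? : ∀ {h k x l h′} → Hop h k x l h′ → hop? h k x l h′ ≡ true
  Hop⇒hop? (stay {h} {k}) rewrite ≐-refl h | ≐-refl k = refl
  Hop⇒hop? jump = refl

  hop?⇒Hop : ∀ h k x l h′ → hop? h k x l h′ ≡ true → Hop h k x l h′
  hop?⇒Hop true false true false true e = jump
  hop?⇒Hop h k false l h′ e with ≐-sound {l} {h} (proj₁ (∧-true e)) | ≐-sound {h′} {k} (proj₂ (∧-true {l ≐ h} e))
  ... | refl | refl = stay
  hop?⇒Hop true false true false false ()
  hop?⇒Hop true false true true h′ ()
  hop?⇒Hop true true true l h′ ()
  hop?⇒Hop false k true l h′ ()

  -- The matching of the two sides of the local rule: reading w and its shift by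
  -- r together, an ascent of the number of beads of w in the window pushes a
  -- choice bit, the next descent to the same level pops it.

  data Pass : (w w′ c c′ : Bool) (σ σ′ : List Bool) → Set where
    keep : ∀ {w c σ} → Pass w w c c σ σ
    push : ∀ {e σ} → Pass false true e false σ (e ∷ σ)
    pop  : ∀ {f σ} → Pass true false false f (f ∷ σ) σ

  Pass-reverse : ∀ {w w′ c c′ σ σ′} → Pass w w′ c c′ σ σ′ → Pass w′ w c′ c σ′ σ
  Pass-reverse keep = keep
  Pass-reverse push = pop
  Pass-reverse pop  = push

  Pass-cong : ∀ {w w₁ w′ w₁′ c c₁ c′ c₁′ σ σ₁ σ′ σ₁′} → w ≡ w₁ → w′ ≡ w₁′ → c ≡ c₁ → c′ ≡ c₁′ →
              σ ≡ σ₁ → σ′ ≡ σ₁′ → Pass w w′ c c′ σ σ′ → Pass w₁ w₁′ c₁ c₁′ σ₁ σ₁′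
  Pass-cong refl refl refl refl refl refl p = p

  Pass-functional : ∀ {w w′ c c′ d′ σ σ′ τ′} → Pass w w′ c c′ σ σ′ → Pass w w′ c d′ σ τ′ →
                    c′ ≡ d′ × σ′ ≡ τ′
  Pass-functional keep keep = refl , refl
  Pass-functional push push = refl , refl
  Pass-functional pop  pop  = refl , refl

  -- On the small side a choice at a descent would not affect any move; requiring it to vanish makes
  -- the choices unique. With the two values of `w` exchanged, this is the corresponding condition
  -- at ascents for the large side.
  no-descent : Bool → Bool → Bool → Bool
  no-descent w w′ c = not (w ∧ not w′ ∧ c)

  Pass-no-descent : ∀ {w w′ c c′ σ σ′} → Pass w w′ c c′ σ σ′ → no-descent w w′ c ≡ true
  Pass-no-descent (keep {true})  = refl
  Pass-no-descent (keep {false}) = refl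
  Pass-no-descent push           = refl
  Pass-no-descent pop            = refl

  passed : (w w′ c : Bool) → List Bool → Bool
  -- A default value: a descent never meets an empty stack, by the length condition of `pass!`.
  passed true  false c []      = false
  passed true  false c (f ∷ σ) = f
  passed false true  c σ       = false
  passed true  true  c σ       = c
  passed false false c σ       = c

  passed-stack : (w w′ c : Bool) → List Bool → List Bool
  passed-stack true  false c []      = []
  passed-stack true  false c (f ∷ σ) = σ
  passed-stack false true  c σ       = c ∷ σ
  passed-stack true  true  c σ       = σ
  passed-stack false false c σ       = σ

  -- In use `m` is the number of beads in the next window. The equation then makes the stack as high
  -- as the current window, so that a bit is present whenever one is to be popped.
  pass! : ∀ w w′ c σ → no-descent w w′ c ≡ true → ∀ m → # w′ + length σ ≡ # w + m →
          Pass w w′ c (passed w w′ c σ) σ (passed-stack w w′ c σ)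
  pass! true  true  c     σ       ok m e = keep
  pass! false false c     σ       ok m e = keep
  pass! false true  c     σ       ok m e = push
  pass! true  false false (f ∷ σ) ok m e = pop

  Pass-length : ∀ {w w′ c c′ σ σ′} → Pass w w′ c c′ σ σ′ → # w + length σ′ ≡ # w′ + length σ
  Pass-length keep = refl
  Pass-length push = refl
  Pass-length pop  = refl

  sumℤ-last : ∀ (f : ℤ → ℕ) k n → sumℤ f k (suc n) ≡ sumℤ f k n + f (k ⊹ n)
  sumℤ-last f k zero    = trans (ℕₚ.+-identityʳ _) (cong f (sym (⊹-identityʳ k)))
  sumℤ-last f k (suc n) = trans (cong (f k ℕ.+_) (sumℤ-last f (k ⊹ 1) n))
    (trans (sym (ℕₚ.+-assoc (f k) _ _)) (cong (λ l → f k + sumℤ f (k ⊹ 1) n + f l) (⊹-suc k n)))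

  Far⇒shift : ∀ {n w} m → Far n w → ∀ q → n + m < ℤ.∣ q ∣ → w q ≡ w (q ⊹ m)
  Far⇒shift {n} m far q lt = let lt′ , e = far-⊹ n m q lt in
    trans (far q (ℕₚ.≤-<-trans (ℕₚ.m≤m+n n m) lt)) (trans (sym e) (sym (far _ lt′)))

  module Stack (R : ℕ) where

    r : ℕ
    r = suc R

    module _ (w : ℤ → Bool) {n} (w-far : Far n w) where

      window : ℤ → ℕ
      window q = sumℤ (# ∘ w) q r

      window-slide : ∀ q → # (w q) + window (q ⊹ 1) ≡ # (w (q ⊹ r)) + window q
      window-slide q = trans (sumℤ-last (# ∘ w) q r) (ℕₚ.+-comm (window q) _)

      window-left : ∀ q → n + r < ℤ.∣ q ∣ → isNeg q ≡ true → window q ≡ r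
      window-left q lt neg = trans (sumℤ-cong q r λ i i<r →
          let lt′ , e = far-⊹ n i q (ℕₚ.≤-<-trans (ℕₚ.+-monoʳ-≤ n (ℕₚ.<⇒≤ i<r)) lt)
          in cong # (trans (w-far _ lt′) (trans e neg)))
        (ones q r)
        where
        ones : ∀ q m → sumℤ (λ _ → 1) q m ≡ m
        ones q zero    = refl
        ones q (suc m) = cong suc (ones (q ⊹ 1) m)

      window-right : ∀ q → n < ℤ.∣ q ∣ → isNeg q ≡ false → window q ≡ 0
      window-right (+ a) lt _ = trans
        (sumℤ-cong {g = λ _ → 0} (+ a) r λ i _ → cong # (w-far (+ (a + i)) (ℕₚ.<-≤-trans lt (ℕₚ.m≤m+n a i))))
        (sumℤ-zero (+ a) r λ _ → refl)

      -- As the stack is as high as the window, a bit pushed on leaving level `h` upwards is popped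
      -- on the next return to level `h`. The bits of `τ` serve those descents that no ascent to
      -- their level precedes.
      record Matching (c c′ : ℤ → Bool) (τ : List Bool) : Set where
        field
          σ        : ℤ → List Bool
          pass     : ∀ q → Pass (w q) (w (q ⊹ r)) (c q) (c′ q) (σ q) (σ (q ⊹ 1))
          σ-left   : ∀ q → suc (n + r) < ℤ.∣ q ∣ → isNeg q ≡ true → σ q ≡ τ
          σ-right  : ∀ q → n < ℤ.∣ q ∣ → isNeg q ≡ false → σ q ≡ []
          σ-length : ∀ q → length (σ q) ≡ window q

      -- Beyond `n + r` the sequence `w` agrees with its shift, so choices pass unchanged.
      Supp-matched : ∀ {c c′ τ} → Matching c c′ τ → ∀ {m} → n + r ≤ m →
                     (Supp m c → Supp m c′) × (Supp m c′ → Supp m c)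
      Supp-matched {c} {c′} M {m} n+r≤m =
        (λ s q lt → trans (sym (same q lt)) (s q lt)) , (λ s q lt → trans (same q lt) (s q lt))
        where
        open Matching M
        unchanged : ∀ {w c c′ σ σ′} → Pass w w c c′ σ σ′ → c ≡ c′
        unchanged keep = refl
        same : ∀ q → m < ℤ.∣ q ∣ → c q ≡ c′ q
        same q lt = unchanged (Pass-cong refl (sym (Far⇒shift r w-far q (ℕₚ.≤-<-trans n+r≤m lt)))
          refl refl refl refl (pass q))

      private
        empty : ∀ {σ : List Bool} → length σ ≡ 0 → σ ≡ []
        empty {[]} _ = refl

      match-forward : ∀ c → (∀ q → no-descent (w q) (w (q ⊹ r)) (c q) ≡ true) →
                      ∀ τ → length τ ≡ r → Σ[ c′ ∈ (ℤ → Bool) ] Matching c c′ τ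
      match-forward c ok τ len = (λ q → passed (w q) (w (q ⊹ r)) (c q) (σ q)) , record
        { σ = σ ; pass = λ q → pass′ q (side s q)
        ; σ-left = left
        ; σ-right = λ q lt pos → empty (trans (length-σ q (side s q)) (window-right q lt pos))
        ; σ-length = λ q → length-σ q (side s q)
        }
        where
        -- To the left of `s` the sequence `w` agrees with its shift, so the stack can be taken to
        -- be `τ` there.
        s : ℤ
        s = -[1+ n + r ]

        st : ℕ → List Bool
        st zero    = τ
        st (suc i) = passed-stack (w (s ⊹ i)) (w (s ⊹ i ⊹ r)) (c (s ⊹ i)) (st i)

        at : ∀ {q} → Side s q → List Bool
        at (after i)    = st i
        at (before _ _) = τ

        σ : ℤ → List Bool
        σ q = at (side s q)

        at-after : ∀ {q} (v : Side s q) i → q ≡ s ⊹ i → at v ≡ st i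
        at-after (after j)    i e = cong st (⊹-cancelˡ s {j} {i} e)
        at-after (before j e) i refl = contradiction (trans e (⊹-assoc s i (suc j)))
          (λ e′ → k≢k⊹suc s (i + j) (trans e′ (cong (s ⊹_) (ℕₚ.+-suc i j))))

        at-before : ∀ {q} (v : Side s q) j → s ≡ q ⊹ j → at v ≡ τ
        at-before (after i) j e = cong st (ℕₚ.m+n≡0⇒m≡0 i (⊹-cancelˡ s
          (trans (sym (⊹-assoc s i j)) (trans (sym e) (sym (⊹-identityʳ s))))))
        at-before (before _ _) j e = refl

        far-before : ∀ q j → s ≡ q ⊹ suc j → n + r < ℤ.∣ q ∣ × isNeg q ≡ true
        far-before q j e = let lt , neg = far-⊹⁻ (n + r) 0 q₀ (subst (λ k → n + r + 0 < ℤ.∣ k ∣) (sym (⊹-identityʳ q₀)) lt₀) in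
          subst (λ k → n + r < ℤ.∣ k ∣) eq lt , cong isNeg (sym eq)
          where
          q₀ : ℤ
          q₀ = -[1+ n + r + suc j ]
          eq : q₀ ≡ q
          eq = ⊹-cancelʳ (suc j) (trans (⊖-negative {suc j} {n + r + suc j} (ℕₚ.m≤n+m (suc j) (n + r)))
            (trans (cong -[1+_] (ℕₚ.m+n∸n≡m (n + r) (suc j))) e))
          lt₀ : n + r + 0 < suc (n + r + suc j)
          lt₀ = s≤s (ℕₚ.+-monoʳ-≤ (n + r) z≤n)

        -- Mutual: the length guarantees the next pass, and the pass gives the next length.
        length-st : ∀ i → length (st i) ≡ window (s ⊹ i)
        pass-st : ∀ i → let q = s ⊹ i in
                  Pass (w q) (w (q ⊹ r)) (c q) (passed (w q) (w (q ⊹ r)) (c q) (st i)) (st i) (st (suc i))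
        length-st zero = trans len (sym (trans (cong window (⊹-identityʳ s))
          (window-left s (ℕₚ.n<1+n (n + r)) refl)))
        length-st (suc i) = ℕₚ.+-cancelˡ-≡ (# (w (s ⊹ i))) _ _ (trans (Pass-length (pass-st i))
          (trans (cong (# (w (s ⊹ i ⊹ r)) ℕ.+_) (length-st i)) (trans (sym (window-slide (s ⊹ i)))
            (cong (λ k → # (w (s ⊹ i)) + window k) (⊹-suc′ s i)))))
        pass-st i = pass! (w (s ⊹ i)) (w (s ⊹ i ⊹ r)) (c (s ⊹ i)) (st i) (ok (s ⊹ i)) _
          (trans (cong (# (w (s ⊹ i ⊹ r)) ℕ.+_) (length-st i)) (sym (window-slide (s ⊹ i))))

        length-σ : ∀ q (v : Side s q) → length (at v) ≡ window q
        length-σ _ (after i)    = length-st i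
        length-σ q (before j e) = let lt , neg = far-before q j e in trans len (sym (window-left q lt neg))

        pass′ : ∀ q (v : Side s q) →
                Pass (w q) (w (q ⊹ r)) (c q) (passed (w q) (w (q ⊹ r)) (c q) (at v)) (at v) (σ (q ⊹ 1))
        pass′ q (after i) = Pass-cong refl refl refl refl refl
          (sym (at-after (side s (q ⊹ 1)) (suc i) (⊹-suc′ s i))) (pass-st i)
        pass′ q (before j e) with w q | w (q ⊹ r) | Far⇒shift r w-far q (proj₁ (far-before q j e))
        ... | true  | _ | refl = Pass-cong refl refl refl refl refl
                (sym (at-before (side s (q ⊹ 1)) j (trans e (sym (⊹-suc q j))))) keep
        ... | false | _ | refl = Pass-cong refl refl refl refl refl
                (sym (at-before (side s (q ⊹ 1)) j (trans e (sym (⊹-suc q j))))) keep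

        left : ∀ q → suc (n + r) < ℤ.∣ q ∣ → isNeg q ≡ true → σ q ≡ τ
        left -[1+ a ] (s≤s lt) _ = at-before (side s -[1+ a ]) (a ∸ (n + r))
          (sym (trans (⊖-negative (ℕₚ.m∸n≤m a (n + r))) (cong -[1+_] (ℕₚ.m∸[m∸n]≡n (ℕₚ.<⇒≤ lt)))))

      -- The same reading from the right, where window and stack are empty, with pushes and pops
      -- exchanged. What remains on the stack at the left end is `τ`.
      match-backward : ∀ c′ → (∀ q → no-descent (w (q ⊹ r)) (w q) (c′ q) ≡ true) →
                       Σ[ c ∈ (ℤ → Bool) ] Σ[ τ ∈ List Bool ] length τ ≡ r × Matching c c′ τ
      match-backward c′ ok =
        (λ q → passed (w (q ⊹ r)) (w q) (c′ q) (σ (q ⊹ 1))) , σ -[1+ n + r ] ,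
        trans (length-σ _ (side s _)) (window-left _ (ℕₚ.n<1+n (n + r)) refl) , record
        { σ = σ ; pass = λ q → pass′ q (side s q)
        ; σ-left = left
        ; σ-right = λ q lt pos → empty (trans (length-σ q (side s q)) (window-right q lt pos))
        ; σ-length = λ q → length-σ q (side s q)
        }
        where
        s : ℤ
        s = + suc n

        pos : ℕ → ℤ
        pos i = s ℤ.- + i

        pos-⊹1 : ∀ i → pos (suc i) ⊹ 1 ≡ pos i
        pos-⊹1 i = ⊹-cancelʳ i (trans (⊹-suc (pos (suc i)) i) (trans (minus-⊹ s (suc i)) (sym (minus-⊹ s i))))

        pos-unique : ∀ {q} i → s ≡ q ⊹ i → pos i ≡ q
        pos-unique i e = ⊹-cancelʳ i (trans (minus-⊹ s i) e)

        st : ℕ → List Bool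
        st zero    = []
        st (suc i) = let q = pos (suc i) in passed-stack (w (q ⊹ r)) (w q) (c′ q) (st i)

        at : ∀ {q} → Side s q → List Bool
        at (after _)    = []
        at (before j _) = st (suc j)

        σ : ℤ → List Bool
        σ q = at (side s q)

        at-after : ∀ {q} (v : Side s q) i → q ≡ s ⊹ i → at v ≡ []
        at-after (after _)    i e = refl
        at-after (before j e) i refl = contradiction (trans e (⊹-assoc s i (suc j)))
          (λ e′ → k≢k⊹suc s (i + j) (trans e′ (cong (s ⊹_) (ℕₚ.+-suc i j))))

        at-before : ∀ {q} (v : Side s q) j → s ≡ q ⊹ j → at v ≡ st j
        at-before (after i) j e = sym (cong st (ℕₚ.m+n≡0⇒n≡0 i (⊹-cancelˡ s
          (trans (sym (⊹-assoc s i j)) (trans (sym e) (sym (⊹-identityʳ s)))))))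
        at-before {q} (before i e) j e′ = cong st (⊹-cancelˡ q (trans (sym e) e′))

        after-far : ∀ i → n < ℤ.∣ s ⊹ i ∣
        after-far i = s≤s (ℕₚ.m≤m+n n i)

        length-st : ∀ i → length (st i) ≡ window (pos i)
        pass-st : ∀ i → let q = pos (suc i) in
                  Pass (w (q ⊹ r)) (w q) (c′ q) (passed (w (q ⊹ r)) (w q) (c′ q) (st i)) (st i) (st (suc i))
        enough : ∀ i → let q = pos (suc i) in # (w q) + length (st i) ≡ # (w (q ⊹ r)) + window q
        length-st zero = sym (trans (cong window (⊹-identityʳ s)) (window-right s (ℕₚ.n<1+n n) refl))
        length-st (suc i) = ℕₚ.+-cancelˡ-≡ (# (w (pos (suc i) ⊹ r))) _ _
          (trans (Pass-length (pass-st i)) (enough i))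
        pass-st i = let q = pos (suc i) in
          pass! (w (q ⊹ r)) (w q) (c′ q) (st i) (ok q) (window q) (enough i)
        enough i = trans (cong (# (w (pos (suc i))) ℕ.+_) (trans (length-st i) (cong window (sym (pos-⊹1 i)))))
          (window-slide (pos (suc i)))

        length-σ : ∀ q (v : Side s q) → length (at v) ≡ window q
        length-σ _ (after i)    = sym (window-right (s ⊹ i) (after-far i) refl)
        length-σ q (before j e) = trans (length-st (suc j)) (cong window (pos-unique (suc j) e))

        choice : ℤ → List Bool → Bool
        choice q = passed (w (q ⊹ r)) (w q) (c′ q)

        pass′ : ∀ q (v : Side s q) → Pass (w q) (w (q ⊹ r)) (choice q (σ (q ⊹ 1))) (c′ q) (at v) (σ (q ⊹ 1))
        pass′ _ (after i)
          rewrite w-far (s ⊹ i) (after-far i) | w-far (s ⊹ i ⊹ r) (ℕₚ.<-≤-trans (after-far i) (ℕₚ.m≤m+n _ r)) =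
          Pass-cong refl refl refl refl refl
            (sym (at-after (side s (s ⊹ i ⊹ 1)) (suc i) (⊹-suc′ s i))) keep
        pass′ q (before j e) = Pass-reverse (subst
          (λ τ → Pass (w (q ⊹ r)) (w q) (c′ q) (choice q τ) τ (st (suc j)))
          (sym (at-before (side s (q ⊹ 1)) j (trans e (sym (⊹-suc q j)))))
          (subst (λ p → Pass (w (p ⊹ r)) (w p) (c′ p) (choice p (st j)) (st j) (st (suc j)))
            (pos-unique (suc j) e) (pass-st j)))

        steady : ∀ {w c c′ σ σ′} → Pass w w c c′ σ σ′ → σ ≡ σ′
        steady keep = refl

        left : ∀ q → suc (n + r) < ℤ.∣ q ∣ → isNeg q ≡ true → σ q ≡ σ -[1+ n + r ]
        left -[1+ a ] (s≤s lt) _ = go (a ∸ (n + r)) a (sym (ℕₚ.m+[n∸m]≡n (ℕₚ.<⇒≤ lt)))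
          where
          go : ∀ m a → a ≡ n + r + m → σ -[1+ a ] ≡ σ -[1+ n + r ]
          go zero    a e = cong (λ b → σ -[1+ b ]) (trans e (ℕₚ.+-identityʳ (n + r)))
          go (suc m) (suc a) e = trans
            (steady (Pass-cong refl (sym (Far⇒shift r w-far -[1+ suc a ] far)) refl refl refl refl
              (pass′ -[1+ suc a ] (side s -[1+ suc a ]))))
            (go m a (ℕₚ.suc-injective (trans e (ℕₚ.+-suc (n + r) m))))
            where
            far : n + r < suc (suc a)
            far = s≤s (ℕₚ.≤-trans (ℕₚ.m≤m+n (n + r) (suc m)) (ℕₚ.≤-reflexive (sym e)))
          go (suc m) zero e = contradiction (trans e (ℕₚ.+-suc (n + r) m)) λ ()

  -- The local rule

  ⊹-minus : ∀ k n → (k ⊹ n) ℤ.- + n ≡ k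
  ⊹-minus k n = ⊹-cancelʳ n (minus-⊹ (k ⊹ n) n)

  -- With w₀ , w₁ the values of w at q , q + r and c the choice at q, the moves
  -- at q of the two strips are Xl w₁ c , Yl w₀ c on the side of the smaller
  -- partition and Xr w₀ c , Yr w₁ c on the side of the larger one.
  Xl Yl Xr Yr : Bool → Bool → Bool
  Xl w₁ c = c ∧ w₁
  Yl w₀ c = c ∧ not w₀
  Xr w₀ c = c ∧ w₀
  Yr w₁ c = c ∧ not w₁

  -- Where `w` and its shift agree, a choice means that exactly one of the strips moves. This part
  -- is visible in β and γ and common to both sides; at ascents and descents the strips move
  -- together.
  flip : Bool → Bool → Bool → Bool
  flip w₀ w₁ c = c ∧ (w₀ ≐ w₁)

  Pass-flip : ∀ {w w′ c c′ σ σ′} → Pass w w′ c c′ σ σ′ → flip w w′ c ≡ flip w w′ c′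
  Pass-flip keep       = refl
  Pass-flip (push {e}) = Boolₚ.∧-zeroʳ e
  Pass-flip (pop {f})  = sym (Boolₚ.∧-zeroʳ f)

  -- cₚ is the choice at q - r
  small large : (w₀ c cₚ : Bool) → Bool
  small w₀ c cₚ = Yl w₀ c ∨ (w₀ ∧ not (Xl w₀ cₚ))
  large w₀ c cₚ = Yr w₀ cₚ ∨ (w₀ ∧ not (Xr w₀ c))

  private
    left-H : ∀ w₀ w₁ c c₁ → (no-descent w₀ w₁ c ⇒
      hop? (w₀ ∨ Yl w₀ c) (small w₁ c₁ c) (Xl w₁ c) (w₀ xor flip w₀ w₁ c) (w₁ ∨ Yl w₁ c₁)) ≡ true
    left-H = tautology 4 (λ w₀ w₁ c c₁ → no-descent w₀ w₁ c ⇒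
      hop? (w₀ ∨ Yl w₀ c) (small w₁ c₁ c) (Xl w₁ c) (w₀ xor flip w₀ w₁ c) (w₁ ∨ Yl w₁ c₁)) refl

    left-V : ∀ w₀ w₁ c c₁ cₚ → (no-descent w₀ w₁ c ⇒
      hop? (not (small w₀ c cₚ ∧ not (Yl w₀ c))) (not (w₁ xor flip w₀ w₁ c)) (Yl w₀ c)
           (not (small w₀ c cₚ)) (not (small w₁ c₁ c ∧ not (Yl w₁ c₁)))) ≡ true
    left-V = tautology 5 (λ w₀ w₁ c c₁ cₚ → no-descent w₀ w₁ c ⇒
      hop? (not (small w₀ c cₚ ∧ not (Yl w₀ c))) (not (w₁ xor flip w₀ w₁ c)) (Yl w₀ c)
           (not (small w₀ c cₚ)) (not (small w₁ c₁ c ∧ not (Yl w₁ c₁)))) refl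

    right-H : ∀ w₀ w₁ c c₁ cₚ → (no-descent w₁ w₀ c ⇒
      hop? (large w₀ c cₚ ∨ Xr w₀ c) (w₁ xor flip w₀ w₁ c) (Xr w₀ c)
           (large w₀ c cₚ) (large w₁ c₁ c ∨ Xr w₁ c₁)) ≡ true
    right-H = tautology 5 (λ w₀ w₁ c c₁ cₚ → no-descent w₁ w₀ c ⇒
      hop? (large w₀ c cₚ ∨ Xr w₀ c) (w₁ xor flip w₀ w₁ c) (Xr w₀ c)
           (large w₀ c cₚ) (large w₁ c₁ c ∨ Xr w₁ c₁)) refl

    right-V : ∀ w₀ w₁ c c₁ → (no-descent w₁ w₀ c ⇒
      hop? (not (w₀ ∧ not (Xr w₀ c))) (not (large w₁ c₁ c)) (Yr w₁ c)
           (not (w₀ xor flip w₀ w₁ c)) (not (w₁ ∧ not (Xr w₁ c₁)))) ≡ true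
    right-V = tautology 4 (λ w₀ w₁ c c₁ → no-descent w₁ w₀ c ⇒
      hop? (not (w₀ ∧ not (Xr w₀ c))) (not (large w₁ c₁ c)) (Yr w₁ c)
           (not (w₀ xor flip w₀ w₁ c)) (not (w₁ ∧ not (Xr w₁ c₁)))) refl

    left-conclusion right-conclusion : (w₀ w₁ c x y l m₁ : Bool) → Bool
    left-conclusion w₀ w₁ c x y l m₁ =
      (x ≐ Xl w₁ c) ∧ (y ≐ Yl w₀ c) ∧ no-descent w₀ w₁ c ∧
      (l ≐ w₀ xor flip w₀ w₁ c) ∧ (m₁ ≐ w₁ xor flip w₀ w₁ c)
    right-conclusion w₀ w₁ c x y l m₁ =
      (x ≐ Xr w₀ c) ∧ (y ≐ Yr w₁ c) ∧ no-descent w₁ w₀ c ∧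
      (l ≐ w₀ xor flip w₀ w₁ c) ∧ (m₁ ≐ w₁ xor flip w₀ w₁ c)

    -- The two hops at `q` do not suffice. The neighbouring hops, at `q - r` and `q + r`, enter
    -- through what they say about the front bits at `q` and `q + r`.
    left-all right-all : Bool^ 11
    left-all h₀ k₀ k₁ x l h₁ g₀ m₁ y g₁ y₁ =
      hop? h₀ k₁ x l h₁ ⇒ hop? g₀ (not m₁) y (not k₀) g₁ ⇒ (k₀ ⇒ h₀) ⇒ (k₁ ⇒ h₁) ⇒
      (g₁ ≐ not k₁ ∨ y₁) ⇒ not (not k₁ ∧ y₁) ⇒
      left-conclusion (h₀ ∧ not y) (h₁ ∧ not y₁) (x ∨ y) x y l m₁ ∧
      (k₁ ≐ y₁ ∨ ((h₁ ∧ not y₁) ∧ not x))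
    right-all h₀ m₁ x n₀ h₁ g₀ n₁ y l g₁ x₁ =
      hop? h₀ m₁ x n₀ h₁ ⇒ hop? g₀ (not n₁) y (not l) g₁ ⇒ (not n₀ ⇒ g₀) ⇒ (h₁ ≐ n₁ ∨ x₁) ⇒ not (n₁ ∧ x₁) ⇒
      right-conclusion (not g₀ ∨ x) (not g₁ ∨ x₁) (x ∨ y) x y l m₁ ∧
      (n₁ ≐ y ∨ ((not g₁ ∨ x₁) ∧ not x₁))

    left-all-holds : Holds 11 left-all
    left-all-holds = tautology 11 left-all refl

    right-all-holds : Holds 11 right-all
    right-all-holds = tautology 11 right-all refl

    left-facts : ∀ w₀ w₁ c x y l m₁ k e → (left-conclusion w₀ w₁ c x y l m₁ ∧ (k ≐ e)) ≡ true →
      x ≡ Xl w₁ c × y ≡ Yl w₀ c × no-descent w₀ w₁ c ≡ true ×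
      l ≡ w₀ xor flip w₀ w₁ c × m₁ ≡ w₁ xor flip w₀ w₁ c × k ≡ e
    left-facts w₀ w₁ c x y l m₁ k e p =
      let p₁ , pk = ∧-true p
          px , p₂ = ∧-true {x ≐ Xl w₁ c} p₁
          py , p₃ = ∧-true {y ≐ Yl w₀ c} p₂
          pn , p₄ = ∧-true {no-descent w₀ w₁ c} p₃
          pl , pm = ∧-true {l ≐ w₀ xor flip w₀ w₁ c} p₄
      in ≐-sound px , ≐-sound py , pn , ≐-sound pl , ≐-sound pm , ≐-sound pk

    right-facts : ∀ w₀ w₁ c x y l m₁ k e → (right-conclusion w₀ w₁ c x y l m₁ ∧ (k ≐ e)) ≡ true →
      x ≡ Xr w₀ c × y ≡ Yr w₁ c × no-descent w₁ w₀ c ≡ true ×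
      l ≡ w₀ xor flip w₀ w₁ c × m₁ ≡ w₁ xor flip w₀ w₁ c × k ≡ e
    right-facts w₀ w₁ c x y l m₁ k e p =
      let p₁ , pk = ∧-true p
          px , p₂ = ∧-true {x ≐ Xr w₀ c} p₁
          py , p₃ = ∧-true {y ≐ Yr w₁ c} p₂
          pn , p₄ = ∧-true {no-descent w₁ w₀ c} p₃
          pl , pm = ∧-true {l ≐ w₀ xor flip w₀ w₁ c} p₄
      in ≐-sound px , ≐-sound py , pn , ≐-sound pl , ≐-sound pm , ≐-sound pk

  incoming⇒back : ∀ {h k x l h′} → Hop h k x l h′ → (k ⇒ h′) ≡ true
  incoming⇒back (stay {k = k}) = ⇒-intro {k} id
  incoming⇒back jump = refl

  front-split : ∀ {h k x l h′} → Hop h k x l h′ → (h ≐ l ∨ x) ≡ true × not (l ∧ x) ≡ true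
  front-split (stay {true})  = refl , refl
  front-split (stay {false}) = refl , refl
  front-split jump           = refl , refl

  module LocalRule (R : ℕ) where
    open Strips R
    open Stack R public

    -- A flow between mere bit sequences: the corner to be constructed is not yet known to come from
    -- a partition.
    Crossing : (in′ x out h : ℤ → Bool) → Set
    Crossing in′ x out h = ∀ q → Hop (h q) (in′ (q ⊹ r)) (x q) (out q) (h (q ⊹ r))

    -- A, B, C, D are the beads of the corner α, of its neighbours β (horizontal)
    -- and γ (vertical), and of the opposite corner δ; τ is the matrix entry.
    record Config (A B C : ℤ → Bool) (τ : List Bool) (D : ℤ → Bool) : Set where
      field
        {w c c′} : ℤ → Bool
        {n m}    : ℕ
        w-far    : Far n w
        c-supp   : Supp m c
        c′-supp  : Supp m c′
        matching : Matching w w-far c c′ τ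
        A-bit    : ∀ q → A q ≡ small (w q) (c q) (c (q ℤ.- + r))
        B-bit    : ∀ q → B q ≡ w q xor flip (w q) (w (q ⊹ r)) (c q)
        C-bit    : ∀ q → C (q ⊹ r) ≡ w (q ⊹ r) xor flip (w q) (w (q ⊹ r)) (c q)
        D-bit    : ∀ q → D q ≡ large (w q) (c′ q) (c′ (q ℤ.- + r))

      open Matching matching public

      x y x′ y′ h v h′ v′ : ℤ → Bool
      x q  = Xl (w (q ⊹ r)) (c q)
      y q  = Yl (w q) (c q)
      x′ q = Xr (w q) (c′ q)
      y′ q = Yr (w (q ⊹ r)) (c′ q)
      h q  = w q ∨ y q
      v q  = A q ∧ not (y q)
      h′ q = D q ∨ x′ q
      v′ q = w q ∧ not (x′ q)

      x-supp : Supp m x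
      x-supp q lt rewrite c-supp q lt = refl
      y-supp : Supp m y
      y-supp q lt rewrite c-supp q lt = refl
      x′-supp : Supp m x′
      x′-supp q lt rewrite c′-supp q lt = refl
      y′-supp : Supp m y′
      y′-supp q lt rewrite c′-supp q lt = refl

      ascent-free : ∀ q → no-descent (w q) (w (q ⊹ r)) (c q) ≡ true
      ascent-free q = Pass-no-descent (pass q)

      descent-free : ∀ q → no-descent (w (q ⊹ r)) (w q) (c′ q) ≡ true
      descent-free q = Pass-no-descent (Pass-reverse (pass q))

      A-bit⁺ : ∀ q → A (q ⊹ r) ≡ small (w (q ⊹ r)) (c (q ⊹ r)) (c q)
      A-bit⁺ q = trans (A-bit (q ⊹ r)) (cong (λ p → small (w (q ⊹ r)) (c (q ⊹ r)) (c p)) (⊹-minus q r))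

      D-bit⁺ : ∀ q → D (q ⊹ r) ≡ large (w (q ⊹ r)) (c′ (q ⊹ r)) (c′ q)
      D-bit⁺ q = trans (D-bit (q ⊹ r)) (cong (λ p → large (w (q ⊹ r)) (c′ (q ⊹ r)) (c′ p)) (⊹-minus q r))

      small-H : Crossing A x B h
      small-H q = Hop-subst refl (sym (A-bit⁺ q)) refl (sym (B-bit q)) refl
        (hop?⇒Hop _ _ _ _ _ (⇒-elim (left-H (w q) (w (q ⊹ r)) (c q) (c (q ⊹ r))) (ascent-free q)))

      small-V : Crossing (not ∘ C) y (not ∘ A) (not ∘ v)
      small-V q = Hop-subst (cong (λ a → not (a ∧ not (y q))) (sym (A-bit q))) (cong not (sym (C-bit q))) refl
        (cong not (sym (A-bit q))) (cong (λ a → not (a ∧ not (y (q ⊹ r)))) (sym (A-bit⁺ q)))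
        (hop?⇒Hop _ _ _ _ _ (⇒-elim
          (left-V (w q) (w (q ⊹ r)) (c q) (c (q ⊹ r)) (c (q ℤ.- + r))) (ascent-free q)))

      same-flip : ∀ q → flip (w q) (w (q ⊹ r)) (c q) ≡ flip (w q) (w (q ⊹ r)) (c′ q)
      same-flip q = Pass-flip (pass q)

      large-H : Crossing C x′ D h′
      large-H q = Hop-subst (cong (_∨ x′ q) (sym (D-bit q)))
        (sym (trans (C-bit q) (cong (w (q ⊹ r) xor_) (same-flip q)))) refl
        (sym (D-bit q)) (cong (_∨ x′ (q ⊹ r)) (sym (D-bit⁺ q)))
        (hop?⇒Hop _ _ _ _ _ (⇒-elim
          (right-H (w q) (w (q ⊹ r)) (c′ q) (c′ (q ⊹ r)) (c′ (q ℤ.- + r))) (descent-free q)))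

      large-V : Crossing (not ∘ D) y′ (not ∘ B) (not ∘ v′)
      large-V q = Hop-subst refl (cong not (sym (D-bit⁺ q))) refl
        (cong not (sym (trans (B-bit q) (cong (w q xor_) (same-flip q))))) refl
        (hop?⇒Hop _ _ _ _ _ (⇒-elim (right-V (w q) (w (q ⊹ r)) (c′ q) (c′ (q ⊹ r))) (descent-free q)))

    reindex : ∀ {A B C D D′ : ℤ → Bool} {τ} → (∀ q → D′ q ≡ D q) → Config A B C τ D → Config A B C τ D′
    reindex e k = record { Config k ; D-bit = λ q → trans (e q) (Config.D-bit k q) }

    reindex′ : ∀ {A A′ B C D : ℤ → Bool} {τ} → (∀ q → A′ q ≡ A q) → Config A B C τ D → Config A′ B C τ D
    reindex′ e k = record { Config k ; A-bit = λ q → trans (e q) (Config.A-bit k q) }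

    private
      at⁻ : ∀ (P : ℤ → Set) q → P ((q ℤ.- + r) ⊹ r) → P q
      at⁻ P q = subst P (minus-⊹ q r)

    -- `h` shows α with the horizontal arrivals; taking away the vertical departures `y` gives `w`.
    module FromSmall {A B C x y h g : ℤ → Bool} (H : Crossing A x B h) (V : Crossing (not ∘ C) y (not ∘ A) g) where

      w c : ℤ → Bool
      w q = h q ∧ not (y q)
      c q = x q ∨ y q

      private
        facts : ∀ q → _
        facts q = left-facts (w q) (w (q ⊹ r)) (c q) (x q) (y q) (B q) (C (q ⊹ r)) (A (q ⊹ r))
          (y (q ⊹ r) ∨ (w (q ⊹ r) ∧ not (x q))) (⇒-elim (⇒-elim (⇒-elim (⇒-elim (⇒-elim (⇒-elim
          (left-all-holds (h q) (A q) (A (q ⊹ r)) (x q) (B q) (h (q ⊹ r)) (g q) (C (q ⊹ r)) (y q) (g (q ⊹ r)) (y (q ⊹ r)))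
          (Hop⇒hop? (H q))) (Hop⇒hop? (V q)))
          (at⁻ (λ p → (A p ⇒ h p) ≡ true) q (incoming⇒back (H (q ℤ.- + r)))))
          (incoming⇒back (H q))) (proj₁ (front-split (V (q ⊹ r))))) (proj₂ (front-split (V (q ⊹ r)))))

      x≡ : ∀ q → x q ≡ Xl (w (q ⊹ r)) (c q)
      x≡ q = proj₁ (facts q)
      y≡ : ∀ q → y q ≡ Yl (w q) (c q)
      y≡ q = proj₁ (proj₂ (facts q))
      valid : ∀ q → no-descent (w q) (w (q ⊹ r)) (c q) ≡ true
      valid q = proj₁ (proj₂ (proj₂ (facts q)))
      B-bit : ∀ q → B q ≡ w q xor flip (w q) (w (q ⊹ r)) (c q)
      B-bit q = proj₁ (proj₂ (proj₂ (proj₂ (facts q))))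
      C-bit : ∀ q → C (q ⊹ r) ≡ w (q ⊹ r) xor flip (w q) (w (q ⊹ r)) (c q)
      C-bit q = proj₁ (proj₂ (proj₂ (proj₂ (proj₂ (facts q)))))
      A-bit : ∀ q → A q ≡ small (w q) (c q) (c (q ℤ.- + r))
      A-bit q = subst (λ p → A p ≡ small (w p) (c p) (c (q ℤ.- + r))) (minus-⊹ q r)
        (trans (proj₂ (proj₂ (proj₂ (proj₂ (proj₂ (facts (q ℤ.- + r)))))))
          (cong₂ (λ y₁ x₀ → y₁ ∨ (w (q ℤ.- + r ⊹ r) ∧ not x₀)) (y≡ (q ℤ.- + r ⊹ r)) (x≡ (q ℤ.- + r))))

    -- `not (g q)` shows δ with the vertical arrivals taken back; restoring the horizontal
    -- departures `x` gives `w` again.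
    module FromLarge {B C D x y h g : ℤ → Bool} (H : Crossing C x D h) (V : Crossing (not ∘ D) y (not ∘ B) g) where

      w c : ℤ → Bool
      w q = not (g q) ∨ x q
      c q = x q ∨ y q

      private
        facts : ∀ q → _
        facts q = right-facts (w q) (w (q ⊹ r)) (c q) (x q) (y q) (B q) (C (q ⊹ r)) (D (q ⊹ r))
          (y q ∨ (w (q ⊹ r) ∧ not (x (q ⊹ r)))) (⇒-elim (⇒-elim (⇒-elim (⇒-elim (⇒-elim
          (right-all-holds (h q) (C (q ⊹ r)) (x q) (D q) (h (q ⊹ r)) (g q) (D (q ⊹ r)) (y q) (B q) (g (q ⊹ r)) (x (q ⊹ r)))
          (Hop⇒hop? (H q))) (Hop⇒hop? (V q)))
          (at⁻ (λ p → (not (D p) ⇒ g p) ≡ true) q (incoming⇒back (V (q ℤ.- + r)))))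
          (proj₁ (front-split (H (q ⊹ r))))) (proj₂ (front-split (H (q ⊹ r)))))

      x≡ : ∀ q → x q ≡ Xr (w q) (c q)
      x≡ q = proj₁ (facts q)
      y≡ : ∀ q → y q ≡ Yr (w (q ⊹ r)) (c q)
      y≡ q = proj₁ (proj₂ (facts q))
      valid : ∀ q → no-descent (w (q ⊹ r)) (w q) (c q) ≡ true
      valid q = proj₁ (proj₂ (proj₂ (facts q)))
      B-bit : ∀ q → B q ≡ w q xor flip (w q) (w (q ⊹ r)) (c q)
      B-bit q = proj₁ (proj₂ (proj₂ (proj₂ (facts q))))
      C-bit : ∀ q → C (q ⊹ r) ≡ w (q ⊹ r) xor flip (w q) (w (q ⊹ r)) (c q)
      C-bit q = proj₁ (proj₂ (proj₂ (proj₂ (proj₂ (facts q)))))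
      D-bit : ∀ q → D q ≡ large (w q) (c q) (c (q ℤ.- + r))
      D-bit q = subst (λ p → D p ≡ large (w p) (c p) (c (q ℤ.- + r))) (minus-⊹ q r)
        (trans (proj₂ (proj₂ (proj₂ (proj₂ (proj₂ (facts (q ℤ.- + r)))))))
          (cong₂ (λ y₀ x₁ → y₀ ∨ (w (q ℤ.- + r ⊹ r) ∧ not x₁)) (y≡ (q ℤ.- + r)) (x≡ (q ℤ.- + r ⊹ r))))

  -- Matrix entries as stacks

  fin⇒bool : Fin 2 → Bool
  fin⇒bool zero       = false
  fin⇒bool (suc zero) = true

  bool⇒fin : Bool → Fin 2
  bool⇒fin false = zero
  bool⇒fin true  = suc zero

  fin⇒bool-injective : ∀ {i j} → fin⇒bool i ≡ fin⇒bool j → i ≡ j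
  fin⇒bool-injective {zero}     {zero}     _ = refl
  fin⇒bool-injective {suc zero} {suc zero} _ = refl
  fin⇒bool-injective {zero}     {suc zero} ()
  fin⇒bool-injective {suc zero} {zero}     ()

  fin⇒bool-bool⇒fin : ∀ b → fin⇒bool (bool⇒fin b) ≡ b
  fin⇒bool-bool⇒fin true  = refl
  fin⇒bool-bool⇒fin false = refl

  stackOnto : ∀ {k} → BitVec k → List Bool → List Bool
  stackOnto []      σ = σ
  stackOnto (i ∷ a) σ = stackOnto a (fin⇒bool i ∷ σ)

  -- the last bit of a is on top
  stack : ∀ {k} → BitVec k → List Bool
  stack a = stackOnto a []

  length-stackOnto : ∀ {k} (a : BitVec k) σ → length (stackOnto a σ) ≡ k + length σ
  length-stackOnto []      σ = refl
  length-stackOnto (i ∷ a) σ = trans (length-stackOnto a _) (ℕₚ.+-suc _ (length σ))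

  length-stack : ∀ {k} (a : BitVec k) → length (stack a) ≡ k
  length-stack a = trans (length-stackOnto a []) (ℕₚ.+-identityʳ _)

  stackOnto-injective : ∀ {k} (a b : BitVec k) {σ τ} → stackOnto a σ ≡ stackOnto b τ → a ≡ b × σ ≡ τ
  stackOnto-injective []      []      e = refl , e
  stackOnto-injective (i ∷ a) (j ∷ b) e with stackOnto-injective a b e
  ... | refl , e′ with Listₚ.∷-injective e′
  ...   | i≡j , σ≡τ = cong (_∷ a) (fin⇒bool-injective i≡j) , σ≡τ

  unstack : ∀ {k} σ → length σ ≡ k → Σ[ a ∈ BitVec k ] stack a ≡ σ
  unstack {k} σ refl = let a , e = go σ in a , trans (e []) (Listₚ.++-identityʳ σ)
    where
    snoc : ∀ {k} (a : BitVec k) b σ → stackOnto (a Vec.∷ʳ bool⇒fin b) σ ≡ b ∷ stackOnto a σ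
    snoc []      b σ = cong (_∷ σ) (fin⇒bool-bool⇒fin b)
    snoc (i ∷ a) b σ = snoc a b _
    go : ∀ σ → Σ[ a ∈ BitVec (length σ) ] (∀ τ → stackOnto a τ ≡ σ List.++ τ)
    go []      = [] , λ τ → refl
    go (b ∷ σ) = let a , e = go σ in a Vec.∷ʳ bool⇒fin b , λ τ → trans (snoc a b τ) (cong (b ∷_) (e τ))

  xor-solve : ∀ m w f → m ≡ w xor f → w ≡ m xor f × f ≡ m xor w
  xor-solve true  true  false refl = refl , refl
  xor-solve true  false true  refl = refl , refl
  xor-solve false true  true  refl = refl , refl
  xor-solve false false false refl = refl , refl

  -- Existence and uniqueness of the missing corner

  module Growth (R : ℕ) where
    open Ribbon R using (r)
    open Strips R
    open LocalRule R hiding (r)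

    record Rule (α β γ : Partition) (a : BitVec r) (δ : Partition) : Set where
      constructor rule
      field
        config : Config (bead α) (bead β) (bead γ) (stack a) (bead δ)

    private
      crossing-back : ∀ {i x o h} → Crossing i x o h → ∀ {n} → Supp n x → ∀ q → n + r < ℤ.∣ q ∣ → h q ≡ i q
      crossing-back {i} {x} {o} {h} cr {n} s q lt = subst (λ k → h k ≡ i k) (minus-⊹ q r)
        (stay-back (Hop-subst refl refl (s _ (proj₁ (far-⊹⁻ n r (q ℤ.- + r)
          (subst (λ k → n + r < ℤ.∣ k ∣) (sym (minus-⊹ q r)) lt)))) refl refl (cr (q ℤ.- + r))))

      Far-weaken : ∀ {m n b} → m ≤ n → Far m b → Far n b
      Far-weaken m≤n f q lt = f q (ℕₚ.≤-<-trans m≤n lt)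

      bound : (a b c : ℕ) → ℕ
      bound a b c = a + b + c + r

      bounds : ∀ a b c → a ≤ bound a b c × b ≤ bound a b c × a + r ≤ bound a b c × b + r ≤ bound a b c × c ≤ bound a b c
      bounds a b c = ℕₚ.≤-trans (ℕₚ.m≤m+n a r) ar , ℕₚ.≤-trans (ℕₚ.m≤m+n b r) br , ar , br ,
        ℕₚ.≤-trans (ℕₚ.m≤n+m c (a + b)) (ℕₚ.m≤m+n _ r)
        where
        ar : a + r ≤ bound a b c
        ar = ℕₚ.+-monoˡ-≤ r (ℕₚ.≤-trans (ℕₚ.m≤m+n a b) (ℕₚ.m≤m+n _ c))
        br : b + r ≤ bound a b c
        br = ℕₚ.+-monoˡ-≤ r (ℕₚ.≤-trans (ℕₚ.m≤n+m b a) (ℕₚ.m≤m+n _ c))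

      far-sign : ∀ {a b s} → a ≡ s → b ≡ false → a ∧ not b ≡ s
      far-sign {a} refl refl = Boolₚ.∧-identityʳ a

      far-sign′ : ∀ {a b s} → a ≡ not s → b ≡ false → not a ∨ b ≡ s
      far-sign′ {s = s} refl refl = trans (Boolₚ.∨-identityʳ _) (Boolₚ.not-involutive s)

      ∨-false : ∀ {a b} → a ≡ false → b ≡ false → a ∨ b ≡ false
      ∨-false refl refl = refl

    private

      -- `large` prescribes the beads of δ. Replaying the horizontal flow from γ shows that a
      -- partition has them, and replaying the vertical flow back from that partition ends in β.
      growCorner : ∀ {α β γ} → HorizontalStrip r α β → VerticalStrip r α γ → (a : BitVec r) →
                  Σ[ δ ∈ Partition ] HorizontalStrip r γ δ × VerticalStrip r β δ × Rule α β γ a δ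
      growCorner {α} {β} {γ} S T a = δ , horizontal-strip (proj₁ (proj₂ built)) ,
        subst (λ ν → VerticalStrip r ν δ) β′≡β (vertical-strip (proj₁ (proj₂ back))) , rule config′
        where
        module S = H.Recorded (H.recording (Horizontal.run (horizontal-run S)))
        module T = V.Recorded (V.recording (Vertical.run (vertical-run T)))
        module W = FromSmall {A = bead α} {B = bead β} {C = bead γ} S.flow T.flow
        n : ℕ
        n = bound S.bound T.bound (size α)
        S≤n = proj₁ (bounds S.bound T.bound (size α))
        T≤n = proj₁ (proj₂ (bounds S.bound T.bound (size α)))
        w-far : Far n W.w
        w-far q lt = let _ , _ , sr , _ , αn = bounds S.bound T.bound (size α) in far-sign
          (trans (crossing-back {bead α} {S.x} {bead β} {S.h} S.flow S.support q (ℕₚ.≤-<-trans sr lt))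
            (Far-weaken αn (bead-far α) q lt))
          (Supp-mono T≤n T.support q lt)
        c-supp : Supp n W.c
        c-supp q lt = ∨-false (Supp-mono S≤n S.support q lt) (Supp-mono T≤n T.support q lt)
        matched = match-forward W.w w-far W.c W.valid (stack a) (length-stack a)
        c′ = proj₁ matched
        D : ℤ → Bool
        D q = large (W.w q) (c′ q) (c′ (q ℤ.- + r))
        n≤n+r = ℕₚ.m≤m+n n r
        config : Config (bead α) (bead β) (bead γ) (stack a) D
        config = record
          { w-far = w-far ; c-supp = Supp-mono n≤n+r c-supp
          ; c′-supp = proj₁ (Supp-matched W.w w-far (proj₂ matched) ℕₚ.≤-refl) (Supp-mono n≤n+r c-supp)
          ; matching = proj₂ matched
          ; A-bit = W.A-bit ; B-bit = W.B-bit ; C-bit = W.C-bit ; D-bit = λ q → refl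
          }
        built = H.replay (suc (n + r + (n + r))) (ℤ.- + (n + r)) γ (Config.large-H config) (H.Supp⇒In (Config.x′-supp config))
        δ = proj₁ built
        config′ : Config (bead α) (bead β) (bead γ) (stack a) (bead δ)
        config′ = reindex (proj₂ (proj₂ built)) config
        back = V.replay (suc (n + r + (n + r))) (ℤ.- + (n + r)) δ (Config.large-V config′) (V.Supp⇒In (Config.y′-supp config′))
        β′≡β : proj₁ back ≡ β
        β′≡β = beads⇒≡ _ β λ q → Boolₚ.not-injective (proj₂ (proj₂ back) q)

      -- Here α is reached by undoing the vertical strip from γ, and the entry is the stack left
      -- over by the backward matching.
      shrinkCorner : ∀ {β γ δ} → HorizontalStrip r γ δ → VerticalStrip r β δ →
                     Σ[ α ∈ Partition ] Σ[ a ∈ BitVec r ]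
                     HorizontalStrip r α β × VerticalStrip r α γ × Rule α β γ a δ
      shrinkCorner {β} {γ} {δ} S T = α , proj₁ unstacked ,
        subst (HorizontalStrip r α) β′≡β (horizontal-strip (proj₁ (proj₂ back))) ,
        vertical-strip (proj₁ (proj₂ built)) , rule config′
        where
        module S = H.Recorded (H.recording (Horizontal.run (horizontal-run S)))
        module T = V.Recorded (V.recording (Vertical.run (vertical-run T)))
        module W = FromLarge {B = bead β} {C = bead γ} {D = bead δ} S.flow T.flow
        n : ℕ
        n = bound S.bound T.bound (size δ)
        S≤n = proj₁ (bounds S.bound T.bound (size δ))
        T≤n = proj₁ (proj₂ (bounds S.bound T.bound (size δ)))
        w-far : Far n W.w
        w-far q lt = let _ , _ , _ , tr , δn = bounds S.bound T.bound (size δ) in far-sign′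
          (trans (crossing-back {not ∘ bead δ} {T.x} {not ∘ bead β} {T.h} T.flow T.support q (ℕₚ.≤-<-trans tr lt))
            (cong not (Far-weaken δn (bead-far δ) q lt)))
          (Supp-mono S≤n S.support q lt)
        c′-supp : Supp n W.c
        c′-supp q lt = ∨-false (Supp-mono S≤n S.support q lt) (Supp-mono T≤n T.support q lt)
        matched = match-backward W.w w-far W.c W.valid
        c = proj₁ matched
        unstacked = unstack (proj₁ (proj₂ matched)) (proj₁ (proj₂ (proj₂ matched)))
        matching : Matching W.w w-far c W.c (stack (proj₁ unstacked))
        matching = subst (Matching W.w w-far c W.c) (sym (proj₂ unstacked)) (proj₂ (proj₂ (proj₂ matched)))
        A : ℤ → Bool
        A q = small (W.w q) (c q) (c (q ℤ.- + r))
        n≤n+r = ℕₚ.m≤m+n n r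
        same : ∀ q → flip (W.w q) (W.w (q ⊹ r)) (W.c q) ≡ flip (W.w q) (W.w (q ⊹ r)) (c q)
        same q = sym (Pass-flip (Matching.pass matching q))
        config : Config A (bead β) (bead γ) (stack (proj₁ unstacked)) (bead δ)
        config = record
          { w-far = w-far ; c′-supp = Supp-mono n≤n+r c′-supp
          ; c-supp = proj₂ (Supp-matched W.w w-far matching ℕₚ.≤-refl) (Supp-mono n≤n+r c′-supp)
          ; matching = matching
          ; A-bit = λ q → refl
          ; B-bit = λ q → trans (W.B-bit q) (cong (W.w q xor_) (same q))
          ; C-bit = λ q → trans (W.C-bit q) (cong (W.w (q ⊹ r) xor_) (same q))
          ; D-bit = W.D-bit
          }
        built = V.replay (suc (n + r + (n + r))) (ℤ.- + (n + r)) γ (Config.small-V config) (V.Supp⇒In (Config.y-supp config))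
        α = proj₁ built
        config′ : Config (bead α) (bead β) (bead γ) (stack (proj₁ unstacked)) (bead δ)
        config′ = reindex′ (λ q → Boolₚ.not-injective (proj₂ (proj₂ built) q)) config
        back = H.replay (suc (n + r + (n + r))) (ℤ.- + (n + r)) α (Config.small-H config′) (H.Supp⇒In (Config.x-supp config′))
        β′≡β : proj₁ back ≡ β
        β′≡β = beads⇒≡ _ β (proj₂ (proj₂ back))

    abstract

      addCorner : ∀ {α β γ} → HorizontalStrip r α β → VerticalStrip r α γ → (a : BitVec r) →
                  Σ[ δ ∈ Partition ] HorizontalStrip r γ δ × VerticalStrip r β δ × Rule α β γ a δ
      addCorner = growCorner

      removeCorner : ∀ {β γ δ} → HorizontalStrip r γ δ → VerticalStrip r β δ →
                     Σ[ α ∈ Partition ] Σ[ a ∈ BitVec r ]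
                     HorizontalStrip r α β × VerticalStrip r α γ × Rule α β γ a δ
      removeCorner = shrinkCorner

    private
      -- At equal bits the choice is the flip. A chosen ascent at `q` shows as a missing bead of α
      -- at `q + r`, a chosen descent as a bead of δ there.
      recoverˡ recoverʳ : (w₀ w₁ f k : Bool) → Bool
      recoverˡ w₀ w₁ f k = if w₀ ≐ w₁ then f else (w₁ ∧ not k)
      recoverʳ w₀ w₁ f k = if w₀ ≐ w₁ then f else (w₀ ∧ k)

      recoverˡ-correct : ∀ w₀ w₁ c c₁ → (no-descent w₀ w₁ c ⇒ c ≐ recoverˡ w₀ w₁ (flip w₀ w₁ c) (small w₁ c₁ c)) ≡ true
      recoverˡ-correct = tautology 4 (λ w₀ w₁ c c₁ →
        no-descent w₀ w₁ c ⇒ c ≐ recoverˡ w₀ w₁ (flip w₀ w₁ c) (small w₁ c₁ c)) refl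

      recoverʳ-correct : ∀ w₀ w₁ c c₁ → (no-descent w₁ w₀ c ⇒ c ≐ recoverʳ w₀ w₁ (flip w₀ w₁ c) (large w₁ c₁ c)) ≡ true
      recoverʳ-correct = tautology 4 (λ w₀ w₁ c c₁ →
        no-descent w₁ w₀ c ⇒ c ≐ recoverʳ w₀ w₁ (flip w₀ w₁ c) (large w₁ c₁ c)) refl

      cong₃ : ∀ (f : Bool → Bool → Bool → Bool) {a a′ b b′ c c′} →
              a ≡ a′ → b ≡ b′ → c ≡ c′ → f a b c ≡ f a′ b′ c′
      cong₃ f refl refl refl = refl

      cong₄ : ∀ {f : Bool → Bool → Bool → Bool → Bool} {a a′ b b′ c c′ d d′} →
              a ≡ a′ → b ≡ b′ → c ≡ c′ → d ≡ d′ → f a b c d ≡ f a′ b′ c′ d′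
      cong₄ refl refl refl refl = refl

    module _ {A A′ B C D D′ : ℤ → Bool} {τ τ′} (K : Config A B C τ D) (K′ : Config A′ B C τ′ D′) where
      private
        module K  = Config K
        module K′ = Config K′

        flip-at flip-at′ : ℤ → Bool
        flip-at q  = flip (K.w q) (K.w (q ⊹ r)) (K.c q)
        flip-at′ q = flip (K′.w q) (K′.w (q ⊹ r)) (K′.c q)

        -- `B q` gives the flip at `q` from `w q`, and `C (q + r)` then gives `w (q + r)`: no other
        -- corner enters the recursion.
        same : ∀ q → K.w q ≡ K′.w q × flip-at q ≡ flip-at′ q
        same = ascending (λ q → K.w q ≡ K′.w q × flip-at q ≡ flip-at′ q)
          (K.n + K′.n + (K.m + K′.m)) R base next
          where
          base : ∀ q → K.n + K′.n + (K.m + K′.m) < ℤ.∣ q ∣ → isNeg q ≡ true →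
                 K.w q ≡ K′.w q × flip-at q ≡ flip-at′ q
          base q lt _ =
            trans (K.w-far q (ℕₚ.≤-<-trans (ℕₚ.≤-trans (ℕₚ.m≤m+n _ K′.n) (ℕₚ.m≤m+n _ (K.m + K′.m))) lt))
              (sym (K′.w-far q (ℕₚ.≤-<-trans (ℕₚ.≤-trans (ℕₚ.m≤n+m _ K.n) (ℕₚ.m≤m+n _ (K.m + K′.m))) lt))) ,
            trans (cong (_∧ _) (K.c-supp q (ℕₚ.≤-<-trans (ℕₚ.≤-trans (ℕₚ.m≤m+n _ K′.m) (ℕₚ.m≤n+m _ (K.n + K′.n))) lt)))
              (sym (cong (_∧ _) (K′.c-supp q (ℕₚ.≤-<-trans (ℕₚ.≤-trans (ℕₚ.m≤n+m _ K.m) (ℕₚ.m≤n+m _ (K.n + K′.n))) lt))))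
          next : ∀ q → K.w q ≡ K′.w q × flip-at q ≡ flip-at′ q →
                 K.w (q ⊹ r) ≡ K′.w (q ⊹ r) × flip-at (q ⊹ r) ≡ flip-at′ (q ⊹ r)
          next q (ew , ef) = ew′ , trans (proj₂ (xor-solve _ _ _ (K.B-bit (q ⊹ r))))
              (trans (cong (B (q ⊹ r) xor_) ew′) (sym (proj₂ (xor-solve _ _ _ (K′.B-bit (q ⊹ r))))))
            where
            ew′ : K.w (q ⊹ r) ≡ K′.w (q ⊹ r)
            ew′ = trans (proj₁ (xor-solve _ _ _ (K.C-bit q)))
              (trans (cong (C (q ⊹ r) xor_) ef) (sym (proj₁ (xor-solve _ _ _ (K′.C-bit q)))))

        ew : ∀ q → K.w q ≡ K′.w q
        ew q = proj₁ (same q)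

      -- The choices `c` are read off α; with equal stacks on the far left, all passes then agree.
      forward-unique : (∀ q → A q ≡ A′ q) → τ ≡ τ′ → ∀ q → D q ≡ D′ q
      forward-unique eA eτ q = trans (K.D-bit q)
        (trans (cong₃ large (ew q) (ec′ q) (ec′ (q ℤ.- + r))) (sym (K′.D-bit q)))
        where
        ec : ∀ q → K.c q ≡ K′.c q
        ec q = trans (≐-sound (⇒-elim (recoverˡ-correct (K.w q) (K.w (q ⊹ r)) (K.c q) (K.c (q ⊹ r))) (K.ascent-free q)))
          (trans (cong₄ {recoverˡ} (ew q) (ew (q ⊹ r)) (proj₂ (same q))
              (trans (sym (K.A-bit⁺ q)) (trans (eA (q ⊹ r)) (K′.A-bit⁺ q))))
            (sym (≐-sound (⇒-elim (recoverˡ-correct (K′.w q) (K′.w (q ⊹ r)) (K′.c q) (K′.c (q ⊹ r))) (K′.ascent-free q)))))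
        both : ∀ q → K.σ q ≡ K′.σ q → K.c′ q ≡ K′.c′ q × K.σ (q ⊹ 1) ≡ K′.σ (q ⊹ 1)
        both q e = Pass-functional (K.pass q)
          (Pass-cong (sym (ew q)) (sym (ew (q ⊹ r))) (sym (ec q)) refl (sym e) refl (K′.pass q))
        eσ : ∀ q → K.σ q ≡ K′.σ q
        eσ = ascending (λ q → K.σ q ≡ K′.σ q) (suc (K.n + r) + suc (K′.n + r)) 0
          (λ q lt neg → trans (K.σ-left q (ℕₚ.≤-<-trans (ℕₚ.m≤m+n _ _) lt) neg)
            (trans eτ (sym (K′.σ-left q (ℕₚ.≤-<-trans (ℕₚ.m≤n+m _ (suc (K.n + r))) lt) neg))))
          (λ q e → proj₂ (both q e))
        ec′ : ∀ q → K.c′ q ≡ K′.c′ q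
        ec′ q = proj₁ (both q (eσ q))

      -- The choices `c′` are read off δ, and the stacks are compared from the right, where both are
      -- empty. On the far left they are the two entries.
      backward-unique : (∀ q → D q ≡ D′ q) → (∀ q → A q ≡ A′ q) × τ ≡ τ′
      backward-unique eD = (λ q → trans (K.A-bit q)
          (trans (cong₃ small (ew q) (ec q) (ec (q ℤ.- + r))) (sym (K′.A-bit q)))) ,
        trans (sym (K.σ-left far (s≤s (ℕₚ.m≤m+n (suc (K.n + r)) _)) refl)) (trans (eσ far)
          (K′.σ-left far (s≤s (ℕₚ.m≤n+m (suc (K′.n + r)) (suc (K.n + r)))) refl))
        where
        far : ℤ
        far = -[1+ suc (K.n + r) + suc (K′.n + r) ]
        ec′ : ∀ q → K.c′ q ≡ K′.c′ q
        ec′ q = trans (≐-sound (⇒-elim (recoverʳ-correct (K.w q) (K.w (q ⊹ r)) (K.c′ q) (K.c′ (q ⊹ r))) (K.descent-free q)))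
          (trans (cong₄ {recoverʳ} (ew q) (ew (q ⊹ r))
              (trans (sym (K.same-flip q)) (trans (proj₂ (same q)) (K′.same-flip q)))
              (trans (sym (K.D-bit⁺ q)) (trans (eD (q ⊹ r)) (K′.D-bit⁺ q))))
            (sym (≐-sound (⇒-elim (recoverʳ-correct (K′.w q) (K′.w (q ⊹ r)) (K′.c′ q) (K′.c′ (q ⊹ r))) (K′.descent-free q)))))
        both : ∀ q → K.σ (q ⊹ 1) ≡ K′.σ (q ⊹ 1) → K.c q ≡ K′.c q × K.σ q ≡ K′.σ q
        both q e = Pass-functional (Pass-reverse (K.pass q))
          (Pass-cong (sym (ew (q ⊹ r))) (sym (ew q)) (sym (ec′ q)) refl (sym e) refl (Pass-reverse (K′.pass q)))
        eσ : ∀ q → K.σ q ≡ K′.σ q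
        eσ = descending (λ q → K.σ q ≡ K′.σ q) (K.n + K′.n)
          (λ q lt pos → trans (K.σ-right q (ℕₚ.≤-<-trans (ℕₚ.m≤m+n _ _) lt) pos)
            (sym (K′.σ-right q (ℕₚ.≤-<-trans (ℕₚ.m≤n+m _ K.n) lt) pos)))
          (λ q e → proj₂ (both q e))
        ec : ∀ q → K.c q ≡ K′.c q
        ec q = proj₁ (both q (eσ (q ⊹ 1)))

    Rule-forward : ∀ {α β γ a δ δ′} → Rule α β γ a δ → Rule α β γ a δ′ → δ ≡ δ′
    Rule-forward {δ = δ} {δ′} (rule K) (rule K′) = beads⇒≡ δ δ′ (forward-unique K K′ (λ _ → refl) refl)

    Rule-backward : ∀ {α α′ β γ a a′ δ} → Rule α β γ a δ → Rule α′ β γ a′ δ → α ≡ α′ × a ≡ a′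
    Rule-backward {α} {α′} {a = a} {a′} (rule K) (rule K′) = let eA , eτ = backward-unique K K′ (λ _ → refl) in
      beads⇒≡ α α′ eA , proj₁ (stackOnto-injective a a′ eτ)

  -- Sizes and heights under the local rule

  sumℤ-+ : ∀ (f g : ℤ → ℕ) k n → sumℤ (λ q → f q + g q) k n ≡ sumℤ f k n + sumℤ g k n
  sumℤ-+ f g k zero    = refl
  sumℤ-+ f g k (suc n) = trans (cong (f k + g k ℕ.+_) (sumℤ-+ f g (k ⊹ 1) n))
    (+-interchange (f k) (g k) _ _)
    where
    +-interchange : ∀ a b c d → a + b + (c + d) ≡ a + c + (b + d)
    +-interchange = solve 4 (λ a b c d → a :+ b :+ (c :+ d) := a :+ c :+ (b :+ d)) refl
      where open ℕSolver.+-*-Solver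

  sumℤ-split : ∀ (f : ℤ → ℕ) k m n → sumℤ f k (m + n) ≡ sumℤ f k m + sumℤ f (k ⊹ m) n
  sumℤ-split f k zero    n = cong (λ l → sumℤ f l n) (sym (⊹-identityʳ k))
  sumℤ-split f k (suc m) n = trans (cong (f k ℕ.+_) (trans (sumℤ-split f (k ⊹ 1) m n)
      (cong (λ l → sumℤ f (k ⊹ 1) m + sumℤ f l n) (⊹-suc k m))))
    (sym (ℕₚ.+-assoc (f k) _ _))

  sumℤ-shift : ∀ (f : ℤ → ℕ) (s : ℤ → ℤ) → (∀ q → s (q ⊹ 1) ≡ s q ⊹ 1) →
               ∀ k n → sumℤ (f ∘ s) k n ≡ sumℤ f (s k) n
  sumℤ-shift f s hom k zero    = refl
  sumℤ-shift f s hom k (suc n) = cong (f (s k) ℕ.+_)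
    (trans (sumℤ-shift f s hom (k ⊹ 1) n) (cong (λ l → sumℤ f l n) (hom k)))

  sumℤ-vanish : ∀ {f : ℤ → ℕ} k n → (∀ i → i < n → f (k ⊹ i) ≡ 0) → sumℤ f k n ≡ 0
  sumℤ-vanish k n e = trans (sumℤ-cong {g = λ _ → 0} k n e) (sumℤ-zero k n λ _ → refl)

  -- `Ψ` acts as a potential. It will be a statistic of the stack, whose boundary values are that of
  -- the matrix entry and 0.
  sumℤ-telescope : ∀ (f g Ψ : ℤ → ℕ) → (∀ q → f q + Ψ (q ⊹ 1) ≡ g q + Ψ q) →
                   ∀ k n → sumℤ f k n + Ψ (k ⊹ n) ≡ sumℤ g k n + Ψ k
  sumℤ-telescope f g Ψ e k zero    = cong Ψ (⊹-identityʳ k)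
  sumℤ-telescope f g Ψ e k (suc n) = begin
    f k + F + Ψ (k ⊹ suc n)       ≡⟨ cong (λ l → f k + F + Ψ l) (⊹-suc k n) ⟨
    f k + F + Ψ (k ⊹ 1 ⊹ n)       ≡⟨ ℕₚ.+-assoc (f k) F _ ⟩
    f k + (F + Ψ (k ⊹ 1 ⊹ n))     ≡⟨ cong (f k ℕ.+_) (sumℤ-telescope f g Ψ e (k ⊹ 1) n) ⟩
    f k + (G + Ψ (k ⊹ 1))         ≡⟨ rearrange (f k) G (Ψ (k ⊹ 1)) ⟩
    f k + Ψ (k ⊹ 1) + G           ≡⟨ cong (_+ G) (e k) ⟩
    g k + Ψ k + G                 ≡⟨ rearrange′ (g k) (Ψ k) G ⟩
    g k + G + Ψ k                 ∎
    where
    open ≡-Reasoning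
    F = sumℤ f (k ⊹ 1) n
    G = sumℤ g (k ⊹ 1) n
    open ℕSolver.+-*-Solver
    rearrange : ∀ a b c → a + (b + c) ≡ a + c + b
    rearrange = solve 3 (λ a b c → a :+ (b :+ c) := a :+ c :+ b) refl
    rearrange′ : ∀ a b c → a + b + c ≡ a + c + b
    rearrange′ = solve 3 (λ a b c → a :+ b :+ c := a :+ c :+ b) refl

  total-end : ∀ n → (ℤ.- + n) ⊹ suc (n + n) ≡ + suc n
  total-end n = trans (cong ((ℤ.- + n) ⊹_) (sym (ℕₚ.+-suc n n)))
    (trans (sym (⊹-assoc (ℤ.- + n) n (suc n))) (cong (_⊹ suc n) (ℤₚ.+-inverseˡ (+ n))))

  total-cong : ∀ {f g : ℤ → ℕ} n → (∀ q → f q ≡ g q) → total n f ≡ total n g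
  total-cong n e = sumℤ-cong (ℤ.- + n) (suc (n + n)) λ i _ → e _

  Vanishing : ℕ → (ℤ → ℕ) → Set
  Vanishing N f = ∀ q → N < ℤ.∣ q ∣ → f q ≡ 0

  private
    minus-suc : ∀ q d → (q ⊹ 1) ℤ.- + d ≡ (q ℤ.- + d) ⊹ 1
    minus-suc q d = ⊹-cancelʳ d (trans (minus-⊹ (q ⊹ 1) d)
      (trans (cong (_⊹ 1) (sym (minus-⊹ q d))) (⊹-comm (q ℤ.- + d) d 1)))

    minus-minus : ∀ q d m → (q ℤ.- + (d + suc m)) ⊹ m ≡ q ℤ.- + suc d
    minus-minus q d m = ⊹-cancelʳ (suc d) (trans (⊹-assoc (q ℤ.- + (d + suc m)) m (suc d))
      (trans (cong (λ l → (q ℤ.- + (d + suc m)) ⊹ l)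
          (trans (ℕₚ.+-suc m d) (trans (cong suc (ℕₚ.+-comm m d)) (sym (ℕₚ.+-suc d m)))))
        (trans (minus-⊹ q (d + suc m)) (sym (minus-⊹ q (suc d))))))

  module _ {N : ℕ} {f g : ℤ → ℕ} (f-vanish : Vanishing N f) (g-vanish : Vanishing N g) where

    shift-product : ∀ d → total N (λ q → f q * g (q ⊹ d)) ≡ total N (λ q → g q * f (q ℤ.- + d))
    shift-product d = begin
      sumℤ (λ q → f q * g (q ⊹ d)) k n   ≡⟨ sumℤ-cong k n (λ i _ → trans (ℕₚ.*-comm (f (k ⊹ i)) _)
                                              (cong (λ p → g (k ⊹ i ⊹ d) * f p) (sym (⊹-minus (k ⊹ i) d)))) ⟩
      sumℤ (λ q → F (q ⊹ d)) k n         ≡⟨ sumℤ-shift F (_⊹ d) (λ q → ⊹-comm q 1 d) k n ⟩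
      sumℤ F (k ⊹ d) n                   ≡⟨ cong (_+ sumℤ F (k ⊹ d) n) (sumℤ-vanish k d left) ⟨
      sumℤ F k d + sumℤ F (k ⊹ d) n      ≡⟨ sumℤ-split F k d n ⟨
      sumℤ F k (d + n)                   ≡⟨ cong (sumℤ F k) (ℕₚ.+-comm d n) ⟩
      sumℤ F k (n + d)                   ≡⟨ sumℤ-split F k n d ⟩
      sumℤ F k n + sumℤ F (k ⊹ n) d      ≡⟨ cong (sumℤ F k n ℕ.+_) (sumℤ-vanish (k ⊹ n) d right) ⟩
      sumℤ F k n + 0                     ≡⟨ ℕₚ.+-identityʳ _ ⟩
      sumℤ F k n                         ∎
      where
      open ≡-Reasoning
      k : ℤ
      k = ℤ.- + N
      n : ℕ
      n = suc (N + N)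
      F : ℤ → ℕ
      F q = g q * f (q ℤ.- + d)
      neg-⊹ : ∀ n e → (ℤ.- + (n + e)) ⊹ e ≡ ℤ.- + n
      neg-⊹ n e = trans (ℤₚ.-m+n≡n⊖m (n + e) e)
        (trans (ℤₚ.⊖-≤ (ℕₚ.m≤n+m e n)) (cong (λ l → ℤ.- + l) (ℕₚ.m+n∸n≡m n e)))
      left : ∀ i → i < d → F (k ⊹ i) ≡ 0
      left i i<d = trans (cong (g (k ⊹ i) *_) (f-vanish _ (subst (λ l → N < ℤ.∣ l ∣) (sym eq)
          (subst (N <_) (sym (ℤₚ.∣-i∣≡∣i∣ (+ (N + (d ∸ i))))) (ℕₚ.m<m+n N (ℕₚ.m<n⇒0<n∸m i<d))))))
        (ℕₚ.*-zeroʳ (g (k ⊹ i)))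
        where
        eq : k ⊹ i ℤ.- + d ≡ ℤ.- + (N + (d ∸ i))
        eq = ⊹-cancelʳ d (trans (minus-⊹ (k ⊹ i) d) (sym (trans
          (cong ((ℤ.- + (N + (d ∸ i))) ⊹_) (sym (ℕₚ.m∸n+n≡m (ℕₚ.<⇒≤ i<d))))
          (trans (sym (⊹-assoc (ℤ.- + (N + (d ∸ i))) (d ∸ i) i)) (cong (_⊹ i) (neg-⊹ N (d ∸ i)))))))
      right : ∀ i → i < d → F (k ⊹ n ⊹ i) ≡ 0
      right i _ = cong (_* f (k ⊹ n ⊹ i ℤ.- + d)) (g-vanish _
        (subst (λ l → N < ℤ.∣ l ⊹ i ∣) (sym (total-end N)) (s≤s (ℕₚ.m≤m+n N i))))

    -- Both sides count, with weights `f` and `g`, the pairs of positions at a distance from `d + 1`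
    -- to `d + m`.
    swap-products : ∀ m d → total N (λ q → f q * sumℤ g (q ⊹ suc d) m) ≡
                            total N (λ q → g q * sumℤ f (q ℤ.- + (d + m)) m)
    swap-products zero d = total-cong N λ q → trans (ℕₚ.*-zeroʳ (f q)) (sym (ℕₚ.*-zeroʳ (g q)))
    swap-products (suc m) d = begin
      total N (λ q → f q * sumℤ g (q ⊹ suc d) (suc m))
        ≡⟨ total-cong N (λ q → trans (ℕₚ.*-distribˡ-+ (f q) (g (q ⊹ suc d)) _)
             (cong (λ l → f q * g (q ⊹ suc d) + f q * sumℤ g l m) (⊹-suc′ q (suc d)))) ⟩
      total N (λ q → f q * g (q ⊹ suc d) + f q * sumℤ g (q ⊹ suc (suc d)) m)
        ≡⟨ sumℤ-+ (λ q → f q * g (q ⊹ suc d)) (λ q → f q * sumℤ g (q ⊹ suc (suc d)) m) (ℤ.- + N) (suc (N + N)) ⟩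
      total N (λ q → f q * g (q ⊹ suc d)) + total N (λ q → f q * sumℤ g (q ⊹ suc (suc d)) m)
        ≡⟨ cong₂ _+_ (shift-product (suc d)) (swap-products m (suc d)) ⟩
      total N (λ q → g q * f (q ℤ.- + suc d)) + total N (λ q → g q * sumℤ f (q ℤ.- + (suc d + m)) m)
        ≡⟨ ℕₚ.+-comm (total N (λ q → g q * f (q ℤ.- + suc d))) _ ⟩
      total N (λ q → g q * sumℤ f (q ℤ.- + (suc d + m)) m) + total N (λ q → g q * f (q ℤ.- + suc d))
        ≡⟨ sumℤ-+ (λ q → g q * sumℤ f (q ℤ.- + (suc d + m)) m) (λ q → g q * f (q ℤ.- + suc d)) (ℤ.- + N) (suc (N + N)) ⟨
      total N (λ q → g q * sumℤ f (q ℤ.- + (suc d + m)) m + g q * f (q ℤ.- + suc d))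
        ≡⟨ total-cong N (λ q → trans
             (cong₂ (λ a b → g q * sumℤ f (q ℤ.- + a) m + g q * f b) (sym (ℕₚ.+-suc d m)) (sym (minus-minus q d m)))
             (trans (sym (ℕₚ.*-distribˡ-+ (g q) _ _))
               (cong (g q *_) (sym (sumℤ-last f (q ℤ.- + (d + suc m)) m))))) ⟩
      total N (λ q → g q * sumℤ f (q ℤ.- + (d + suc m)) (suc m)) ∎
      where open ≡-Reasoning

  module Crossings (R : ℕ) where

    r : ℕ
    r = suc R

    ahead : (ℤ → ℕ) → ℤ → ℕ
    ahead f q = sumℤ f (q ⊹ 1) R

    delayed : (ℤ → ℕ) → ℤ → ℕ
    delayed f q = f (q ℤ.- + r)

    -- The distances from 1 to `R` are symmetric under `j ↦ r − j`, so a delay by `r` turns looking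
    -- back from `q` into looking ahead.
    ahead-swap : ∀ {N f g} → Vanishing N f → Vanishing N g →
                 total N (λ q → f q * ahead g q) ≡ total N (λ q → g q * ahead (delayed f) q)
    ahead-swap {N} {f} {g} vf vg = trans (swap-products vf vg R 0) (total-cong N λ q →
      cong (g q *_) (sym (trans (sumℤ-shift f (λ p → p ℤ.- + r) (λ p → minus-suc p r) (q ⊹ 1) R)
        (cong (λ l → sumℤ f l R) (⊹-cancelʳ r (trans (minus-⊹ (q ⊹ 1) r)
          (sym (trans (sym (⊹-suc′ (q ℤ.- + R) R)) (cong (_⊹ 1) (minus-⊹ q R))))))))))

    module _ {N : ℕ} {w x y : ℤ → ℕ} (x-vanish : Vanishing N x) (y-vanish : Vanishing N y) where

      private
        distribute : ∀ {f g e : ℤ → ℕ} (z : ℤ → ℕ) → (∀ q → f q ≡ g q + e q) →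
          total N (λ q → z q * ahead f q) ≡ total N (λ q → z q * ahead g q) + total N (λ q → z q * ahead e q)
        distribute {f} {g} {e} z eq = trans (total-cong N λ q → trans
            (cong (z q *_) (trans (sumℤ-cong (q ⊹ 1) R λ i _ → eq _) (sumℤ-+ g e (q ⊹ 1) R)))
            (ℕₚ.*-distribˡ-+ (z q) (ahead g q) (ahead e q)))
          (sumℤ-+ (λ q → z q * ahead g q) (λ q → z q * ahead e q) (ℤ.- + N) (suc (N + N)))

        collect : total N (λ q → x q * ahead w q) + total N (λ q → y q * ahead w q) ≡
                  total N (λ q → (x q + y q) * ahead w q)
        collect = trans (sym (sumℤ-+ (λ q → x q * ahead w q) (λ q → y q * ahead w q) (ℤ.- + N) (suc (N + N))))
          (total-cong N λ q → sym (ℕₚ.*-distribʳ-+ (ahead w q) (x q) (y q)))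

      -- The moves of either strip change the number of beads over which the other
      -- one jumps; the two effects cancel.
      cancel-small : ∀ {h v : ℤ → ℕ} → (∀ q → h q ≡ w q + y q) → (∀ q → w q ≡ v q + delayed x q) →
        total N (λ q → x q * ahead h q) + total N (λ q → y q * ahead v q) ≡
        total N (λ q → (x q + y q) * ahead w q)
      cancel-small {h} {v} eh ev = begin
        total N (λ q → x q * ahead h q) + Yv                    ≡⟨ cong (_+ Yv) (distribute x eh) ⟩
        Xw + total N (λ q → x q * ahead y q) + Yv               ≡⟨ cong (λ t → Xw + t + Yv) (ahead-swap x-vanish y-vanish) ⟩
        Xw + total N (λ q → y q * ahead (delayed x) q) + Yv     ≡⟨ ℕₚ.+-assoc Xw _ Yv ⟩
        Xw + (total N (λ q → y q * ahead (delayed x) q) + Yv)   ≡⟨ cong (Xw ℕ.+_) (ℕₚ.+-comm _ Yv) ⟩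
        Xw + (Yv + total N (λ q → y q * ahead (delayed x) q))   ≡⟨ cong (Xw ℕ.+_) (distribute y ev) ⟨
        Xw + total N (λ q → y q * ahead w q)                    ≡⟨ collect ⟩
        total N (λ q → (x q + y q) * ahead w q)                 ∎
        where
        open ≡-Reasoning
        Xw = total N (λ q → x q * ahead w q)
        Yv = total N (λ q → y q * ahead v q)

      cancel-large : ∀ {h v : ℤ → ℕ} → (∀ q → h q ≡ w q + delayed y q) → (∀ q → w q ≡ v q + x q) →
        total N (λ q → x q * ahead h q) + total N (λ q → y q * ahead v q) ≡
        total N (λ q → (x q + y q) * ahead w q)
      cancel-large {h} {v} eh ev = begin
        total N (λ q → x q * ahead h q) + Yv                    ≡⟨ cong (_+ Yv) (distribute x eh) ⟩
        Xw + total N (λ q → x q * ahead (delayed y) q) + Yv     ≡⟨ cong (λ t → Xw + t + Yv) (ahead-swap y-vanish x-vanish) ⟨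
        Xw + total N (λ q → y q * ahead x q) + Yv               ≡⟨ ℕₚ.+-assoc Xw _ Yv ⟩
        Xw + (total N (λ q → y q * ahead x q) + Yv)             ≡⟨ cong (Xw ℕ.+_) (ℕₚ.+-comm _ Yv) ⟩
        Xw + (Yv + total N (λ q → y q * ahead x q))             ≡⟨ cong (Xw ℕ.+_) (distribute y ev) ⟨
        Xw + total N (λ q → y q * ahead w q)                    ≡⟨ collect ⟩
        total N (λ q → (x q + y q) * ahead w q)                 ∎
        where
        open ≡-Reasoning
        Xw = total N (λ q → x q * ahead w q)
        Yv = total N (λ q → y q * ahead v q)

  trues : List Bool → ℕ
  trues []      = 0
  trues (b ∷ σ) = # b + trues σ

  -- Each bit counts with the number of entries beneath it, that is, with its level.
  levels : List Bool → ℕ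
  levels []      = 0
  levels (b ∷ σ) = # b * length σ + levels σ

  #-fin⇒bool : ∀ i → # (fin⇒bool i) ≡ toℕ i
  #-fin⇒bool zero       = refl
  #-fin⇒bool (suc zero) = refl

  trues-stackOnto : ∀ {k} (a : BitVec k) σ → trues (stackOnto a σ) ≡ trues σ + ∣ a ∣
  trues-stackOnto []      σ = sym (ℕₚ.+-identityʳ _)
  trues-stackOnto (i ∷ a) σ = trans (trues-stackOnto a _)
    (trans (cong (_+ ∣ a ∣) (trans (ℕₚ.+-comm _ (trues σ)) (cong (trues σ ℕ.+_) (#-fin⇒bool i))))
      (ℕₚ.+-assoc (trues σ) _ _))

  levels-stackOnto : ∀ {k} (a : BitVec k) σ →
    levels (stackOnto a σ) ≡ levels σ + ∑[ i < k ] ((length σ + toℕ i) * toℕ (lookup a i))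
  levels-stackOnto []          σ = sym (ℕₚ.+-identityʳ _)
  levels-stackOnto {suc k} (i ∷ a) σ = begin
    levels (stackOnto a (fin⇒bool i ∷ σ))                ≡⟨ levels-stackOnto a _ ⟩
    # (fin⇒bool i) * length σ + levels σ + rest′         ≡⟨ cong₂ (λ b s → b * length σ + levels σ + s) (#-fin⇒bool i)
                                                             (sum-cong-≗ λ j → cong (_* toℕ (lookup a j)) (sym (ℕₚ.+-suc (length σ) (toℕ j)))) ⟩
    toℕ i * length σ + levels σ + rest                   ≡⟨ rearrange (toℕ i) (length σ) (levels σ) rest ⟩
    levels σ + ((length σ + 0) * toℕ i + rest)           ∎
    where
    open ≡-Reasoning
    open ℕSolver.+-*-Solver
    rest rest′ : ℕ
    rest  = ∑[ j < k ] ((length σ + suc (toℕ j)) * toℕ (lookup a j))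
    rest′ = ∑[ j < k ] ((suc (length σ) + toℕ j) * toℕ (lookup a j))
    rearrange : ∀ a b c d → a * b + c + d ≡ c + ((b + 0) * a + d)
    rearrange = solve 4 (λ a b c d → a :* b :+ c :+ d := c :+ ((b :+ con 0) :* a :+ d)) refl

  private
    #-small-h : ∀ w c → # (w ∨ Yl w c) ≡ # w + # (Yl w c)
    #-small-h true  true  = refl
    #-small-h true  false = refl
    #-small-h false true  = refl
    #-small-h false false = refl

    #-small-v : ∀ w c cₚ → # w ≡ # (small w c cₚ ∧ not (Yl w c)) + # (Xl w cₚ)
    #-small-v true  true  true  = refl
    #-small-v true  true  false = refl
    #-small-v true  false true  = refl
    #-small-v true  false false = refl
    #-small-v false true  true  = refl
    #-small-v false true  false = refl
    #-small-v false false true  = refl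
    #-small-v false false false = refl

    #-large-h : ∀ w c cₚ → # (large w c cₚ ∨ Xr w c) ≡ # w + # (Yr w cₚ)
    #-large-h true  true  true  = refl
    #-large-h true  true  false = refl
    #-large-h true  false true  = refl
    #-large-h true  false false = refl
    #-large-h false true  true  = refl
    #-large-h false true  false = refl
    #-large-h false false true  = refl
    #-large-h false false false = refl

    #-large-v : ∀ w c → # w ≡ # (w ∧ not (Xr w c)) + # (Xr w c)
    #-large-v true  true  = refl
    #-large-v true  false = refl
    #-large-v false true  = refl
    #-large-v false false = refl

    -- Choices are conserved: a pushed bit is a move of the small side put aside, a popped one a
    -- move of the large side.
    Pass-X : ∀ {w w′ c c′ σ σ′} → Pass w w′ c c′ σ σ′ → # (Xr w c′) + trues σ′ ≡ # (Xl w′ c) + trues σ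
    Pass-X keep         = refl
    Pass-X (push {e})   = cong (λ b → # b + _) (sym (Boolₚ.∧-identityʳ e))
    Pass-X (pop {f})    = cong (λ b → # b + _) (Boolₚ.∧-identityʳ f)

    Pass-Y : ∀ {w w′ c c′ σ σ′} → Pass w w′ c c′ σ σ′ → # (Yr w′ c′) + trues σ′ ≡ # (Yl w c) + trues σ
    Pass-Y keep         = refl
    Pass-Y (push {e})   = cong (λ b → # b + _) (sym (Boolₚ.∧-identityʳ e))
    Pass-Y (pop {f})    = cong (λ b → # b + _) (Boolₚ.∧-identityʳ f)

    -- Here `l` is the number of beads of `w` strictly between `q` and `q + r`. A pushed or popped
    -- bit has exactly `l` entries beneath it, and the factor 2 arises because both strips make the
    -- move.
    Pass-levels : ∀ {w w′ c c′ σ σ′} l → Pass w w′ c c′ σ σ′ → length σ ≡ # w + l →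
      (# (Xr w c′) + # (Yr w′ c′)) * l + 2 * levels σ′ ≡ (# (Xl w′ c) + # (Yl w c)) * l + 2 * levels σ
    Pass-levels l keep e = refl
    Pass-levels l (push {e = b}) refl rewrite Boolₚ.∧-identityʳ b =
      solve 3 (λ b l s → con 2 :* (b :* l :+ s) := (b :+ b) :* l :+ con 2 :* s) refl (# b) l _
      where open ℕSolver.+-*-Solver
    Pass-levels l (pop {f = b}) refl rewrite Boolₚ.∧-identityʳ b =
      solve 3 (λ b l s → (b :+ b) :* l :+ con 2 :* s := con 2 :* (b :* l :+ s)) refl (# b) l _
      where open ℕSolver.+-*-Solver

  module Weights (R : ℕ) where
    open Ribbon R using (r)
    open Strips R
    open LocalRule R hiding (r)
    open Growth R
    open Crossings R using (ahead; delayed; cancel-small; cancel-large)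

    private
      -- By uniqueness of flows, size and height may be read off the flow supplied by the local rule
      -- instead of the recorded standardisation.
      measure-horizontal : ∀ {α β x h n} (S : HorizontalStrip r α β) → Crossing (bead α) x (bead β) h → Supp n x →
        stripSize S ≡ total n (# ∘ x) × stripHeight S ≡ total n (λ q → # (x q) * ahead (# ∘ h) q)
      measure-horizontal {α} {β} {x} {h} {n} S cr s =
        trans (sym (Horizontal.hops≡ hr)) (trans (N.hops≡ n s′) (total-cong n λ q → cong # (proj₁ (same q)))) ,
        trans (sym (Horizontal.weights≡ hr)) (trans (N.weight≡ n s′) (total-cong n λ q → cong₂ _*_ (cong # (proj₁ (same q)))
          (sumℤ-cong (q ⊹ 1) R λ i _ → cong # (proj₂ (same _)))))
        where
        hr = horizontal-run S
        module N = H.Recorded (H.recording (Horizontal.run hr))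
        same : ∀ q → N.x q ≡ x q × N.h q ≡ h q
        same = H.flow-unique {ρ = α} {o = bead β} N.flow cr N.support s
        s′ : Supp n N.x
        s′ q lt = trans (proj₁ (same q)) (s q lt)

      measure-vertical : ∀ {α γ y g n} (T : VerticalStrip r α γ) →
        Crossing (not ∘ bead γ) y (not ∘ bead α) g → Supp n y →
        stripSize T ≡ total n (# ∘ y) × stripHeight T ≡ total n (λ q → # (y q) * ahead (# ∘ not ∘ g) q)
      measure-vertical {α} {γ} {y} {g} {n} T cr s =
        trans (sym (Vertical.hops≡ vr)) (trans (N.hops≡ n s′) (total-cong n λ q → cong # (proj₁ (same q)))) ,
        trans (sym (Vertical.weights≡ vr)) (trans (N.weight≡ n s′) (total-cong n λ q → cong₂ _*_ (cong # (proj₁ (same q)))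
          (sumℤ-cong (q ⊹ 1) R λ i _ → cong (# ∘ not) (proj₂ (same _)))))
        where
        vr = vertical-run T
        module N = V.Recorded (V.recording (Vertical.run vr))
        same : ∀ q → N.x q ≡ y q × N.h q ≡ g q
        same = V.flow-unique {ρ = γ} {o = not ∘ bead α} N.flow cr N.support s
        s′ : Supp n N.x
        s′ q lt = trans (proj₁ (same q)) (s q lt)

    -- Tableaux are compared by their shapes, while the statistics use the recorded
    -- standardisations; this makes the statistics functions of the shapes.
    horizontal-unique : ∀ {α β} (S S′ : HorizontalStrip r α β) →
                        stripSize S ≡ stripSize S′ × stripHeight S ≡ stripHeight S′
    horizontal-unique S S′ =
      let m  = measure-horizontal S N.flow N.support
          m′ = measure-horizontal S′ N.flow N.support
      in trans (proj₁ m) (sym (proj₁ m′)) , trans (proj₂ m) (sym (proj₂ m′))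
      where module N = H.Recorded (H.recording (Horizontal.run (horizontal-run S)))

    vertical-unique : ∀ {α γ} (T T′ : VerticalStrip r α γ) →
                      stripSize T ≡ stripSize T′ × stripHeight T ≡ stripHeight T′
    vertical-unique T T′ =
      let m  = measure-vertical T N.flow N.support
          m′ = measure-vertical T′ N.flow N.support
      in trans (proj₁ m) (sym (proj₁ m′)) , trans (proj₂ m) (sym (proj₂ m′))
      where module N = V.Recorded (V.recording (Vertical.run (vertical-run T)))

    module _ {α β γ δ a} (K : Rule α β γ a δ)
             (S : HorizontalStrip r α β) (T : VerticalStrip r α γ)
             (S′ : HorizontalStrip r γ δ) (T′ : VerticalStrip r β δ) where
      private
        module K = Config (Rule.config K)

        N : ℕ
        -- Beyond all supports, and far enough out that the stack is `stack a` at `− N` and empty at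
        -- `N + 1`.
        N = suc (suc (K.n + r)) + K.m

        widen : ∀ {x} → Supp K.m x → Supp N x
        widen = Supp-mono (ℕₚ.m≤n+m K.m (suc (suc (K.n + r))))

        vanish : ∀ {x} → Supp K.m x → Vanishing N (# ∘ x)
        vanish s q lt = cong # (widen s q lt)

        σ-first : K.σ (ℤ.- + N) ≡ stack a
        σ-first = K.σ-left -[1+ suc (K.n + r) + K.m ] (s≤s (s≤s (ℕₚ.m≤m+n _ K.m))) refl

        σ-last : K.σ ((ℤ.- + N) ⊹ suc (N + N)) ≡ []
        σ-last = trans (cong K.σ (total-end N)) (K.σ-right (+ suc N)
          (s≤s (ℕₚ.≤-trans (ℕₚ.m≤m+n K.n r) (ℕₚ.≤-trans (ℕₚ.n≤1+n _) (ℕₚ.≤-trans (ℕₚ.n≤1+n _) (ℕₚ.m≤m+n _ K.m)))))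
          refl)

        telescoped : ∀ (f g : ℤ → ℕ) (Ψ : List Bool → ℕ) → Ψ [] ≡ 0 →
          (∀ q → f q + Ψ (K.σ (q ⊹ 1)) ≡ g q + Ψ (K.σ q)) → total N f ≡ total N g + Ψ (stack a)
        telescoped f g Ψ Ψ[] e = trans (sym (ℕₚ.+-identityʳ _)) (trans
          (cong (total N f ℕ.+_) (sym (trans (cong Ψ σ-last) Ψ[])))
          (trans (sumℤ-telescope f g (Ψ ∘ K.σ) e (ℤ.- + N) (suc (N + N)))
            (cong (λ σ → total N g + Ψ σ) σ-first)))

        mS  = measure-horizontal S K.small-H (widen K.x-supp)
        mT  = measure-vertical T K.small-V (widen K.y-supp)
        mS′ = measure-horizontal S′ K.large-H (widen K.x′-supp)
        mT′ = measure-vertical T′ K.large-V (widen K.y′-supp)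

      horizontal-size : stripSize S′ ≡ stripSize S + ∣ a ∣
      horizontal-size = trans (proj₁ mS′) (trans
        (telescoped (# ∘ K.x′) (# ∘ K.x) trues refl (λ q → Pass-X (K.pass q)))
        (cong₂ _+_ (sym (proj₁ mS)) (trues-stackOnto a [])))

      vertical-size : stripSize T′ ≡ stripSize T + ∣ a ∣
      vertical-size = trans (proj₁ mT′) (trans
        (telescoped (# ∘ K.y′) (# ∘ K.y) trues refl (λ q → Pass-Y (K.pass q)))
        (cong₂ _+_ (sym (proj₁ mT)) (trues-stackOnto a [])))

      -- Each side equals the sum in which every move is charged with the beads of `w` that it
      -- passes; these two sums differ by the telescoped `levels`.
      heights-balance : stripHeight S′ + stripHeight T′ ≡ stripHeight S + stripHeight T + 2 * 𝐧 a
      heights-balance = begin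
        stripHeight S′ + stripHeight T′
          ≡⟨ cong₂ _+_ (proj₂ mS′) (proj₂ mT′) ⟩
        total N (λ q → # (K.x′ q) * ahead (# ∘ K.h′) q) + total N (λ q → # (K.y′ q) * ahead (# ∘ not ∘ not ∘ K.v′) q)
          ≡⟨ cancel-large (vanish K.x′-supp) (vanish K.y′-supp) h′≡ v′≡ ⟩
        total N (λ q → (# (K.x′ q) + # (K.y′ q)) * ahead (# ∘ K.w) q)
          ≡⟨ telescoped (λ q → (# (K.x′ q) + # (K.y′ q)) * ahead (# ∘ K.w) q)
               (λ q → (# (K.x q) + # (K.y q)) * ahead (# ∘ K.w) q) (λ σ → 2 * levels σ) refl
               (λ q → Pass-levels (ahead (# ∘ K.w) q) (K.pass q) (K.σ-length q)) ⟩
        total N (λ q → (# (K.x q) + # (K.y q)) * ahead (# ∘ K.w) q) + 2 * levels (stack a)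
          ≡⟨ cong₂ (λ s t → s + 2 * t)
               (cancel-small (vanish K.x-supp) (vanish K.y-supp) (λ q → #-small-h (K.w q) (K.c q)) v≡)
               (sym (levels-stackOnto a [])) ⟨
        total N (λ q → # (K.x q) * ahead (# ∘ K.h) q) + total N (λ q → # (K.y q) * ahead (# ∘ not ∘ not ∘ K.v) q) + 2 * 𝐧 a
          ≡⟨ cong (_+ 2 * 𝐧 a) (cong₂ _+_ (proj₂ mS) (proj₂ mT)) ⟨
        stripHeight S + stripHeight T + 2 * 𝐧 a ∎
        where
        open ≡-Reasoning
        h′≡ : ∀ q → # (K.h′ q) ≡ # (K.w q) + delayed (# ∘ K.y′) q
        h′≡ q = trans (cong (λ d → # (d ∨ K.x′ q)) (K.D-bit q))
          (trans (#-large-h (K.w q) (K.c′ q) (K.c′ (q ℤ.- + r)))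
            (cong (λ p → # (K.w q) + # (Yr (K.w p) (K.c′ (q ℤ.- + r)))) (sym (minus-⊹ q r))))
        v≡ : ∀ q → # (K.w q) ≡ # (not (not (K.v q))) + delayed (# ∘ K.x) q
        v≡ q = trans (trans (#-small-v (K.w q) (K.c q) (K.c (q ℤ.- + r)))
          (cong₂ (λ b p → # (b ∧ not (K.y q)) + # (Xl (K.w p) (K.c (q ℤ.- + r))))
            (sym (K.A-bit q)) (sym (minus-⊹ q r))))
          (cong (λ b → # b + delayed (# ∘ K.x) q) (sym (Boolₚ.not-involutive (K.v q))))
        v′≡ : ∀ q → # (K.w q) ≡ # (not (not (K.v′ q))) + # (K.x′ q)
        v′≡ q = trans (#-large-v (K.w q) (K.c′ q))
          (cong (λ b → # b + # (K.x′ q)) (sym (Boolₚ.not-involutive (K.v′ q))))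

  -- Growth diagrams

  half-+ : ∀ a b → + a ℚ./ 2 ℚ.+ + b ℚ./ 2 ≡ + (a + b) ℚ./ 2
  half-+ a b = ℚₚ.toℚᵘ-injective (begin
    ℚ.toℚᵘ (+ a ℚ./ 2 ℚ.+ + b ℚ./ 2)                 ≈⟨ ℚₚ.toℚᵘ-homo-+ (+ a ℚ./ 2) (+ b ℚ./ 2) ⟩
    ℚ.toℚᵘ (+ a ℚ./ 2) ℚᵘ.+ ℚ.toℚᵘ (+ b ℚ./ 2)       ≈⟨ ℚᵘₚ.+-cong (ℚₚ.toℚᵘ-fromℚᵘ (ℚᵘ.mkℚᵘ (+ a) 1)) (ℚₚ.toℚᵘ-fromℚᵘ (ℚᵘ.mkℚᵘ (+ b) 1)) ⟩
    ℚᵘ.mkℚᵘ (+ a) 1 ℚᵘ.+ ℚᵘ.mkℚᵘ (+ b) 1             ≈⟨ ℚᵘ.*≡* (fractions (+ a) (+ b)) ⟩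
    ℚᵘ.mkℚᵘ (+ (a + b)) 1                            ≈⟨ ℚₚ.toℚᵘ-fromℚᵘ (ℚᵘ.mkℚᵘ (+ (a + b)) 1) ⟨
    ℚ.toℚᵘ (+ (a + b) ℚ./ 2)                         ∎)
    where
    open import Relation.Binary.Reasoning.Setoid ℚᵘₚ.≃-setoid
    open ℤSolver.+-*-Solver
    fractions : ∀ x y → (x ℤ.* + 2 ℤ.+ y ℤ.* + 2) ℤ.* + 2 ≡ (x ℤ.+ y) ℤ.* + 4
    fractions = solve 2 (λ x y → (x :* con (+ 2) :+ y :* con (+ 2)) :* con (+ 2) := (x :+ y) :* con (+ 4)) refl

  half-double : ∀ n → + (2 * n) ℚ./ 2 ≡ + n ℚ./ 1
  half-double n = ℚₚ.fromℚᵘ-cong {ℚᵘ.mkℚᵘ (+ (2 * n)) 1} {ℚᵘ.mkℚᵘ (+ n) 0} (ℚᵘ.*≡* (begin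
    + (2 * n) ℤ.* + 1   ≡⟨ ℤₚ.*-identityʳ (+ (2 * n)) ⟩
    + (2 * n)           ≡⟨ cong +_ (ℕₚ.*-comm 2 n) ⟩
    + (n * 2)           ≡⟨ ℤₚ.pos-* n 2 ⟩
    + n ℤ.* + 2         ∎))
    where open ≡-Reasoning

  -- Twice the spin, kept in ℕ until the very end.
  tableauHeight : ∀ {_⊏_ r n γ μ} → Tableau _⊏_ r n γ μ → ℕ
  tableauHeight []      = 0
  tableauHeight (s ∷ T) = sumᴸ (heights (standardisation s)) + tableauHeight T

  spin-tableauHeight : ∀ {_⊏_ r n γ μ} (T : Tableau _⊏_ r n γ μ) → spin T ≡ + tableauHeight T ℚ./ 2
  spin-tableauHeight []      = refl
  spin-tableauHeight (s ∷ T) = trans (cong (stripSpin s ℚ.+_) (spin-tableauHeight T))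
    (half-+ (sumᴸ (heights (standardisation s))) (tableauHeight T))

  shapes-head : ∀ {_⊏_ r n γ μ} (T : Tableau _⊏_ r n γ μ) → Vec.head (shapes T) ≡ γ
  shapes-head []      = refl
  shapes-head (s ∷ T) = refl

  shapes-last : ∀ {_⊏_ r n γ μ} (T : Tableau _⊏_ r n γ μ) → Vec.last (shapes T) ≡ μ
  shapes-last []      = refl
  shapes-last (s ∷ T) = trans (last-∷ (Vec.head (shapes (s ∷ T))) (shapes T)) (shapes-last T)
    where
    last-∷ : ∀ {n} (ν : Partition) (νs : Vec Partition (suc n)) → Vec.last (ν ∷ νs) ≡ Vec.last νs
    last-∷ ν (_ ∷ _) = refl

  shapes⇒start : ∀ {_⊏_ r n γ γ′ μ μ′} (T : Tableau _⊏_ r n γ μ) (T′ : Tableau _⊏_ r n γ′ μ′) →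
                 shapes T ≡ shapes T′ → γ ≡ γ′
  shapes⇒start T T′ e = trans (sym (shapes-head T)) (trans (cong Vec.head e) (shapes-head T′))

  shapes⇒end : ∀ {_⊏_ r n γ γ′ μ μ′} (T : Tableau _⊏_ r n γ μ) (T′ : Tableau _⊏_ r n γ′ μ′) →
               shapes T ≡ shapes T′ → μ ≡ μ′
  shapes⇒end T T′ e = trans (sym (shapes-last T)) (trans (cong Vec.last e) (shapes-last T′))

  emptyStrip : ∀ {_⊏_ r γ} → Strip _⊏_ r γ γ
  emptyStrip = record { standardisation = ε ; monotone = [] }

  constant : ∀ {_⊏_ r} n {γ} → Tableau _⊏_ r n γ γ
  constant zero    = []
  constant (suc n) = emptyStrip ∷ constant n

  wt-constant : ∀ {_⊏_ r} n {γ} j → lookup (wt (constant {_⊏_} {r} n {γ})) j ≡ 0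
  wt-constant (suc n) zero    = refl
  wt-constant (suc n) (suc j) = wt-constant n j

  tableauHeight-constant : ∀ {_⊏_ r} n {γ} → tableauHeight (constant {_⊏_} {r} n {γ}) ≡ 0
  tableauHeight-constant zero    = refl
  tableauHeight-constant (suc n) = tableauHeight-constant n

  module Cores {r γ} (core : IsCore r γ) where

    chain-into-core : ∀ {α} → Chain r α γ → α ≡ γ
    chain-into-core ε = refl
    chain-into-core (x ◅ c) with chain-into-core c
    ... | refl = contradiction (RibbonStep.ribbon x) (core _)

    tableau-into-core : ∀ {_⊏_ n α} (T : Tableau _⊏_ r n α γ) → shapes T ≡ shapes (constant {_⊏_} {r} n {γ})
    tableau-into-core []      = refl
    tableau-into-core {_⊏_} {suc n} (s ∷ T)
      with shapes⇒start T (constant {_⊏_} {r} n {γ}) (tableau-into-core T)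
    ... | refl = cong₂ _∷_ (chain-into-core (standardisation s)) (tableau-into-core T)

  module Grid (R : ℕ) where
    open Ribbon R using (r)
    open Strips R using (stripHeight)
    open Growth R
    open Weights R

    infixr 5 _∷_

    -- One row of cells between two successive horizontal borders. The vertical edge to the right of
    -- each cell is kept because the statistics are handed on from edge to edge.
    data RowGrowth : ∀ {n α ω γ δ} → SemistandardTableau r n α ω → Vec (BitVec r) n →
                     SemistandardTableau r n γ δ → Set where
      []  : ∀ {α γ} → RowGrowth ([] {γ = α}) [] ([] {γ = γ})
      _∷_ : ∀ {n α β γ δ ω μ a as} {S : HorizontalStrip r α β} {S′ : HorizontalStrip r γ δ}
            {T : SemistandardTableau r n β ω} {T′ : SemistandardTableau r n δ μ} →
            Rule α β γ a δ × VerticalStrip r β δ → RowGrowth T as T′ → RowGrowth (S ∷ T) (a ∷ as) (S′ ∷ T′)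

    insertRow : ∀ {n α ω γ} (T : SemistandardTableau r n α ω) → VerticalStrip r α γ → (as : Vec (BitVec r) n) →
                Σ[ μ ∈ Partition ] Σ[ T′ ∈ SemistandardTableau r n γ μ ] VerticalStrip r ω μ × RowGrowth T as T′
    insertRow []      V []       = _ , [] , V , []
    insertRow (S ∷ T) V (a ∷ as) =
      let δ , S′ , V′ , K = addCorner S V a
          μ , T′ , W , g  = insertRow T V′ as
      in μ , S′ ∷ T′ , W , (K , V′) ∷ g

    extractRow : ∀ {n ω γ μ} (T′ : SemistandardTableau r n γ μ) → VerticalStrip r ω μ →
                 Σ[ α ∈ Partition ] Σ[ T ∈ SemistandardTableau r n α ω ] Σ[ as ∈ Vec (BitVec r) n ]
                 VerticalStrip r α γ × RowGrowth T as T′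
    extractRow []        W = _ , [] , [] , W , []
    extractRow (S′ ∷ T′) W =
      let β , T , as , V′ , g = extractRow T′ W
          α , a , S , V , K   = removeCorner S′ V′
      in α , S ∷ T , a ∷ as , V , (K , V′) ∷ g

    insertRow-unique : ∀ {n α ω γ μ α₁ ω₁ γ₁ μ₁ as}
      {T : SemistandardTableau r n α ω} {T₁ : SemistandardTableau r n α₁ ω₁}
      {T′ : SemistandardTableau r n γ μ} {T₁′ : SemistandardTableau r n γ₁ μ₁} →
      RowGrowth T as T′ → RowGrowth T₁ as T₁′ → shapes T ≡ shapes T₁ → γ ≡ γ₁ → shapes T′ ≡ shapes T₁′
    insertRow-unique [] [] e eγ = cong (_∷ []) eγ
    insertRow-unique {T = _ ∷ T} {_ ∷ T₁} ((K , _) ∷ g) ((K₁ , _) ∷ g₁) e eγ =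
      let eα , eT = Vecₚ.∷-injective e
      in cong₂ _∷_ eγ (insertRow-unique g g₁ eT (same K K₁ eα (shapes⇒start T T₁ eT) eγ))
      where
      same : ∀ {α β γ α₁ β₁ γ₁ a δ δ₁} → Rule α β γ a δ → Rule α₁ β₁ γ₁ a δ₁ →
             α ≡ α₁ → β ≡ β₁ → γ ≡ γ₁ → δ ≡ δ₁
      same K K₁ refl refl refl = Rule-forward K K₁

    extractRow-unique : ∀ {n α ω γ μ α₁ ω₁ γ₁ μ₁ as as₁}
      {T : SemistandardTableau r n α ω} {T₁ : SemistandardTableau r n α₁ ω₁}
      {T′ : SemistandardTableau r n γ μ} {T₁′ : SemistandardTableau r n γ₁ μ₁} →
      RowGrowth T as T′ → RowGrowth T₁ as₁ T₁′ → shapes T′ ≡ shapes T₁′ → ω ≡ ω₁ →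
      shapes T ≡ shapes T₁ × as ≡ as₁
    extractRow-unique [] [] e eω = cong (_∷ []) eω , refl
    extractRow-unique {T = _ ∷ T} {_ ∷ T₁} {_ ∷ T′} {_ ∷ T₁′} ((K , _) ∷ g) ((K₁ , _) ∷ g₁) e eω =
      let eγ , eT′ = Vecₚ.∷-injective e
          eT , eas = extractRow-unique g g₁ eT′ eω
          eα , ea  = same K K₁ (shapes⇒start T T₁ eT) eγ (shapes⇒start T′ T₁′ eT′)
      in cong₂ _∷_ eα eT , cong₂ _∷_ ea eas
      where
      same : ∀ {α β γ α₁ β₁ γ₁ a a₁ δ δ₁} → Rule α β γ a δ → Rule α₁ β₁ γ₁ a₁ δ₁ →
             β ≡ β₁ → γ ≡ γ₁ → δ ≡ δ₁ → α ≡ α₁ × a ≡ a₁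
      same K K₁ refl refl refl = Rule-backward K K₁

    module _ {γ : Partition} {n : ℕ} where

      -- All horizontal borders start at the same γ: the left border of the diagram is constant.
      data MatrixGrowth : ∀ {m δ μ} → SemistandardTableau r n γ δ → Matrix r m n →
                          SemistandardTableau r n γ μ → TransposeSemistandardTableau r m δ μ → Set where
        []  : ∀ {δ} {T T′ : SemistandardTableau r n γ δ} → shapes T ≡ shapes T′ → MatrixGrowth T [] T′ []
        _∷_ : ∀ {m δ κ μ as} {A : Matrix r m n} {T : SemistandardTableau r n γ δ}
              {T₁ : SemistandardTableau r n γ κ} {T′ : SemistandardTableau r n γ μ}
              {S : VerticalStrip r δ κ} {Q : TransposeSemistandardTableau r m κ μ} →
              RowGrowth T as T₁ → MatrixGrowth T₁ A T′ Q → MatrixGrowth T (as ∷ A) T′ (S ∷ Q)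

      insert : ∀ {m δ} (T : SemistandardTableau r n γ δ) (A : Matrix r m n) →
               Σ[ μ ∈ Partition ] Σ[ P ∈ SemistandardTableau r n γ μ ]
               Σ[ Q ∈ TransposeSemistandardTableau r m δ μ ] MatrixGrowth T A P Q
      insert T []       = _ , T , [] , [] refl
      insert T (as ∷ A) =
        let κ , T₁ , S , g = insertRow T emptyStrip as
            μ , P , Q , G  = insert T₁ A
        in μ , P , S ∷ Q , g ∷ G

      insert-unique : ∀ {m δ μ δ₁ μ₁} {A : Matrix r m n}
        {T : SemistandardTableau r n γ δ} {T₁ : SemistandardTableau r n γ δ₁}
        {P : SemistandardTableau r n γ μ} {P₁ : SemistandardTableau r n γ μ₁}
        {Q : TransposeSemistandardTableau r m δ μ} {Q₁ : TransposeSemistandardTableau r m δ₁ μ₁} →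
        MatrixGrowth T A P Q → MatrixGrowth T₁ A P₁ Q₁ → shapes T ≡ shapes T₁ →
        shapes P ≡ shapes P₁ × shapes Q ≡ shapes Q₁
      insert-unique {T = T} {T₁} ([] e) ([] e₁) eT =
        trans (sym e) (trans eT e₁) , cong (_∷ []) (shapes⇒end T T₁ eT)
      insert-unique {T = T} {T₁} (g ∷ G) (g₁ ∷ G₁) eT =
        let eP , eQ = insert-unique G G₁ (insertRow-unique g g₁ eT refl)
        in eP , cong₂ _∷_ (shapes⇒end T T₁ eT) eQ

      extract-unique : ∀ {m δ μ δ₁ μ₁} {A A₁ : Matrix r m n}
        {T : SemistandardTableau r n γ δ} {T₁ : SemistandardTableau r n γ δ₁}
        {P : SemistandardTableau r n γ μ} {P₁ : SemistandardTableau r n γ μ₁}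
        {Q : TransposeSemistandardTableau r m δ μ} {Q₁ : TransposeSemistandardTableau r m δ₁ μ₁} →
        MatrixGrowth T A P Q → MatrixGrowth T₁ A₁ P₁ Q₁ → shapes P ≡ shapes P₁ → shapes Q ≡ shapes Q₁ →
        shapes T ≡ shapes T₁ × A ≡ A₁
      extract-unique ([] e) ([] e₁) eP eQ = trans e (trans eP (sym e₁)) , refl
      extract-unique (g ∷ G) (g₁ ∷ G₁) eP eQ with Vecₚ.∷-injective eQ
      ... | eδ , eQ′ with extract-unique G G₁ eP eQ′
      ...   | eT , eA = let eT′ , ea = extractRow-unique g g₁ eT eδ in eT′ , cong₂ _∷_ ea eA

      extract : IsCore r γ → ∀ {m δ μ} (P : SemistandardTableau r n γ μ) (Q : TransposeSemistandardTableau r m δ μ) →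
                Σ[ T ∈ SemistandardTableau r n γ δ ] Σ[ A ∈ Matrix r m n ] MatrixGrowth T A P Q
      extract core P []      = P , [] , [] refl
      extract core P (S ∷ Q) with extract core P Q
      ... | T₁ , A , G with extractRow T₁ S
      -- The left edge of the extracted row is a strip ending in the core, hence trivial, so the
      -- next border starts at `γ` again.
      ...   | α , T , as , V , g with Cores.chain-into-core core (standardisation V)
      ...     | refl = T , as ∷ A , g ∷ G

    -- Each cell adds `∣ a ∣` to both of its strips and `2 * 𝐧 a` to the sum of their heights. The
    -- outer edges `V` and `W` carry arbitrary standardisations, so that those of a prescribed
    -- tableau can be used.
    row-statistics : ∀ {n α ω γ μ as} {T : SemistandardTableau r n α ω} {T′ : SemistandardTableau r n γ μ} →
      RowGrowth T as T′ → (V : VerticalStrip r α γ) (W : VerticalStrip r ω μ) →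
      (∀ j → lookup (wt T′) j ≡ lookup (wt T) j + ∣ lookup as j ∣) ×
      stripSize W ≡ stripSize V + ∑[ j < n ] ∣ lookup as j ∣ ×
      tableauHeight T′ + stripHeight W ≡ tableauHeight T + stripHeight V + 2 * ∑[ j < n ] 𝐧 (lookup as j)
    row-statistics [] V W = (λ ()) ,
      trans (proj₁ (vertical-unique W V)) (sym (ℕₚ.+-identityʳ _)) ,
      trans (proj₂ (vertical-unique W V)) (sym (ℕₚ.+-identityʳ _))
    row-statistics {suc n} {as = a ∷ as} {S ∷ T} {S′ ∷ T′} ((K , V′) ∷ g) V W =
      let ewt , esize , eheight = row-statistics g V′ W in
      (λ { zero → horizontal-size K S V S′ V′ ; (suc j) → ewt j }) ,
      trans esize (trans (cong (_+ sizes) (vertical-size K S V S′ V′)) (ℕₚ.+-assoc (stripSize V) _ _)) ,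
      (begin
        stripHeight S′ + tableauHeight T′ + stripHeight W               ≡⟨ ℕₚ.+-assoc (stripHeight S′) _ _ ⟩
        stripHeight S′ + (tableauHeight T′ + stripHeight W)             ≡⟨ cong (stripHeight S′ ℕ.+_) eheight ⟩
        stripHeight S′ + (tableauHeight T + stripHeight V′ + 2 * spins) ≡⟨ rearrange (stripHeight S′) (tableauHeight T) (stripHeight V′) spins ⟩
        (stripHeight S′ + stripHeight V′) + (tableauHeight T + 2 * spins) ≡⟨ cong (_+ (tableauHeight T + 2 * spins)) (heights-balance K S V S′ V′) ⟩
        (stripHeight S + stripHeight V + 2 * 𝐧 a) + (tableauHeight T + 2 * spins) ≡⟨ rearrange′ (stripHeight S) (stripHeight V) (𝐧 a) (tableauHeight T) spins ⟩
        stripHeight S + tableauHeight T + stripHeight V + 2 * (𝐧 a + spins) ∎)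
      where
      open ≡-Reasoning
      open ℕSolver.+-*-Solver
      sizes spins : ℕ
      sizes = ∑[ j < n ] ∣ lookup as j ∣
      spins = ∑[ j < n ] 𝐧 (lookup as j)
      rearrange : ∀ s t v e → s + (t + v + 2 * e) ≡ (s + v) + (t + 2 * e)
      rearrange = solve 4 (λ s t v e → s :+ (t :+ v :+ con 2 :* e) := (s :+ v) :+ (t :+ con 2 :* e)) refl
      rearrange′ : ∀ s v a t e → (s + v + 2 * a) + (t + 2 * e) ≡ s + t + v + 2 * (a + e)
      rearrange′ = solve 5 (λ s v a t e → (s :+ v :+ con 2 :* a) :+ (t :+ con 2 :* e) :=
                                          s :+ t :+ v :+ con 2 :* (a :+ e)) refl

    -- `P₁` and `Q₁` share only their shapes with the grown tableaux, since the claim concerns every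
    -- pair that corresponds to `A`.
    matrix-statistics : ∀ {γ n m δ μ} {A : Matrix r m n} {T : SemistandardTableau r n γ δ}
      {P : SemistandardTableau r n γ μ} {Q : TransposeSemistandardTableau r m δ μ} → MatrixGrowth T A P Q →
      (P₁ : SemistandardTableau r n γ μ) (Q₁ : TransposeSemistandardTableau r m δ μ) →
      shapes P ≡ shapes P₁ → shapes Q ≡ shapes Q₁ →
      (∀ j → lookup (wt P₁) j ≡ lookup (wt T) j + ∑[ i < m ] ∣ A [ i , j ] ∣) ×
      (∀ i → lookup (wt Q₁) i ≡ ∑[ j < n ] ∣ A [ i , j ] ∣) ×
      tableauHeight P₁ + tableauHeight Q₁ ≡ tableauHeight T + 2 * ∑[ i < m ] (∑[ j < n ] 𝐧 (A [ i , j ]))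
    matrix-statistics {T = T} {P} ([] e) P₁ [] eP eQ =
      (λ j → trans (cong (λ w → lookup w j) (sym ewt)) (sym (ℕₚ.+-identityʳ _))) , (λ ()) ,
      cong (_+ 0) (sym eheight)
      where
      same : ∀ {n α μ α₁ μ₁} (T : SemistandardTableau r n α μ) (T₁ : SemistandardTableau r n α₁ μ₁) →
             shapes T ≡ shapes T₁ → wt T ≡ wt T₁ × tableauHeight T ≡ tableauHeight T₁
      same []      []        e = refl , refl
      same (S ∷ T) (S₁ ∷ T₁) e with Vecₚ.∷-injective e
      ... | refl , e′ with shapes⇒start T T₁ e′
      ...   | refl = let ew , eh = same T T₁ e′ ; es , eh′ = horizontal-unique S S₁
                     in cong₂ _∷_ es ew , cong₂ _+_ eh′ eh
      ewt = proj₁ (same T P₁ (trans e eP))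
      eheight = proj₂ (same T P₁ (trans e eP))
    matrix-statistics {n = n} {suc m} {A = as ∷ A} {T} {Q = S ∷ Q} (_∷_ {T₁ = T₁} g G) P₁ (S₁ ∷ Q₁) eP eQ
      with Vecₚ.∷-injective eQ
    ... | _ , eQ′ with shapes⇒start Q Q₁ eQ′
    ...   | refl =
      let rwt , rsize , rheight = row-statistics g emptyStrip S₁
          mwt , msize , mheight = matrix-statistics G P₁ Q₁ eP eQ′ in
      (λ j → trans (mwt j) (trans (cong (_+ ∑[ i < m ] ∣ A [ i , j ] ∣) (rwt j))
         (ℕₚ.+-assoc (lookup (wt T) j) _ _))) ,
      (λ { zero → rsize ; (suc i) → msize i }) ,
      (begin
        tableauHeight P₁ + (stripHeight S₁ + tableauHeight Q₁) ≡⟨ rearrange (tableauHeight P₁) (stripHeight S₁) _ ⟩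
        tableauHeight P₁ + tableauHeight Q₁ + stripHeight S₁   ≡⟨ cong (_+ stripHeight S₁) mheight ⟩
        tableauHeight T₁ + 2 * rest + stripHeight S₁           ≡⟨ rearrange′ (tableauHeight T₁) rest (stripHeight S₁) ⟩
        tableauHeight T₁ + stripHeight S₁ + 2 * rest           ≡⟨ cong (_+ 2 * rest) rheight ⟩
        tableauHeight T + 0 + 2 * first + 2 * rest             ≡⟨ rearrange″ (tableauHeight T) first rest ⟩
        tableauHeight T + 2 * (first + rest)                   ∎)
      where
      open ≡-Reasoning
      open ℕSolver.+-*-Solver
      first rest : ℕ
      first = ∑[ j < n ] 𝐧 (lookup as j)
      rest  = ∑[ i < m ] (∑[ j < n ] 𝐧 (A [ i , j ]))
      rearrange : ∀ p s q → p + (s + q) ≡ p + q + s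
      rearrange = solve 3 (λ p s q → p :+ (s :+ q) := p :+ q :+ s) refl
      rearrange′ : ∀ t e s → t + 2 * e + s ≡ t + s + 2 * e
      rearrange′ = solve 3 (λ t e s → t :+ con 2 :* e :+ s := t :+ s :+ con 2 :* e) refl
      rearrange″ : ∀ t a e → t + 0 + 2 * a + 2 * e ≡ t + 2 * (a + e)
      rearrange″ = solve 3 (λ t a e → t :+ con 0 :+ con 2 :* a :+ con 2 :* e := t :+ con 2 :* (a :+ e)) refl

    module _ (γ : Partition) (core : IsCore r γ) (m n : ℕ) where

      correspondence : Bijection (setoid (Matrix r m n)) (TableauPairs r m n γ)
      correspondence = record { to = to ; cong = λ { refl → refl } ; bijective = injective , surjective }
        where
        to : Matrix r m n → TableauPair r m n γ
        to A = let μ , P , Q , _ = insert (constant n) A in μ , P , Q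
        growth : ∀ A → let _ , P , Q = to A in MatrixGrowth (constant n) A P Q
        growth A = proj₂ (proj₂ (proj₂ (insert (constant n) A)))
        injective : ∀ {A B} → Setoid._≈_ (TableauPairs r m n γ) (to A) (to B) → A ≡ B
        injective {A} {B} e =
          proj₂ (extract-unique (growth A) (growth B) (cong proj₁ e) (cong proj₂ e))
        surjective : ∀ y → Σ[ A ∈ Matrix r m n ] (∀ {B} → B ≡ A → Setoid._≈_ (TableauPairs r m n γ) (to B) y)
        surjective (μ , P , Q) =
          -- The border `T` that is left over runs from `γ` into `γ`; nothing lies below the core,
          -- so its shapes are constant and inserting `A` reproduces those of `P` and `Q`.
          let T , A , G = extract core P Q
          in A , λ { refl → let eP , eQ = insert-unique (growth A) G (sym (Cores.tableau-into-core core T))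
                            in cong₂ _,_ eP eQ }

      statistics : (A : Matrix r m n) (μ : Partition)
        (P : SemistandardTableau r n γ μ) (Q : TransposeSemistandardTableau r m γ μ) →
        Setoid._≈_ (TableauPairs r m n γ) (Bijection.to correspondence A) (μ , P , Q) →
          wt P ≡ tabulate (λ j → ∑[ i < m ] ∣ A [ i , j ] ∣)
        × wt Q ≡ tabulate (λ i → ∑[ j < n ] ∣ A [ i , j ] ∣)
        × spin P ℚ.+ spin Q ≡ + (∑[ i < m ] (∑[ j < n ] 𝐧 (A [ i , j ]))) ℚ./ 1
      statistics A μ P Q e with insert (constant {ℤ._<_} {r} n {γ}) A
      ... | μ′ , P′ , Q′ , G with shapes⇒end P′ P (cong proj₁ e)
      ...   | refl =
        let ewt , ewt′ , eheight = matrix-statistics G P Q (cong proj₁ e) (cong proj₂ e) in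
        by-entries _ (λ j → trans (ewt j) (cong (_+ ∑[ i < m ] ∣ A [ i , j ] ∣) (wt-constant n j))) ,
        by-entries _ ewt′ ,
        (begin
          spin P ℚ.+ spin Q                                    ≡⟨ cong₂ ℚ._+_ (spin-tableauHeight P) (spin-tableauHeight Q) ⟩
          + tableauHeight P ℚ./ 2 ℚ.+ + tableauHeight Q ℚ./ 2  ≡⟨ half-+ (tableauHeight P) (tableauHeight Q) ⟩
          + (tableauHeight P + tableauHeight Q) ℚ./ 2          ≡⟨ cong (λ h → + h ℚ./ 2) (trans eheight (cong (_+ 2 * charge) (tableauHeight-constant {ℤ._<_} {r} n {γ}))) ⟩
          + (2 * charge) ℚ./ 2                                 ≡⟨ half-double charge ⟩
          + charge ℚ./ 1                                       ∎)
        where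
        open ≡-Reasoning
        charge : ℕ
        charge = ∑[ i < m ] (∑[ j < n ] 𝐧 (A [ i , j ]))
        by-entries : ∀ {k} {w : Vec ℕ k} (f : Fin k → ℕ) → (∀ j → lookup w j ≡ f j) → w ≡ tabulate f
        by-entries {w = w} f e = trans (sym (Vecₚ.tabulate∘lookup w)) (Vecₚ.tabulate-cong e)

open import Defs
open import Data.Integer.Base using (+_)
open import Data.Nat.Base using (ℕ; NonZero)
open import Data.Product using (Σ-syntax; _×_; _,_)
open import Data.Rational.Base using (_+_; _/_)
open import Data.Vec.Base using (tabulate)
open import Function.Bundles using (Bijection)
open import Relation.Binary.Bundles using (Setoid)
open import Relation.Binary.PropositionalEquality using (_≡_; setoid)

open import Data.Nat.Base using (zero; suc; ≢-nonZero⁻¹)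
open import Relation.Binary.PropositionalEquality using (refl)
open import Relation.Nullary.Negation using (contradiction)
open RibbonCorrespondence using (module Grid)

corollary6p4 : (r : ℕ) .{{_ : NonZero r}} (γ : Partition) → IsCore r γ → (m n : ℕ) →
    Σ[ φ ∈ Bijection (setoid (Matrix r m n)) (TableauPairs r m n γ) ]
    ((A : Matrix r m n) (μ : Partition)
    (P : SemistandardTableau r n γ μ) (Q : TransposeSemistandardTableau r m γ μ) →
    Setoid._≈_ (TableauPairs r m n γ) (Bijection.to φ A) (μ , P , Q) →
    wt P ≡ tabulate (λ j → ∑[ i < m ] ∣ A [ i , j ] ∣)
    × wt Q ≡ tabulate (λ i → ∑[ j < n ] ∣ A [ i , j ] ∣)
    × spin P + spin Q ≡ + (∑[ i < m ] (∑[ j < n ] 𝐧 (A [ i , j ]))) / 1)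
corollary6p4 zero    γ core m n = contradiction refl (≢-nonZero⁻¹ 0)
corollary6p4 (suc R) γ core m n = Grid.correspondence R γ core m n , Grid.statistics R γ core m n
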